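{- If $G$ is a bicyclic graph of order $n\ge 7$, then $\operatorname{CW}(G,x)\preceq \operatorname{CW}(B_n,x)$.
   Context: All graphs are finite, simple and undirected. A bicyclic graph is a connected graph $G$ with $|E(G)|=|V(G)|+1$. $B_n$ is the graph with vertices $c,a,b,w$ and $n-4$ further vertices, where $c$ is adjacent to all other vertices and the only other edges are $ab$ and $aw$. A graph is cop-win if, in the game of Cops and Robber with one cop (cop places, then robber places, then they alternately move to an adjacent vertex or stay put; the cop wins on occupying the robber's vertex), the cop can guarantee capture. For a graph $G$ of order $n$, $W_k(G)$ is the number of $k$-subsets of $V(G)$ inducing a cop-win subgraph, and the cop-win polynomial is $\operatorname{CW}(G,x)=\sum_{k=1}^n W_k(G)x^k$. For polynomials $A(x)=\sum_{k=0}^n a_kx^k$, $B(x)=\sum_{k=0}^m b_kx^k$, write $B(x)\preceq A(x)$ if $m\le n$ and $b_k\le a_k$ for all $k$. -}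

module Defs where

open import Data.Nat using (ℕ; zero; suc; _≤_; _<ᵇ_)
open import Data.Bool using (Bool; true; false; T; _∧_; if_then_else_)
open import Data.Fin using (Fin; toℕ)
open import Data.Fin.Subset using (Subset; _∈_; ∣_∣)
open import Data.List using (List; []; _∷_; map; _++_; allFin)
open import Data.Nat.ListAction using (sum)
open import Data.Vec using (_∷_; [])
open import Data.Product using (Σ; _×_; _,_; ∃)
open import Data.Sum using (_⊎_)
open import Relation.Nullary using (¬_)
open import Relation.Binary.PropositionalEquality using (_≡_; refl)

record Graph (n : ℕ) : Set where
  field
    adj    : Fin n → Fin n → Bool
    sym    : ∀ u v → adj u v ≡ adj v u
    irrefl : ∀ v → adj v v ≡ false
open Graph public

edgeCount : ∀ {n} → Graph n → ℕ
edgeCount {n} G =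
  sum (map (λ i → sum (map (λ j → if (toℕ i <ᵇ toℕ j) ∧ adj G i j then 1 else 0)
                           (allFin n)))
           (allFin n))

data Reach {n} (G : Graph n) : Fin n → Fin n → Set where
  here : ∀ {v} → Reach G v v
  step : ∀ {u w v} → T (adj G u w) → Reach G w v → Reach G u v

Connected : ∀ {n} → Graph n → Set
Connected G = ∀ u v → Reach G u v

Bicyclic : ∀ {n} → Graph n → Set
Bicyclic {n} G = Connected G × edgeCount G ≡ suc n

module Game {V : Set} (E : V → V → Set) where

  Move : V → V → Set
  Move x y = (x ≡ y) ⊎ E x y

  -- positions from which the cop can force capture (in finitely many moves)
  mutual
    data CopTurn (c r : V) : Set where
      move : ∀ c' → Move c c' → (c' ≡ r) ⊎ RobTurn c' r → CopTurn c r

    -- robber (at r) to move, cop at c (c ≢ r)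
    data RobTurn (c r : V) : Set where
      respond : (∀ r' → Move r r' → (r' ≡ c) ⊎ CopTurn c r') → RobTurn c r

  CopWin : Set
  CopWin = Σ V λ c₀ → ∀ r₀ → (r₀ ≡ c₀) ⊎ CopTurn c₀ r₀

InducedCopWin : ∀ {n} → Graph n → Subset n → Set
InducedCopWin {n} G S =
  Game.CopWin {Σ (Fin n) (λ v → v ∈ S)} (λ x y → T (adj G (Data.Product.proj₁ x) (Data.Product.proj₁ y)))

allSubsets : ∀ n → List (Subset n)
allSubsets zero    = [] ∷ []
allSubsets (suc n) = map (false ∷_) (allSubsets n) ++ map (true ∷_) (allSubsets n)

data Count {A : Set} (P : A → Set) : List A → ℕ → Set where
  nil  : Count P [] 0
  yes  : ∀ {x xs m} → P x → Count P xs m → Count P (x ∷ xs) (suc m)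
  no   : ∀ {x xs m} → ¬ P x → Count P xs m → Count P (x ∷ xs) m

W : ∀ {n} → Graph n → ℕ → ℕ → Set
W {n} G k w = Count (λ S → (∣ S ∣ ≡ k) × InducedCopWin G S) (allSubsets n) w

-- coefficient of x^k in CW(G,x) is w  (CW has zero constant term)
CWcoeff : ∀ {n} → Graph n → ℕ → ℕ → Set
CWcoeff G zero    w = w ≡ 0
CWcoeff G (suc k) w = W G (suc k) w

-- CW(H,x) ⪯ CW(G,x): coefficientwise ≤.  (With natural-number coefficients
-- this also forces deg CW(H) ≤ deg CW(G).)
_⪯CW_ : ∀ {m n} → Graph m → Graph n → Set
H ⪯CW G = ∀ k b a → CWcoeff H k b → CWcoeff G k a → b ≤ a

-- B_n : c = 0, a = 1, b = 2, w = 3; c universal, plus edges ab, aw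

adjB : ℕ → ℕ → Bool
adjB zero    zero    = false
adjB zero    (suc _) = true
adjB (suc _) zero    = true
adjB 1 2 = true
adjB 2 1 = true
adjB 1 3 = true
adjB 3 1 = true
adjB _ _ = false

adjB-sym : ∀ i j → adjB i j ≡ adjB j i
adjB-sym zero zero = refl
adjB-sym zero (suc j) = refl
adjB-sym (suc i) zero = refl
adjB-sym 1 1 = refl
adjB-sym 1 2 = refl
adjB-sym 1 3 = refl
adjB-sym 1 (suc (suc (suc (suc j)))) = refl
adjB-sym 2 1 = refl
adjB-sym 2 2 = refl
adjB-sym 2 3 = refl
adjB-sym 2 (suc (suc (suc (suc j)))) = refl
adjB-sym 3 1 = refl
adjB-sym 3 2 = refl
adjB-sym 3 3 = refl
adjB-sym 3 (suc (suc (suc (suc j)))) = refl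
adjB-sym (suc (suc (suc (suc i)))) 1 = refl
adjB-sym (suc (suc (suc (suc i)))) 2 = refl
adjB-sym (suc (suc (suc (suc i)))) 3 = refl
adjB-sym (suc (suc (suc (suc i)))) (suc (suc (suc (suc j)))) = refl

adjB-irrefl : ∀ i → adjB i i ≡ false
adjB-irrefl zero = refl
adjB-irrefl 1 = refl
adjB-irrefl 2 = refl
adjB-irrefl 3 = refl
adjB-irrefl (suc (suc (suc (suc i)))) = refl

B : (n : ℕ) → Graph n
B n = record
  { adj    = λ u v → adjB (toℕ u) (toℕ v)
  ; sym    = λ u v → adjB-sym (toℕ u) (toℕ v)
  ; irrefl = λ v → adjB-irrefl (toℕ v)
  }

{-# OPTIONS --safe #-}
module Submission where

-- Every set containing the vertex c of B_n is cop-win, and so is {1,2,3}.  Hence, for k ≥ 3, it suffices to map the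
-- cop-win k-sets of G injectively to k-sets containing a fixed vertex c of G, with one spare value if k = 3.
-- Sets containing c are kept.  A connected set S avoiding c inside a tree component of G − c has a top t, and all
-- other members have their parents in S; it goes to S − a + c, where a is the parent of a member b and is chosen so that
-- the result is disconnected.  Whatever b is chosen, S can be recovered.  No b exists exactly if S joins
-- two or three neighbours of c to the root q, so that S + c contains a cycle; these few sets receive other
-- values that are disconnected or contain an induced long cycle.  If the two cycles of G share an edge, c and q are
-- the two branch vertices; otherwise G is glued from two unicyclic parts.

-- The bound `3 ≤ k` enters at a chain of vertices ending in a neighbour of the centre: in a chain
-- of two, exchanging the upper vertex for the centre leaves an edge.
--
-- Values are made disconnected because cop-win sets are connected, so that such values never meet a
-- kept set. The obstacle is the sets without a suitable `b`: a part with one cycle has at most one,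
-- and two cycles with a common edge give at most four, but their replacements must differ from each
-- other, from all cop-win sets and from all regular images. Long legs leave room for this among
-- their own vertices. With short legs the spare set of `B n` absorbs one triple, and further
-- replacements use vertices off the legs. Two shapes produce the bound 7: legs with 2, 1 and 1
-- inner vertices occupy six vertices and ask for one more, and three legs with one inner vertex
-- each occupy five and ask for two more.

open import Defs renaming (sym to adj-sym; irrefl to adj-irrefl; yes to count-yes; no to count-no; nil to count-nil; here to reach-here; step to reach-step)
open import Data.Nat using (ℕ; zero; suc; _+_; _≤_; _<_; z≤n; s≤s; _<ᵇ_)
open import Data.Nat.Properties using (≤-trans; ≤-reflexive; m≤n⇒m≤1+n; ≤-pred; +-comm; +-suc; +-cancelˡ-≡; ≤-antisym; <⇒<ᵇ; <ᵇ⇒<)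
import Data.Nat.Properties as ℕₚ
open import Data.Bool using (Bool; true; false; T; _∧_; if_then_else_)
open import Data.Fin using (Fin; zero; suc; toℕ)
open import Data.Fin.Properties using (_≟_; any?; all?; toℕ-injective)
open import Data.Fin.Subset using (Subset; _∈_; _∉_; ∣_∣; Nonempty)
open import Data.Fin.Subset.Properties using (_∈?_; ⊆-antisym; nonempty?; Empty-unique; ∣⊥∣≡0; ∣⊤∣≡n; ∉⊥)
open import Data.Vec using (_∷_; []; _[_]≔_; here; there)
open import Data.List using (List; []; _∷_; map; _++_; allFin; length; filter; cartesianProduct)
open import Data.List.Properties using (length-map; length-tabulate)
open import Data.List.Membership.Propositional using () renaming (_∈_ to _∈ˡ_; _∉_ to _∉ˡ_)
open import Data.List.Membership.Propositional.Properties using (∈-map⁺; ∈-map⁻; ∈-++⁺ˡ; ∈-++⁺ʳ; ∈-allFin; ∈-filter⁺; ∈-filter⁻; ∈-cartesianProduct⁺)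
open import Data.List.Relation.Unary.Any using () renaming (here to hereˡ; there to thereˡ)
open import Data.List.Relation.Unary.All using ([]; _∷_)
import Data.List.Relation.Unary.All as All
open import Data.List.Relation.Unary.AllPairs using ([]; _∷_)
open import Data.List.Relation.Unary.Unique.Propositional using (Unique)
import Data.List.Relation.Unary.Unique.Propositional.Properties as Unique
open import Data.Nat.ListAction using (sum)
open import Data.Maybe using (Maybe; just; nothing)
open import Data.Maybe.Properties using (just-injective)
open import Data.Product using (Σ; ∃; _×_; _,_; proj₁; proj₂)
open import Data.Sum using (_⊎_; inj₁; inj₂; [_,_]′)
open import Data.Empty using (⊥; ⊥-elim)
open import Data.Unit using (⊤; tt)
open import Function using (_∘_; id; case_of_)
open import Relation.Nullary using (¬_; Dec; yes; no)
open import Relation.Nullary.Decidable using (_×-dec_; _⊎-dec_; _→-dec_; ¬?; T?)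
open import Relation.Binary.PropositionalEquality using (_≡_; _≢_; refl; sym; trans; cong; subst; ≢-sym)
open import Relation.Binary.Definitions using (tri<; tri≈; tri>)
import Data.Fin.Subset as Subset

-- Subsets and counting

module _ {n : ℕ} where

  add del : Subset n → Fin n → Subset n
  add S v = S [ v ]≔ true
  del S v = S [ v ]≔ false

  swap : Subset n → Fin n → Fin n → Subset n
  swap S x y = add (del S x) y

∈-add-new : ∀ {n} (S : Subset n) v → v ∈ add S v
∈-add-new (_ ∷ S) zero = here
∈-add-new (_ ∷ S) (suc v) = there (∈-add-new S v)

∈-add-old : ∀ {n} (S : Subset n) v {u} → u ∈ S → u ∈ add S v
∈-add-old (_ ∷ S) zero here = here
∈-add-old (_ ∷ S) zero (there p) = there p
∈-add-old (_ ∷ S) (suc v) here = here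
∈-add-old (_ ∷ S) (suc v) (there p) = there (∈-add-old S v p)

∈-add⁻ : ∀ {n} (S : Subset n) v {u} → u ∈ add S v → u ≡ v ⊎ u ∈ S
∈-add⁻ (_ ∷ S) zero here = inj₁ refl
∈-add⁻ (_ ∷ S) zero (there p) = inj₂ (there p)
∈-add⁻ (_ ∷ S) (suc v) here = inj₂ here
∈-add⁻ (_ ∷ S) (suc v) (there p) with ∈-add⁻ S v p
... | inj₁ refl = inj₁ refl
... | inj₂ q = inj₂ (there q)

∈-del : ∀ {n} (S : Subset n) v {u} → u ≢ v → u ∈ S → u ∈ del S v
∈-del (_ ∷ S) zero u≢v here = ⊥-elim (u≢v refl)
∈-del (_ ∷ S) zero u≢v (there p) = there p
∈-del (_ ∷ S) (suc v) u≢v here = here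
∈-del (_ ∷ S) (suc v) u≢v (there p) = there (∈-del S v (u≢v ∘ cong suc) p)

∈-del⁻ : ∀ {n} (S : Subset n) v {u} → u ∈ del S v → u ≢ v × u ∈ S
∈-del⁻ (_ ∷ S) zero (there p) = (λ ()) , there p
∈-del⁻ (_ ∷ S) (suc v) here = (λ ()) , here
∈-del⁻ (_ ∷ S) (suc v) (there p) with ∈-del⁻ S v p
... | u≢v , q = (λ { refl → u≢v refl }) , there q

∣add∣ : ∀ {n} (S : Subset n) v → v ∉ S → ∣ add S v ∣ ≡ suc ∣ S ∣
∣add∣ (true ∷ S) zero v∉ = ⊥-elim (v∉ here)
∣add∣ (false ∷ S) zero v∉ = refl
∣add∣ (true ∷ S) (suc v) v∉ = cong suc (∣add∣ S v (v∉ ∘ there))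
∣add∣ (false ∷ S) (suc v) v∉ = ∣add∣ S v (v∉ ∘ there)

∣del∣ : ∀ {n} (S : Subset n) v → v ∈ S → suc ∣ del S v ∣ ≡ ∣ S ∣
∣del∣ (true ∷ S) zero here = refl
∣del∣ (true ∷ S) (suc v) (there p) = cong suc (∣del∣ S v p)
∣del∣ (false ∷ S) (suc v) (there p) = ∣del∣ S v p

module _ {n : ℕ} where

  ⊆⊇⇒≡ : {S S' : Subset n} → (∀ {u} → u ∈ S → u ∈ S') → (∀ {u} → u ∈ S' → u ∈ S) → S ≡ S'
  ⊆⊇⇒≡ f g = ⊆-antisym f g

  ∈-swap-new : (S : Subset n) → ∀ x y → y ∈ swap S x y
  ∈-swap-new S x y = ∈-add-new (del S x) y

  ∈-swap-old : (S : Subset n) → ∀ x y {u} → u ≢ x → u ∈ S → u ∈ swap S x y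
  ∈-swap-old S x y u≢x u∈S = ∈-add-old (del S x) y (∈-del S x u≢x u∈S)

  ∈-swap⁻ : (S : Subset n) → ∀ x y {u} → u ∈ swap S x y → u ≡ y ⊎ (u ≢ x × u ∈ S)
  ∈-swap⁻ S x y p with ∈-add⁻ (del S x) y p
  ... | inj₁ e = inj₁ e
  ... | inj₂ q = inj₂ (∈-del⁻ S x q)

  ∈-swap⁻-old : (S : Subset n) → ∀ x y {u} → u ≢ y → u ∈ swap S x y → u ≢ x × u ∈ S
  ∈-swap⁻-old S x y u≢y p with ∈-swap⁻ S x y p
  ... | inj₁ e = ⊥-elim (u≢y e)
  ... | inj₂ q = q

  ∉-swap-out : (S : Subset n) → ∀ x y → x ≢ y → x ∉ swap S x y
  ∉-swap-out S x y x≢y p = proj₁ (∈-swap⁻-old S x y x≢y p) refl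

  ∣swap∣ : (S : Subset n) → ∀ x y → x ∈ S → y ∉ S → ∣ swap S x y ∣ ≡ ∣ S ∣
  ∣swap∣ S x y x∈S y∉S =
    trans (∣add∣ (del S x) y (λ p → y∉S (proj₂ (∈-del⁻ S x p)))) (∣del∣ S x x∈S)

  swap-injective : (S S' : Subset n) → ∀ x y → x ∈ S → x ∈ S' → y ∉ S → y ∉ S' →
                   swap S x y ≡ swap S' x y → S ≡ S'
  swap-injective S S' x y xS xS' yS yS' e = ⊆⊇⇒≡ (half S S' xS' yS e) (half S' S xS yS' (sym e))
    where
    half : (S S' : Subset n) → x ∈ S' → y ∉ S → swap S x y ≡ swap S' x y → ∀ {u} → u ∈ S → u ∈ S'
    half S S' xS' yS e {u} uS with u ≟ x
    ... | yes refl = xS'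
    ... | no u≢x = proj₂ (∈-swap⁻-old S' x y (λ { refl → yS uS }) (subst (u ∈_) e (∈-swap-old S x y u≢x uS)))

  -- On sets containing `x` this is the action of the transposition of `x` and `y`, hence injective
  -- there. It carries sets around one centre to sets around another.
  recentre : Fin n → Fin n → Subset n → Subset n
  recentre x y S with y ∈? S
  ... | yes _ = S
  ... | no _ = swap S x y

  recentre-centre : ∀ x y S → y ∈ recentre x y S
  recentre-centre x y S with y ∈? S
  ... | yes y∈ = y∈
  ... | no _ = ∈-swap-new S x y

  recentre-members : ∀ x y S {v} → v ∈ recentre x y S → v ≡ y ⊎ v ∈ S
  recentre-members x y S v∈ with y ∈? S
  ... | yes _ = inj₂ v∈
  ... | no _ with ∈-swap⁻ S x y v∈
  ...   | inj₁ e = inj₁ e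
  ...   | inj₂ (_ , p) = inj₂ p

  recentre-kept : ∀ x y S {v} → v ≢ x → v ∈ S → v ∈ recentre x y S
  recentre-kept x y S v≢x v∈ with y ∈? S
  ... | yes _ = v∈
  ... | no _ = ∈-swap-old S x y v≢x v∈

  recentre-size : ∀ x y S → x ∈ S → ∣ recentre x y S ∣ ≡ ∣ S ∣
  recentre-size x y S x∈ with y ∈? S
  ... | yes _ = refl
  ... | no y∉ = ∣swap∣ S x y x∈ y∉

  recentre-injective : ∀ x y S S' → x ∈ S → x ∈ S' → recentre x y S ≡ recentre x y S' → S ≡ S'
  recentre-injective x y S S' x∈ x∈' e with y ∈? S | y ∈? S'
  ... | yes _ | yes _ = e
  ... | no y∉ | no y∉' = swap-injective S S' x y x∈ x∈' y∉ y∉' e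
  ... | yes _ | no y∉' = ⊥-elim (∉-swap-out S' x y (λ { refl → y∉' x∈' }) (subst (x ∈_) e x∈))
  ... | no y∉ | yes _ = ⊥-elim (∉-swap-out S x y (λ { refl → y∉ x∈ }) (subst (x ∈_) (sym e) x∈'))

  positive⇒Nonempty : (S : Subset n) → 1 ≤ ∣ S ∣ → Nonempty S
  positive⇒Nonempty S p with nonempty? S
  ... | yes ne = ne
  ... | no ¬ne with trans (cong ∣_∣ (Empty-unique ¬ne)) (∣⊥∣≡0 n)
  ...   | e with subst (1 ≤_) e p
  ...     | ()

  ∣del∣≥ : (S : Subset n) → ∀ v → ∣ S ∣ ≤ suc ∣ del S v ∣
  ∣del∣≥ S v with v ∈? S
  ... | yes p = ≤-reflexive (sym (∣del∣ S v p))
  ... | no ¬p = m≤n⇒m≤1+n (≤-reflexive (cong ∣_∣ {S} {del S v} (⊆⊇⇒≡ (λ {u} uS → ∈-del S v (λ { refl → ¬p uS }) uS) (λ uD → proj₂ (∈-del⁻ S v uD)))))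

  member-outside : (S : Subset n) (xs : List (Fin n)) → length xs < ∣ S ∣ → ∃ λ v → v ∈ S × v ∉ˡ xs
  member-outside S [] p with positive⇒Nonempty S p
  ... | v , vS = v , vS , λ ()
  member-outside S (x ∷ xs) p with member-outside (del S x) xs (≤-pred (≤-trans p (∣del∣≥ S x)))
  ... | v , vD , v∉ = v , proj₂ (∈-del⁻ S x vD) , λ { (hereˡ e) → proj₁ (∈-del⁻ S x vD) e ; (thereˡ q) → v∉ q }

  two-elements : (S : Subset n) → ∣ S ∣ ≡ 2 → ∀ {x y} → x ∈ S → y ∈ S → x ≢ y → ∀ {v} → v ∈ S → v ≡ x ⊎ v ≡ y
  two-elements S e {x} {y} xS yS x≢y {v} vS with v ≟ x | v ≟ y
  ... | yes p | _ = inj₁ p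
  ... | _ | yes p = inj₂ p
  ... | no v≢x | no v≢y = ⊥-elim (contra (trans (cong suc (trans (cong suc (∣del∣ _ v v∈)) (∣del∣ _ y y∈))) (trans (∣del∣ S x xS) e)))
    where
    y∈ : y ∈ del S x
    y∈ = ∈-del S x (≢-sym x≢y) yS
    v∈ : v ∈ del (del S x) y
    v∈ = ∈-del _ y v≢y (∈-del S x v≢x vS)
    contra : ∀ {m} → suc (suc (suc m)) ≡ 2 → ⊥
    contra ()

∈-singleton-length : ∀ {A : Set} {x : A} {ys} → x ∈ˡ ys → ∃ λ zs → length ys ≡ suc (length zs) × (∀ {y} → y ∈ˡ ys → y ≢ x → y ∈ˡ zs)
∈-singleton-length {ys = y ∷ ys} (hereˡ refl) = ys , refl , λ { (hereˡ e) ne → ⊥-elim (ne e) ; (thereˡ p) _ → p }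
∈-singleton-length {ys = y ∷ ys} (thereˡ p) with ∈-singleton-length p
... | zs , e , f = y ∷ zs , cong suc e , λ { (hereˡ e) _ → hereˡ e ; (thereˡ q) ne → thereˡ (f q ne) }

-- A relation takes the place of a function because the later values are found by case analysis on
-- proofs and depend on choices; it is enough that a value determines its source.
relational-pigeonhole : ∀ {A B : Set} (R : A → B → Set) →
  (∀ {x x' y} → R x y → R x' y → x ≡ x') →
  ∀ {xs : List A} {ys : List B} → Unique xs → (∀ {x} → x ∈ˡ xs → ∃ λ y → y ∈ˡ ys × R x y) →
  length xs ≤ length ys
relational-pigeonhole R inj {[]} u f = z≤n
relational-pigeonhole R inj {x ∷ xs} (x∉ ∷ u) f with f (hereˡ refl)
... | y , y∈ , r with ∈-singleton-length y∈
...   | zs , e , g = ≤-trans (s≤s (relational-pigeonhole R inj u f')) (≤-reflexive (sym e))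
  where
  f' : ∀ {x'} → x' ∈ˡ xs → ∃ λ y → y ∈ˡ zs × R x' y
  f' {x'} p with f (thereˡ p)
  ... | y' , y'∈ , r' = y' , g y'∈ (λ { refl → All.lookup x∉ p (inj r r') }) , r'

module _ {A : Set} {P : A → Set} where

  -- A `Count` derivation itself records which entries satisfy `P`, so it yields the list of these
  -- entries without a decision procedure for the game.
  Count-witnesses : ∀ {xs m} → Unique xs → Count P xs m →
    ∃ λ ys → length ys ≡ m × Unique ys × (∀ {y} → y ∈ˡ ys → y ∈ˡ xs × P y) × (∀ {x} → x ∈ˡ xs → P x → x ∈ˡ ys)
  Count-witnesses u count-nil = [] , refl , [] , (λ ()) , λ ()
  Count-witnesses {x ∷ xs} (x∉ ∷ u) (count-yes px c) with Count-witnesses u c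
  ... | ys , e , u' , f , g = x ∷ ys , cong suc e , All.tabulate (λ p → All.lookup x∉ (proj₁ (f p))) ∷ u' ,
        (λ { (hereˡ refl) → hereˡ refl , px ; (thereˡ p) → thereˡ (proj₁ (f p)) , proj₂ (f p) }) ,
        (λ { (hereˡ refl) _ → hereˡ refl ; (thereˡ p) q → thereˡ (g p q) })
  Count-witnesses (x∉ ∷ u) (count-no ¬px c) with Count-witnesses u c
  ... | ys , e , u' , f , g = ys , e , u' , (λ p → thereˡ (proj₁ (f p)) , proj₂ (f p)) ,
        (λ { (hereˡ refl) q → ⊥-elim (¬px q) ; (thereˡ p) q → g p q })

allSubsets-complete : ∀ {n} (S : Subset n) → S ∈ˡ allSubsets n
allSubsets-complete [] = hereˡ refl
allSubsets-complete {suc n} (false ∷ S) = ∈-++⁺ˡ (∈-map⁺ (false ∷_) (allSubsets-complete S))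
allSubsets-complete {suc n} (true ∷ S) = ∈-++⁺ʳ (map (false ∷_) (allSubsets n)) (∈-map⁺ (true ∷_) (allSubsets-complete S))

allSubsets-unique : ∀ n → Unique (allSubsets n)
allSubsets-unique zero = [] ∷ []
allSubsets-unique (suc n) =
  Unique.++⁺ (Unique.map⁺ tail-≡ (allSubsets-unique n)) (Unique.map⁺ tail-≡ (allSubsets-unique n)) disjoint
  where
  tail-≡ : ∀ {b} {S S' : Subset n} → b ∷ S ≡ b ∷ S' → S ≡ S'
  tail-≡ refl = refl
  disjoint : ∀ {S} → S ∈ˡ map (false ∷_) (allSubsets n) × S ∈ˡ map (true ∷_) (allSubsets n) → ⊥
  disjoint (p , q) with ∈-map⁻ (false ∷_) p | ∈-map⁻ (true ∷_) q
  ... | _ , _ , refl | _ , _ , ()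

Count-≤ : ∀ {n} {P Q : Subset n → Set} {a b} (R : Subset n → Subset n → Set) →
  (∀ {S S' Y} → R S Y → R S' Y → S ≡ S') → (∀ {S} → P S → ∃ λ Y → Q Y × R S Y) →
  Count P (allSubsets n) b → Count Q (allSubsets n) a → b ≤ a
Count-≤ {n} R inj f cP cQ with Count-witnesses (allSubsets-unique n) cP | Count-witnesses (allSubsets-unique n) cQ
... | xs , refl , u , p , _ | ys , refl , _ , _ , q =
  relational-pigeonhole R inj u λ x∈ → let (Y , qY , r) = f (proj₂ (p x∈)) in Y , q (allSubsets-complete Y) qY , r

-- The game on an induced subgraph

module _ {n : ℕ} (G : Graph n) where

  Adj : Fin n → Fin n → Set
  Adj u v = T (adj G u v)

  Adj? : ∀ u v → Dec (Adj u v)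
  Adj? u v = T? (adj G u v)

  Adj-sym : ∀ {u v} → Adj u v → Adj v u
  Adj-sym {u} {v} = subst T (adj-sym G u v)

  Adj-irrefl : ∀ {u v} → Adj u v → u ≢ v
  Adj-irrefl {u} a refl = subst T (adj-irrefl G u) a

  data Path (S : Subset n) (u : Fin n) : Fin n → Set where
    stop : u ∈ S → Path S u u
    move : ∀ {v w} → Path S u v → Adj v w → w ∈ S → Path S u w

  ConnectedIn : Subset n → Set
  ConnectedIn S = ∀ {u v} → u ∈ S → v ∈ S → Path S u v

  Path-end : ∀ {S u v} → Path S u v → v ∈ S
  Path-end (stop p) = p
  Path-end (move _ _ p) = p

  Path-trans : ∀ {S u v w} → Path S u v → Path S v w → Path S u w
  Path-trans p (stop _) = p
  Path-trans p (move q a m) = move (Path-trans p q) a m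

  Path-sym : ∀ {S u v} → Path S u v → Path S v u
  Path-sym (stop p) = stop p
  Path-sym (move p a m) = Path-trans (move (stop m) (Adj-sym a) (Path-end p)) (Path-sym p)

  Path-crossing : ∀ {S u v} {X : Fin n → Set} → (∀ x → Dec (X x)) → Path S u v → ¬ X u → X v →
                  ∃ λ a → ∃ λ b → a ∈ S × b ∈ S × Adj a b × ¬ X a × X b
  Path-crossing X? (stop _) ¬xu xv = ⊥-elim (¬xu xv)
  Path-crossing X? (move {v} {w} p a m) ¬xu xw with X? v
  ... | yes xv = Path-crossing X? p ¬xu xv
  ... | no ¬xv = v , w , Path-end p , m , a , ¬xv , xw

  -- The certificate for every disconnected value below: `X` describes one side of the separation
  -- and may be phrased with ancestors in a forest.
  closed⇒¬connected : ∀ {S u v} (X : Fin n → Set) → u ∈ S → v ∈ S → X u → ¬ X v →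
                      (∀ {a b} → a ∈ S → b ∈ S → Adj a b → X a → X b) → ¬ ConnectedIn S
  closed⇒¬connected {S} {u} X u∈ v∈ xu ¬xv closed conn = ¬xv (go (conn u∈ v∈))
    where
    go : ∀ {w} → Path S u w → X w
    go (stop _) = xu
    go (move p a m) = closed (Path-end p) m a (go p)

  module _ {S : Subset n} where
    private
      V : Set
      V = Σ (Fin n) (_∈ S)
      open Game {V} (λ x y → Adj (proj₁ x) (proj₁ y)) renaming (move to step-to)

    -- Even a robber who never moves is caught, and against this robber the moves of the cop trace a
    -- path.
    CopTurn⇒Path : ∀ {c r} → CopTurn c r → Path S (proj₁ c) (proj₁ r)
    CopTurn⇒Path {c} (step-to c' m e) = Path-trans (first m) (rest e)
      where
      first : Move c c' → Path S (proj₁ c) (proj₁ c')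
      first (inj₁ refl) = stop (proj₂ c)
      first (inj₂ a) = move (stop (proj₂ c)) a (proj₂ c')
      rest : ∀ {r} → (c' ≡ r) ⊎ RobTurn c' r → Path S (proj₁ c') (proj₁ r)
      rest (inj₁ refl) = stop (proj₂ c')
      rest {r} (inj₂ (respond f)) with f r (inj₁ refl)
      ... | inj₁ refl = stop (proj₂ c')
      ... | inj₂ t = CopTurn⇒Path t

    copwin⇒connected : InducedCopWin G S → ConnectedIn S
    copwin⇒connected (c₀ , win) u∈ v∈ = Path-trans (Path-sym (from u∈)) (from v∈)
      where
      from : ∀ {v} (v∈ : v ∈ S) → Path S (proj₁ c₀) v
      from {v} v∈ with win (v , v∈)
      ... | inj₁ refl = stop v∈
      ... | inj₂ t = CopTurn⇒Path t

    -- Every vertex of P has two neighbours in P; without triangles, the cop can never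
    -- guard a vertex of P together with both of these neighbours, so the robber stays in P.
    triangle-free⇒¬copwin : (P : Fin n → Set) → (∀ {v} → P v → v ∈ S) → ∃ P →
      (∀ {v} → P v → ∃ λ x → ∃ λ y → P x × P y × x ≢ y × Adj v x × Adj v y) →
      (∀ {u v w} → u ∈ S → v ∈ S → w ∈ S → Adj u v → Adj v w → Adj u w → ⊥) →
      ¬ InducedCopWin G S
    triangle-free⇒¬copwin P P⊆S (p₀ , Pp₀) nbrs no-triangle (c₀ , win) = start
      where
      Safe : V → V → Set
      Safe c r = P (proj₁ r) × proj₁ c ≢ proj₁ r × ¬ Adj (proj₁ c) (proj₁ r)

      escape : ∀ c r → P (proj₁ r) → proj₁ c ≢ proj₁ r → ∃ λ r' → Move r r' × Safe c r'
      escape (c , c∈) (r , r∈) Pr c≢r with Adj? c r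
      ... | no ¬a = (r , r∈) , inj₁ refl , Pr , c≢r , ¬a
      ... | yes a with nbrs Pr
      ...   | x , y , Px , Py , x≢y , rx , ry with c ≟ x
      ...     | no c≢x = (x , P⊆S Px) , inj₂ rx , Px , c≢x , λ cx → no-triangle c∈ r∈ (P⊆S Px) a rx cx
      ...     | yes refl = (y , P⊆S Py) , inj₂ ry , Py , x≢y , λ cy → no-triangle c∈ r∈ (P⊆S Py) a ry cy

      missed : ∀ {c c' r : V} → proj₁ c ≢ proj₁ r → ¬ Adj (proj₁ c) (proj₁ r) → Move c c' → proj₁ c' ≢ proj₁ r
      missed c≢r ¬a (inj₁ refl) e = c≢r e
      missed {c} c≢r ¬a (inj₂ a) e = ¬a (subst (Adj (proj₁ c)) e a)

      survive : ∀ c r → Safe c r → ¬ CopTurn c r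
      survive c r (Pr , c≢r , ¬a) (step-to c' m (inj₁ refl)) with m
      ... | inj₁ refl = c≢r refl
      ... | inj₂ a = ¬a a
      survive c r (Pr , c≢r , ¬a) (step-to c' m (inj₂ (respond f))) with escape c' r Pr (missed {c} {c'} {r} c≢r ¬a m)
      ... | r' , mv , safe with f r' mv
      ...   | inj₁ refl = proj₁ (proj₂ safe) refl
      ...   | inj₂ t = survive c' r' safe t

      start-at : ∃ λ r → P r × proj₁ c₀ ≢ r
      start-at with proj₁ c₀ ≟ p₀
      ... | no ne = p₀ , Pp₀ , ne
      ... | yes refl with nbrs Pp₀
      ...   | x , _ , Px , _ , _ , a , _ = x , Px , Adj-irrefl a

      start : ⊥
      start with start-at
      ... | r , Pr , ne with escape c₀ (r , P⊆S Pr) Pr ne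
      ...   | r' , _ , safe with win r'
      ...     | inj₁ refl = proj₁ (proj₂ safe) refl
      ...     | inj₂ t = survive c₀ r' safe t

dominated⇒copwin : ∀ {n} (G : Graph n) {S : Subset n} {c} → c ∈ S →
  (∀ {v} → v ∈ S → v ≢ c → Adj G c v) → InducedCopWin G S
dominated⇒copwin G {S} {c} c∈ dom = (c , c∈) , λ { (v , v∈) → reply v v∈ (v ≟ c) }
  where
  open Game {Σ (Fin _) (_∈ S)} (λ x y → Adj G (proj₁ x) (proj₁ y)) renaming (move to step-to)
  reply : ∀ v (v∈ : v ∈ S) → Dec (v ≡ c) → (v , v∈) ≡ (c , c∈) ⊎ CopTurn (c , c∈) (v , v∈)
  reply v v∈ (no v≢c) = inj₂ (step-to (v , v∈) (inj₂ (dom v∈ v≢c)) (inj₁ refl))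
  -- Positions are vertices paired with membership proofs, so equal vertices give equal positions
  -- only because these proofs are unique.
  reply v v∈ (yes refl) = inj₁ (cong (v ,_) (unique-proof v∈ c∈))
    where
    unique-proof : ∀ {m} {S : Subset m} {v} (p q : v ∈ S) → p ≡ q
    unique-proof here here = refl
    unique-proof (there p) (there q) = cong there (unique-proof p q)

-- Rooted forests

Parents : ℕ → Set
Parents n = Fin n → Maybe (Fin n)

data Anc {n} (par : Parents n) (u : Fin n) : Fin n → Set where
  self : Anc par u u
  up   : ∀ {v p} → par v ≡ just p → Anc par u p → Anc par u v

-- Accessibility for the parent relation; recursion over it decides ancestry and measures depth.
data Grounded {n} (par : Parents n) (v : Fin n) : Set where
  root  : par v ≡ nothing → Grounded par v
  child : ∀ {p} → par v ≡ just p → Grounded par p → Grounded par v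

Forest : ∀ {n} → Parents n → Set
Forest par = ∀ v → Grounded par v

just≢nothing : ∀ {A : Set} {x : A} {m : Maybe A} → m ≡ just x → m ≡ nothing → ⊥
just≢nothing refl ()

same-just : ∀ {A : Set} {m : Maybe A} {x y : A} → m ≡ just x → m ≡ just y → x ≡ y
same-just e f = just-injective (trans (sym e) f)

module _ {n : ℕ} {par : Parents n} where

  Anc-trans : ∀ {u v w} → Anc par u v → Anc par v w → Anc par u w
  Anc-trans a self = a
  Anc-trans a (up e b) = up e (Anc-trans a b)

  Anc-root : ∀ {u v} → par v ≡ nothing → Anc par u v → u ≡ v
  Anc-root e self = refl
  Anc-root e (up f _) = ⊥-elim (just≢nothing f e)

  Anc-parent : ∀ {u v p} → par v ≡ just p → Anc par u v → u ≢ v → Anc par u p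
  Anc-parent e self ne = ⊥-elim (ne refl)
  Anc-parent {u} e (up f a) ne = subst (Anc par u) (same-just f e) a

  Anc-has-parent : ∀ {u v} → Anc par u v → u ≢ v → ∃ λ p → par v ≡ just p × Anc par u p
  Anc-has-parent self ne = ⊥-elim (ne refl)
  Anc-has-parent (up e a) ne = _ , e , a

  Anc-child : ∀ {u v} → Anc par u v → u ≢ v → ∃ λ b → par b ≡ just u × Anc par b v
  Anc-child self ne = ⊥-elim (ne refl)
  Anc-child {u} (up {v} {p} e a) ne with u ≟ p
  ... | yes refl = v , e , self
  ... | no u≢p with Anc-child a u≢p
  ...   | b , f , c = b , f , up e c

  Anc-compare : ∀ {u v w} → Anc par u w → Anc par v w → Anc par u v ⊎ Anc par v u
  Anc-compare self b = inj₂ b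
  Anc-compare a@(up _ _) self = inj₁ a
  Anc-compare {u} (up e a) (up f b) = Anc-compare (subst (Anc par u) (same-just e f) a) b

  no-loop : Forest par → ∀ {v p} → par v ≡ just p → ¬ Anc par v p
  no-loop F {v} = go (F v)
    where
    go : ∀ {v p} → Grounded par v → par v ≡ just p → ¬ Anc par v p
    go (root e) f _ = just≢nothing f e
    go {v} (child e g) f a with same-just e f
    go (child e g) f self | refl = go g e self
    -- A closed chain of parents through `v` is turned by one step, so that it passes through the
    -- parent, whose derivation is smaller.
    go (child e g) f (up e' a) | refl = go g e' (Anc-trans (up e self) a)

  Anc-antisym : Forest par → ∀ {u v} → Anc par u v → Anc par v u → u ≡ v
  Anc-antisym F self b = refl
  Anc-antisym F (up e a) b = ⊥-elim (no-loop F e (Anc-trans b a))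

  parent-≢ : Forest par → ∀ {v p} → par v ≡ just p → v ≢ p
  parent-≢ F e refl = no-loop F e self

  Anc? : Forest par → ∀ u v → Dec (Anc par u v)
  Anc? F u v = go (F v)
    where
    go : ∀ {v} → Grounded par v → Dec (Anc par u v)
    go {v} g with u ≟ v
    ... | yes refl = yes self
    go (root e) | no u≢v = no λ a → u≢v (Anc-root e a)
    go (child e g) | no u≢v with go g
    ... | yes a = yes (up e a)
    ... | no ¬a = no λ a → ¬a (Anc-parent e a u≢v)

  parent-view : ∀ v → par v ≡ nothing ⊎ ∃ λ p → par v ≡ just p
  parent-view v with par v
  ... | nothing = inj₁ refl
  ... | just p = inj₂ (p , refl)

hang : ∀ {n} → Parents n → Fin n → Maybe (Fin n) → Parents n
hang par x m v with v ≟ x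
... | yes _ = m
... | no _ = par v

module _ {n : ℕ} (par : Parents n) (x : Fin n) (m : Maybe (Fin n)) where

  hang-at : hang par x m x ≡ m
  hang-at with x ≟ x
  ... | yes _ = refl
  ... | no ne = ⊥-elim (ne refl)

  hang-off : ∀ {v} → v ≢ x → hang par x m v ≡ par v
  hang-off {v} ne with v ≟ x
  ... | yes e = ⊥-elim (ne e)
  ... | no _ = refl

  private par' = hang par x m

  Anc-hang⁻ : ∀ {u v} → Anc par' u v → Anc par u v ⊎ (Anc par x v × ∃ λ y → m ≡ just y × Anc par' u y)
  Anc-hang⁻ self = inj₁ self
  Anc-hang⁻ {u} {v} (up {p = p} e a) with v ≟ x
  ... | yes refl = inj₂ (self , p , e , a)
  ... | no ne with Anc-hang⁻ a
  ...   | inj₁ b = inj₁ (up e b)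
  ...   | inj₂ (b , r) = inj₂ (up e b , r)

  hang-forest : Forest par → (∀ {y} → m ≡ just y → ¬ Anc par x y) → Forest par'
  hang-forest F new v = all (F v)
    where
    outside : ∀ {v} → Grounded par v → ¬ Anc par x v → Grounded par' v
    outside {v} g ¬a with v ≟ x
    ... | yes refl = ⊥-elim (¬a self)
    outside (root e) ¬a | no ne = root (trans (hang-off ne) e)
    outside (child e g) ¬a | no ne = child (trans (hang-off ne) e) (outside g (λ b → ¬a (up e b)))
    at-x : (k : Maybe (Fin n)) → m ≡ k → Grounded par' x
    at-x nothing e = root (trans hang-at e)
    at-x (just y) e = child (trans hang-at e) (outside (F y) (new e))
    all : ∀ {v} → Grounded par v → Grounded par' v
    all {v} g with v ≟ x
    ... | yes refl = at-x m refl
    all (root e) | no ne = root (trans (hang-off ne) e)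
    all (child e g) | no ne = child (trans (hang-off ne) e) (all g)

  -- The chain from `v` up to `u` uses the pointer of `x` only if `x` lies on it strictly below `u`.
  -- Both alternatives exclude this.
  Anc-hang⁺ : Forest par → ∀ {u v} → Anc par u v → ¬ Anc par x v ⊎ Anc par x u → Anc par' u v
  Anc-hang⁺ F self _ = self
  Anc-hang⁺ F {u} {v} (up {p = p} e a) h =
    up (trans (hang-off v≢x) e) (Anc-hang⁺ F a ([ (λ ¬xv → inj₁ (λ b → ¬xv (up e b))) , inj₂ ]′ h))
    where
    v≢x : v ≢ x
    v≢x refl = [ (λ ¬xv → ¬xv self) , (λ xu → no-loop F e (Anc-trans xu a)) ]′ h

-- Images of the sets avoiding the centre

record Subtree {n} (par : Parents n) (S : Subset n) (t : Fin n) : Set where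
  field
    top∈      : t ∈ S
    top-exits : ∀ {p} → par t ≡ just p → p ∉ S
    closed    : ∀ {v} → v ∈ S → v ≢ t → ∃ λ p → par v ≡ just p × p ∈ S
    below     : ∀ {v} → v ∈ S → Anc par t v

  above-in : Forest par → ∀ {u v} → Anc par u v → v ∈ S → Anc par t u → u ∈ S
  above-in F self v∈ _ = v∈
  above-in F {u} {v} (up e a) v∈ tu with v ≟ t
  ... | yes refl = ⊥-elim (no-loop F e (Anc-trans tu a))
  ... | no v≢t with closed v∈ v≢t
  ...   | p , f , p∈ = above-in F a (subst (_∈ S) (same-just f e) p∈) tu

  child-in : Forest par → ∀ {v} → v ∈ S → v ≢ t → ∃ λ b → par b ≡ just t × Anc par b v × b ∈ S
  child-in F v∈ v≢t with Anc-child (below v∈) (≢-sym v≢t)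
  ... | b , e , a = b , e , a , above-in F a v∈ (up e self)

  parent-in : ∀ {v p} → v ∈ S → v ≢ t → par v ≡ just p → p ∈ S
  parent-in v∈ v≢t e with closed v∈ v≢t
  ... | p , f , p∈ = subst (_∈ S) (same-just f e) p∈

module _ {n} {par : Parents n} (F : Forest par) where

  -- Shared by all images S ↦ swap S a c: if S' = S − a + a' with a ≠ a', then b would be the top of S'
  -- and b' the top of S, so that b and b' would lie strictly below each other.
  swap-parent-injective : ∀ {S S' : Subset n} {t t' c b b' a a'} → c ∉ S → c ∉ S' →
    Subtree par S t → Subtree par S' t' →
    b ∈ S → par b ≡ just a → a ∈ S → b' ∈ S' → par b' ≡ just a' → a' ∈ S' →
    swap S a c ≡ swap S' a' c → S ≡ S'
  swap-parent-injective {S} {S'} {t} {t'} {c} {b} {b'} {a} {a'} c∉ c∉' T T' b∈ eb a∈ b'∈ eb' a'∈ e with a ≟ a'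
  ... | yes refl = swap-injective S S' a c a∈ a'∈ c∉ c∉' e
  ... | no a≢a' = ⊥-elim (Subtree.top-exits T (subst (λ v → par v ≡ just a) (sym b'≡t≡b) eb) a∈)
    where
    across : ∀ {S S' : Subset n} {a a' v} → c ∉ S → swap S a c ≡ swap S' a' c → v ∈ S → v ≢ a → v ∈ S'
    across {S} {S'} {a} {a'} {v} c∉ e v∈ v≢a =
      proj₂ (∈-swap⁻-old S' a' c (λ { refl → c∉ v∈ }) (subst (v ∈_) e (∈-swap-old S a c v≢a v∈)))
    gone : ∀ {S S' : Subset n} {a a'} → a ≢ a' → a ∈ S → c ∉ S → swap S a c ≡ swap S' a' c → a ∉ S'
    gone {S} {S'} {a} {a'} a≢a' a∈ c∉ e a∈' =
      ∉-swap-out S a c (λ { refl → c∉ a∈ }) (subst (a ∈_) (sym e) (∈-swap-old S' a' c a≢a' a∈'))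
    is-top : ∀ {S S' : Subset n} {a a' b t'} → a ≢ a' → c ∉ S → swap S a c ≡ swap S' a' c →
             b ∈ S → par b ≡ just a → a ∈ S → Subtree par S' t' → b ≡ t' × b ∈ S'
    is-top {S} {S'} {a} {a'} {b} {t'} a≢a' c∉ e b∈ eb a∈ T' with b ≟ t'
    ... | yes b≡t' = b≡t' , across {S' = S'} c∉ e b∈ (parent-≢ F eb)
    ... | no b≢t' = ⊥-elim (gone {S' = S'} a≢a' a∈ c∉ e (Subtree.parent-in T' (across {S' = S'} c∉ e b∈ (parent-≢ F eb)) b≢t' eb))
    b-top : b ≡ t' × b ∈ S'
    b-top = is-top {S' = S'} a≢a' c∉ e b∈ eb a∈ T'
    b'-top : b' ≡ t × b' ∈ S
    b'-top = is-top {S' = S} (≢-sym a≢a') c∉' (sym e) b'∈ eb' a'∈ T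
    b'≡t≡b : t ≡ b
    b'≡t≡b = Anc-antisym F (Subtree.below T b∈)
      (subst (Anc par b) (proj₁ b'-top) (subst (λ z → Anc par z b') (sym (proj₁ b-top)) (Subtree.below T' b'∈)))

-- `M` is the part of the graph under study and `c` its centre. Without `c` the edges inside `M`
-- form a forest. A neighbour of `c` is a child of `c` other than `q`, or one of the ends `R` of the
-- legs that descend from `q`; apart from `c`, two legs have only `q` in common. Pointers to `c`
-- need not be edges of `G`.
record Form {n} (G : Graph n) (par : Parents n) (M : Fin n → Set) (c q : Fin n) (R : Fin n → Set) : Set where
  field
    forest      : Forest par
    R?          : ∀ v → Dec (R v)
    c-root      : par c ≡ nothing
    q-child     : par q ≡ just c
    tree-edge   : ∀ {u v} → M u → M v → u ≢ c → v ≢ c → Adj G u v → par u ≡ just v ⊎ par v ≡ just u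
    centre-edge : ∀ {v} → M v → Adj G c v → R v ⊎ (par v ≡ just c × v ≢ q)
    R-below     : ∀ {r} → R r → Anc par q r
    legs        : ∀ {r r' v} → R r → R r' → r ≢ r' → Anc par v r → Anc par v r' → v ≢ c → v ≡ q

module FormProperties {n} {G : Graph n} {par : Parents n} {M : Fin n → Set} {c q : Fin n} {R : Fin n → Set}
                      (form : Form G par M c q R) where
  open Form form

  private F = forest

  -- Both `v` and `q` lie above `r`, so they are comparable, and comparable children of the root `c`
  -- coincide.
  core-child⇒q : ∀ {v r} → R r → Anc par v r → par v ≡ just c → v ≡ q
  core-child⇒q {v} Rr a e with Anc-compare a (R-below Rr)
  ... | inj₁ vq with v ≟ q
  ...   | yes eq = eq
  ...   | no ne = ⊥-elim (just≢nothing e (subst (λ z → par z ≡ nothing) (sym (Anc-root c-root (Anc-parent q-child vq ne))) c-root))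
  core-child⇒q {v} Rr a e | inj₂ qv with q ≟ v
  ... | yes eq = sym eq
  ... | no ne = ⊥-elim (just≢nothing q-child (subst (λ z → par z ≡ nothing) (sym (Anc-root c-root (Anc-parent e qv ne))) c-root))

  module _ {S : Subset n} (S⊆M : ∀ {v} → v ∈ S → M v) (c∉S : c ∉ S) (conn : ConnectedIn G S) where

    private
      ≢c : ∀ {v} → v ∈ S → v ≢ c
      ≢c v∈ refl = c∉S v∈

      edge : ∀ {u v} → u ∈ S → v ∈ S → Adj G u v → par u ≡ just v ⊎ par v ≡ just u
      edge u∈ v∈ = tree-edge (S⊆M u∈) (S⊆M v∈) (≢c u∈) (≢c v∈)

      climb : ∀ {v} → Grounded par v → v ∈ S → ∃ λ t → t ∈ S × (∀ {p} → par t ≡ just p → p ∉ S)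
      climb {v} (root e) v∈ = v , v∈ , λ f → ⊥-elim (just≢nothing f e)
      climb {v} (child {p} e g) v∈ with p ∈? S
      ... | yes p∈ = climb g p∈
      ... | no p∉ = v , v∈ , λ f p'∈ → p∉ (subst (_∈ S) (same-just f e) p'∈)

    -- Climbing from any member until the parent leaves `S` finds the top. A path in `S` from there
    -- follows forest edges and can never step above it.
    connected⇒Subtree : ∀ {v} → v ∈ S → ∃ (Subtree par S)
    connected⇒Subtree {v₀} v₀∈ with climb (F v₀) v₀∈
    ... | t , t∈ , exits = t , record { top∈ = t∈ ; top-exits = exits ; closed = closed′ ; below = below′ }
      where
      go : ∀ {v} → Path G S t v → Anc par t v
      go (stop _) = self
      go (move {u} {v} p a v∈) with edge (Path-end G p) v∈ a
      ... | inj₂ e = up e (go p)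
      ... | inj₁ e with u ≟ t
      ...   | yes refl = ⊥-elim (exits e v∈)
      ...   | no u≢t = Anc-parent e (go p) (≢-sym u≢t)
      below′ : ∀ {v} → v ∈ S → Anc par t v
      below′ v∈ = go (conn t∈ v∈)
      closed′ : ∀ {v} → v ∈ S → v ≢ t → ∃ λ p → par v ≡ just p × p ∈ S
      -- A path from the top to `v` has to enter the subtree of `v`, and the only forest edge
      -- entering it comes from the parent of `v`.
      closed′ {v} v∈ v≢t with Path-crossing G (Anc? F v) (conn t∈ v∈) (λ vt → v≢t (Anc-antisym F vt (below′ v∈))) self
      ... | a , b , a∈ , b∈ , ab , ¬va , vb with edge a∈ b∈ ab
      ...   | inj₁ e = ⊥-elim (¬va (up e vb))
      ...   | inj₂ e with v ≟ b
      ...     | yes refl = a , e , a∈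
      ...     | no v≢b = ⊥-elim (¬va (Anc-parent e vb v≢b))

  OffCore : Fin n → Set
  OffCore v = ∀ r → R r → ¬ Anc par v r

  -- Three cuts: a branch at the top without an end in `S`; a deeper branch with no end below it at
  -- all; and, for a chain above a single end `r`, the part above the parent of `r`. The first
  -- premise of `cut-core` says that `cut-top` is impossible; this later rules out collisions with
  -- replacements.
  data Image (S : Subset n) (t : Fin n) : Subset n → Set where
    cut-top  : ∀ {b} → b ∈ S → par b ≡ just t → (∀ r → R r → r ∈ S → ¬ Anc par b r) →
               Image S t (swap S t c)
    cut-core : ∀ {b a} → (∀ {v} → v ∈ S → par v ≡ just t → ∃ λ r → R r × r ∈ S × Anc par v r) →
               b ∈ S → par b ≡ just a → a ∈ S → a ≢ t → OffCore b →
               Image S t (swap S a c)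
    cut-leg  : ∀ {r a z} → R r → r ∈ S → (∀ {v} → v ∈ S → R v → v ≡ r) → (∀ {v} → v ∈ S → Anc par v r) →
               par r ≡ just a → a ∈ S → par a ≡ just z → z ∈ S →
               Image S t (swap S a c)

  record Exceptional (S : Subset n) : Set where
    field
      subtree : Subtree par S q
      core    : ∀ {v} → v ∈ S → ∃ λ r → R r × r ∈ S × Anc par v r
      two     : ∃ λ r → ∃ λ r' → R r × R r' × r ∈ S × r' ∈ S × r ≢ r'

  image-or-exceptional : ∀ {S t} → c ∉ S → 3 ≤ ∣ S ∣ → Subtree par S t → ∃ (Image S t) ⊎ Exceptional S
  image-or-exceptional {S} {t} c∉S big T
    with any? (λ b → (b ∈? S) ×-dec (par? b t ×-dec all? (λ r → R? r →-dec ((r ∈? S) →-dec ¬? (Anc? F b r)))))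
    where
    par? : ∀ b t → Dec (par b ≡ just t)
    par? b t = Maybe-dec (par b)
      where
      Maybe-dec : (m : Maybe (Fin n)) → Dec (m ≡ just t)
      Maybe-dec nothing = no λ ()
      Maybe-dec (just x) with x ≟ t
      ... | yes refl = yes refl
      ... | no ne = no λ { refl → ne refl }
  ... | yes (b , b∈ , e , h) = inj₁ (_ , cut-top b∈ e h)
  ... | no ¬cut with any? (λ b → (b ∈? S) ×-dec (parent-in? b ×-dec all? (λ r → R? r →-dec ¬? (Anc? F b r))))
    where
    parent-in? : ∀ b → Dec (∃ λ a → par b ≡ just a × a ∈ S × a ≢ t)
    parent-in? b with parent-view {par = par} b
    ... | inj₁ e = no λ { (_ , f , _) → just≢nothing f e }
    ... | inj₂ (p , e) with p ∈? S | p ≟ t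
    ...   | no p∉ | _ = no λ { (a , f , a∈ , _) → p∉ (subst (_∈ S) (same-just f e) a∈) }
    ...   | yes _ | yes p≡t = no λ { (a , f , _ , a≢t) → a≢t (trans (same-just f e) p≡t) }
    ...   | yes p∈ | no p≢t = yes (p , e , p∈ , p≢t)
  ...   | yes (b , b∈ , (a , e , a∈ , a≢t) , off) = inj₁ (_ , cut-core children b∈ e a∈ a≢t off)
    where
    children : ∀ {v} → v ∈ S → par v ≡ just t → ∃ λ r → R r × r ∈ S × Anc par v r
    children {v} v∈ e with any? (λ r → R? r ×-dec ((r ∈? S) ×-dec Anc? F v r))
    ... | yes r = r
    ... | no ¬r = ⊥-elim (¬cut (v , v∈ , e , λ r Rr r∈ a → ¬r (r , Rr , r∈ , a)))
  ...   | no ¬off = finish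
    where
    open Subtree T
    children : ∀ {v} → v ∈ S → par v ≡ just t → ∃ λ r → R r × r ∈ S × Anc par v r
    children {v} v∈ e with any? (λ r → R? r ×-dec ((r ∈? S) ×-dec Anc? F v r))
    ... | yes r = r
    ... | no ¬r = ⊥-elim (¬cut (v , v∈ , e , λ r Rr r∈ a → ¬r (r , Rr , r∈ , a)))

    core′ : ∀ {v} → v ∈ S → v ≢ t → ∃ λ r → R r × r ∈ S × Anc par v r
    core′ {v} v∈ v≢t with child-in F v∈ v≢t
    ... | b , e , bv , b∈ with children b∈ e
    ...   | r , Rr , r∈ , br with Anc? F v r
    ...     | yes vr = r , Rr , r∈ , vr
    ...     | no ¬vr with any? (λ r' → R? r' ×-dec Anc? F v r')
    -- The child `b` of the top lies above two different ends, so it is `q`, and its parent `t`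
    -- would be `c`.
    ...       | yes (r' , Rr' , vr') = ⊥-elim (c∉S (subst (_∈ S) t≡c top∈))
      where
      b≡q : b ≡ q
      b≡q = legs Rr Rr' (λ { refl → ¬vr vr' }) br (Anc-trans bv vr') (λ { refl → c∉S b∈ })
      t≡c : t ≡ c
      t≡c = same-just (subst (λ z → par z ≡ just t) b≡q e) q-child
    ...       | no ¬r' with closed v∈ v≢t
    ...         | p , f , p∈ with p ≟ t
    ...           | yes refl = ⊥-elim (let (r'' , Rr'' , _ , a) = children v∈ f in ¬r' (r'' , Rr'' , a))
    ...           | no p≢t = ⊥-elim (¬off (v , v∈ , (p , f , p∈ , p≢t) , λ r' Rr' a → ¬r' (r' , Rr' , a)))

    finish : ∃ (Image S t) ⊎ Exceptional S
    finish with member-outside S (t ∷ []) (≤-trans (s≤s (s≤s z≤n)) big)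
    ... | v , v∈ , v∉ with core′ v∈ (λ e → v∉ (hereˡ e))
    ...   | r , Rr , r∈ , vr with any? (λ r' → R? r' ×-dec ((r' ∈? S) ×-dec ¬? (r' ≟ r)))
    ...     | yes (r' , Rr' , r'∈ , r'≢r) = inj₂ record
              { subtree = subst (Subtree par S) t≡q T ; core = core″ ; two = r' , r , Rr' , Rr , r'∈ , r∈ , r'≢r }
      where
      t≡q : t ≡ q
      t≡q = legs Rr' Rr r'≢r (below r'∈) (below r∈) (λ { refl → c∉S top∈ })
      core″ : ∀ {v} → v ∈ S → ∃ λ r → R r × r ∈ S × Anc par v r
      core″ {v} v∈ with v ≟ t
      ... | yes refl = r , Rr , r∈ , below r∈
      ... | no v≢t = core′ v∈ v≢t
    ...     | no ¬r' = leg
      where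
      only : ∀ {v} → v ∈ S → R v → v ≡ r
      only {v} v∈ Rv with v ≟ r
      ... | yes e = e
      ... | no ne = ⊥-elim (¬r' (v , Rv , v∈ , ne))
      chain : ∀ {v} → v ∈ S → Anc par v r
      chain {v} v∈ with v ≟ t
      ... | yes refl = below r∈
      ... | no v≢t with core′ v∈ v≢t
      ...   | r' , Rr' , r'∈ , a = subst (Anc par v) (only r'∈ Rr') a
      r≢t : r ≢ t
      r≢t refl = v∉ (hereˡ (Anc-antisym F vr (below v∈)))
      leg : ∃ (Image S t) ⊎ Exceptional S
      leg with closed r∈ r≢t
      ... | a , e , a∈ with a ≟ t
      ...   | no a≢t = let (z , f , z∈) = closed a∈ a≢t in inj₁ (_ , cut-leg Rr r∈ only chain e a∈ f z∈)
      -- If the parent of `r` is the top, the chain is just these two vertices; this is where a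
      -- third member is demanded.
      ...   | yes refl with member-outside S (r ∷ a ∷ []) big
      ...     | w , w∈ , w∉ = ⊥-elim (w∉ (thereˡ (hereˡ (Anc-antisym F (Anc-parent e (chain w∈) (λ w≡r → w∉ (hereˡ w≡r))) (below w∈)))))

  -- The common shape of the three cuts, which is all that `swap-parent-injective` asks for.
  image-swap : ∀ {S t Y} → Subtree par S t → Image S t Y →
    ∃ λ b → ∃ λ a → b ∈ S × par b ≡ just a × a ∈ S × Y ≡ swap S a c
  image-swap T (cut-top {b} b∈ e _) = b , _ , b∈ , e , Subtree.top∈ T , refl
  image-swap T (cut-core {b} {a} _ b∈ e a∈ _ _) = b , a , b∈ , e , a∈ , refl
  image-swap T (cut-leg {r} {a} _ r∈ _ _ e a∈ _ _) = r , a , r∈ , e , a∈ , refl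

  image-injective : ∀ {S S' t t' Y} → c ∉ S → c ∉ S' → Subtree par S t → Subtree par S' t' →
                    Image S t Y → Image S' t' Y → S ≡ S'
  image-injective c∉ c∉' T T' i i' with image-swap T i | image-swap T' i'
  ... | b , a , b∈ , e , a∈ , y | b' , a' , b'∈ , e' , a'∈ , y' =
    swap-parent-injective F c∉ c∉' T T' b∈ e a∈ b'∈ e' a'∈ (trans (sym y) y')

  image-size : ∀ {S t Y} → c ∉ S → Subtree par S t → Image S t Y → ∣ Y ∣ ≡ ∣ S ∣
  image-size {S} c∉ T i with image-swap T i
  ... | b , a , b∈ , e , a∈ , refl = ∣swap∣ S a c a∈ c∉

  image-centre : ∀ {S t Y} → Subtree par S t → Image S t Y → c ∈ Y
  image-centre {S} T i with image-swap T i
  ... | b , a , b∈ , e , a∈ , refl = ∈-swap-new S a c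

  image-disconnected : ∀ {S t Y} → (∀ {v} → v ∈ S → M v) → M c → c ∉ S → Subtree par S t → Image S t Y → ¬ ConnectedIn G Y
  image-disconnected {S} {t} S⊆M Mc c∉ T = go
    where
    open Subtree T
    ≢c : ∀ {v} → v ∈ S → v ≢ c
    ≢c v∈ refl = c∉ v∈

    -- Once `a` is gone, the members below `b` have no way up, and none of them is adjacent to `c`.
    branch : ∀ {b a} → b ∈ S → par b ≡ just a → a ∈ S → (∀ r → R r → r ∈ S → ¬ Anc par b r) → ¬ ConnectedIn G (swap S a c)
    branch {b} {a} b∈ e a∈ h =
      closed⇒¬connected G (λ v → v ∈ S × Anc par b v) (∈-swap-old S a c (parent-≢ F e) b∈) (∈-swap-new S a c)
        (b∈ , self) (λ { (c∈ , _) → c∉ c∈ }) step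
      where
      step : ∀ {u v} → u ∈ swap S a c → v ∈ swap S a c → Adj G u v → u ∈ S × Anc par b u → v ∈ S × Anc par b v
      step {u} {v} u∈' v∈' uv (u∈ , bu) with ∈-swap⁻ S a c v∈'
      step {u} {v} u∈' v∈' uv (u∈ , bu) | inj₁ refl with centre-edge (S⊆M u∈) (Adj-sym G uv)
      ... | inj₁ Ru = ⊥-elim (h u Ru u∈ bu)
      ... | inj₂ (f , _) with b ≟ u
      ...   | yes refl = ⊥-elim (c∉ (subst (_∈ S) (same-just e f) a∈))
      ...   | no b≢u = ⊥-elim (≢c b∈ (Anc-root c-root (Anc-parent f bu b≢u)))
      step {u} {v} u∈' v∈' uv (u∈ , bu) | inj₂ (v≢a , v∈) with tree-edge (S⊆M u∈) (S⊆M v∈) (≢c u∈) (≢c v∈) uv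
      ... | inj₂ f = v∈ , up f bu
      ... | inj₁ f with b ≟ u
      ...   | yes refl = ⊥-elim (v≢a (same-just f e))
      ...   | no b≢u = v∈ , Anc-parent f bu b≢u

    go : ∀ {Y} → Image S t Y → ¬ ConnectedIn G Y
    go (cut-top b∈ e h) = branch b∈ e top∈ h
    go (cut-core _ b∈ e a∈ _ off) = branch b∈ e a∈ (λ r Rr _ → off r Rr)
    go (cut-leg {r} {a} {z} Rr r∈ only chain e a∈ f z∈) =
      -- Within the chain only `r` is adjacent to `c`, and the removed `a` was the only neighbour of
      -- `r` in `S`.
      closed⇒¬connected G (λ v → v ∈ S × v ≢ r × v ≢ a) (∈-swap-old S a c (≢-sym (parent-≢ F f)) z∈) (∈-swap-new S a c)
        (z∈ , z≢r , ≢-sym (parent-≢ F f)) (λ { (c∈ , _) → c∉ c∈ }) step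
      where
      z≢r : z ≢ r
      z≢r refl = no-loop F f (up e self)
      step : ∀ {u v} → u ∈ swap S a c → v ∈ swap S a c → Adj G u v → u ∈ S × u ≢ r × u ≢ a → v ∈ S × v ≢ r × v ≢ a
      step {u} {v} u∈' v∈' uv (u∈ , u≢r , u≢a) with ∈-swap⁻ S a c v∈'
      step {u} {v} u∈' v∈' uv (u∈ , u≢r , u≢a) | inj₁ refl with centre-edge (S⊆M u∈) (Adj-sym G uv)
      ... | inj₁ Ru = ⊥-elim (u≢r (only u∈ Ru))
      ... | inj₂ (g , u≢q) = ⊥-elim (u≢q (core-child⇒q Rr (chain u∈) g))
      step {u} {v} u∈' v∈' uv (u∈ , u≢r , u≢a) | inj₂ (v≢a , v∈) with v ≟ r
      ... | no v≢r = v∈ , v≢r , v≢a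
      ... | yes refl with tree-edge (S⊆M u∈) (S⊆M v∈) (≢c u∈) (≢c v∈) uv
      ...   | inj₁ g = ⊥-elim (no-loop F g (chain u∈))
      ...   | inj₂ g = ⊥-elim (u≢a (same-just g e))

  -- An exceptional set is the union of the legs from `q` to the ends it contains, so these ends
  -- determine it.
  exceptional-⊆ : ∀ {S S'} → Exceptional S → Exceptional S' → (∀ {r} → R r → r ∈ S → r ∈ S') → ∀ {v} → v ∈ S → v ∈ S'
  exceptional-⊆ X X' h v∈ with Exceptional.core X v∈
  ... | r , Rr , r∈ , vr = Subtree.above-in (Exceptional.subtree X') F vr (h Rr r∈) (Subtree.below (Exceptional.subtree X) v∈)

  several : ∀ {S x} → Exceptional S → ¬ (∀ {r} → R r → r ∈ S → r ≡ x)
  several X single = let (_ , _ , Rr , Rr' , r∈ , r'∈ , r≢r') = Exceptional.two X in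
    r≢r' (trans (single Rr r∈) (sym (single Rr' r'∈)))

  module TwoLegs {x} (two-ends : ∀ {r} → R r → r ≡ q ⊎ r ≡ x) where

    end-in : ∀ {S} → Exceptional S → x ∈ S
    end-in {S} X with x ∈? S
    ... | yes x∈ = x∈
    ... | no x∉ = ⊥-elim (several X λ Rr r∈ → [ id , (λ { refl → ⊥-elim (x∉ r∈) }) ]′ (two-ends Rr))

    exceptional-unique : ∀ {S S'} → Exceptional S → Exceptional S' → S ≡ S'
    exceptional-unique X X' = ⊆⊇⇒≡ (exceptional-⊆ X X' (λ Rr _ → ends X' Rr)) (exceptional-⊆ X' X (λ Rr _ → ends X Rr))
      where
      ends : ∀ {S} → Exceptional S → ∀ {r} → R r → r ∈ S
      ends X Rr = [ (λ { refl → Subtree.top∈ (Exceptional.subtree X) }) , (λ { refl → end-in X }) ]′ (two-ends Rr)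

  data Centred (S : Subset n) (Y : Subset n) : Set where
    kept  : c ∈ S → ConnectedIn G S → Y ≡ S → Centred S Y
    moved : ∀ {t} → c ∉ S → Subtree par S t → Image S t Y → Centred S Y

  centred-or-exceptional : ∀ {S} → (∀ {v} → v ∈ S → M v) → ConnectedIn G S → 3 ≤ ∣ S ∣ →
                           ∃ (Centred S) ⊎ (c ∉ S × Exceptional S)
  centred-or-exceptional {S} S⊆M conn big with c ∈? S
  ... | yes c∈ = inj₁ (S , kept c∈ conn refl)
  ... | no c∉ with positive⇒Nonempty S (≤-trans (s≤s z≤n) big)
  ...   | v , v∈ with connected⇒Subtree S⊆M c∉ conn v∈
  ...     | t , T with image-or-exceptional c∉ big T
  ...       | inj₁ (Y , i) = inj₁ (Y , moved c∉ T i)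
  ...       | inj₂ x = inj₂ (c∉ , x)

  centred-centre : ∀ {S Y} → Centred S Y → c ∈ Y
  centred-centre (kept c∈ _ refl) = c∈
  centred-centre (moved _ T i) = image-centre T i

  centred-size : ∀ {S Y} → Centred S Y → ∣ Y ∣ ≡ ∣ S ∣
  centred-size (kept _ _ refl) = refl
  centred-size (moved c∉ T i) = image-size c∉ T i

  centred-members : ∀ {S Y} → Centred S Y → ∀ {v} → v ∈ Y → v ≡ c ⊎ v ∈ S
  centred-members (kept _ _ refl) v∈ = inj₂ v∈
  centred-members {S} (moved _ T i) v∈ with image-swap T i
  ... | b , a , _ , _ , _ , refl with ∈-swap⁻ S a c v∈
  ...   | inj₁ e = inj₁ e
  ...   | inj₂ (_ , p) = inj₂ p

  -- Kept values are connected and moved values are not, so only values of the same kind have to be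
  -- compared.
  centred-injective : ∀ {S S' Y} → M c → (∀ {v} → v ∈ S → M v) → (∀ {v} → v ∈ S' → M v) →
                      Centred S Y → Centred S' Y → S ≡ S'
  centred-injective Mc S⊆M S'⊆M (kept _ _ refl) (kept _ _ refl) = refl
  centred-injective Mc S⊆M S'⊆M (kept _ conn refl) (moved c∉ T i) = ⊥-elim (image-disconnected S'⊆M Mc c∉ T i conn)
  centred-injective Mc S⊆M S'⊆M (moved c∉ T i) (kept _ conn refl) = ⊥-elim (image-disconnected S⊆M Mc c∉ T i conn)
  centred-injective Mc S⊆M S'⊆M (moved c∉ T i) (moved c∉' T' i') = image-injective c∉ c∉' T T' i i'

module _ {n} {par : Parents n} {c q : Fin n} (c-root : par c ≡ nothing) (q-child : par q ≡ just c) where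

  above-root-child : ∀ {v} → Anc par v q → v ≢ c → v ≡ q
  above-root-child {v} a v≢c with v ≟ q
  ... | yes e = e
  ... | no v≢q = ⊥-elim (v≢c (Anc-root c-root (Anc-parent q-child a v≢q)))

  two-legs : ∀ {x r r' v} → r ≡ q ⊎ r ≡ x → r' ≡ q ⊎ r' ≡ x → r ≢ r' → Anc par v r → Anc par v r' → v ≢ c → v ≡ q
  two-legs (inj₁ refl) _ _ a _ = above-root-child a
  two-legs (inj₂ _) (inj₁ refl) _ _ b = above-root-child b
  two-legs (inj₂ refl) (inj₂ refl) ne = ⊥-elim (ne refl)

-- Spanning trees and the two extra edges

Same : ∀ {n} → Fin n → Fin n → Fin n → Fin n → Set
Same u v x y = (u ≡ x × v ≡ y) ⊎ (u ≡ y × v ≡ x)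

Same-flip : ∀ {n} {u v x y : Fin n} → Same u v x y → Same u v y x
Same-flip (inj₁ p) = inj₂ p
Same-flip (inj₂ p) = inj₁ p

Same-sym : ∀ {n} {u v x y : Fin n} → Same u v x y → Same x y u v
Same-sym (inj₁ (refl , refl)) = inj₁ (refl , refl)
Same-sym (inj₂ (refl , refl)) = inj₂ (refl , refl)

TreeEdge : ∀ {n} → Parents n → Fin n → Fin n → Set
TreeEdge par u v = par u ≡ just v ⊎ par v ≡ just u

just? : ∀ {n} (m : Maybe (Fin n)) v → Dec (m ≡ just v)
just? nothing v = no λ ()
just? (just x) v with x ≟ v
... | yes refl = yes refl
... | no ne = no λ { refl → ne refl }

TreeEdge? : ∀ {n} (par : Parents n) u v → Dec (TreeEdge par u v)
TreeEdge? par u v = just? (par u) v ⊎-dec just? (par v) u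

record SpanningTree {n} (E : Fin n → Fin n → Set) (par : Parents n) (ρ : Fin n) : Set where
  field
    forest : Forest par
    root≡  : par ρ ≡ nothing
    rooted : ∀ v → Anc par ρ v
    sound  : ∀ {v p} → par v ≡ just p → E v p

module Growing {n} (E : Fin n → Fin n → Set) (E-sym : ∀ {u v} → E u v → E v u) (ρ : Fin n) where

  data Walk : Fin n → Set where
    stay   : Walk ρ
    extend : ∀ {u v} → Walk u → E u v → Walk v

  record Partial (par : Parents n) : Set where
    field
      forest  : Forest par
      root≡   : par ρ ≡ nothing
      sound   : ∀ {v p} → par v ≡ just p → E v p
      attached-or-isolated : ∀ v → Anc par ρ v ⊎ par v ≡ nothing

  -- The walk is followed edge by edge, and a vertex not yet below `ρ` is hung from its predecessor.
  -- The predecessor is below `ρ`, hence not below the new vertex, so no cycle arises.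
  attach : ∀ {par v} → Partial par → Walk v →
           ∃ λ par' → Partial par' × Anc par' ρ v × (∀ {w} → Anc par ρ w → Anc par' ρ w)
  attach P stay = _ , P , self , id
  attach P (extend {u} {v} walk e) with attach P walk
  ... | par , P' , ρu , keep with Anc? (Partial.forest P') ρ v
  ...   | yes ρv = par , P' , ρv , keep
  ...   | no ¬ρv = par' , P″ , up (hang-at par v (just u)) (keep′ ρu) , λ a → keep′ (keep a)
    where
    open Partial P'
    par' = hang par v (just u)
    outside : ∀ {w} → Anc par ρ w → ¬ Anc par v w
    outside ρw vw with Anc-compare ρw vw
    ... | inj₁ ρv = ¬ρv ρv
    ... | inj₂ vρ = ¬ρv (subst (Anc par ρ) (sym (Anc-root root≡ vρ)) self)
    keep′ : ∀ {w} → Anc par ρ w → Anc par' ρ w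
    keep′ ρw = Anc-hang⁺ par v (just u) forest ρw (inj₁ (outside ρw))
    P″ : Partial par'
    P″ = record
      { forest = hang-forest par v (just u) forest (λ { refl → outside ρu })
      ; root≡ = trans (hang-off par v (just u) (λ { refl → ¬ρv self })) root≡
      ; sound = λ {w} → sound′ {w}
      ; attached-or-isolated = classify }
      where
      sound′ : ∀ {w p} → par' w ≡ just p → E w p
      sound′ {w} f with w ≟ v
      sound′ refl | yes refl = E-sym e
      ... | no _ = sound f
      classify : ∀ w → Anc par' ρ w ⊎ par' w ≡ nothing
      classify w with attached-or-isolated w
      ... | inj₁ a = inj₁ (keep′ a)
      ... | inj₂ f with w ≟ v
      ...   | yes refl = inj₁ (up (hang-at par v (just u)) (keep′ ρu))
      ...   | no _ = inj₂ f

  attach-all : (∀ v → Walk v) → (vs : List (Fin n)) → ∃ λ par → Partial par × (∀ {v} → v ∈ˡ vs → Anc par ρ v)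
  attach-all walk [] = (λ _ → nothing) ,
    record { forest = λ _ → root refl ; root≡ = refl ; sound = λ () ; attached-or-isolated = λ _ → inj₂ refl } , λ ()
  attach-all walk (v ∷ vs) with attach-all walk vs
  ... | par , P , all with attach P (walk v)
  ...   | par' , P' , ρv , keep = par' , P' , λ { (hereˡ refl) → ρv ; (thereˡ p) → keep (all p) }

  abstract
    spanning-tree : (∀ v → Walk v) → ∃ λ par → SpanningTree E par ρ
    spanning-tree walk with attach-all walk (allFin n)
    ... | par , P , all = par , record
      { forest = Partial.forest P ; root≡ = Partial.root≡ P ; rooted = λ v → all (∈-allFin v) ; sound = Partial.sound P }

length-filter-split : ∀ {A : Set} {P : A → Set} (P? : ∀ x → Dec (P x)) (xs : List A) →
  length (filter P? xs) + length (filter (λ x → ¬? (P? x)) xs) ≡ length xs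
length-filter-split P? [] = refl
length-filter-split P? (x ∷ xs) with P? x
... | yes _ = cong suc (length-filter-split P? xs)
... | no _ = trans (+-suc _ _) (cong suc (length-filter-split P? xs))

record Skeleton {n} (G : Graph n) (par : Parents n) (ρ e₁ e₂ f₁ f₂ : Fin n) : Set where
  field
    tree     : SpanningTree (Adj G) par ρ
    e-edge   : Adj G e₁ e₂
    f-edge   : Adj G f₁ f₂
    e-new    : ¬ TreeEdge par e₁ e₂
    f-new    : ¬ TreeEdge par f₁ f₂
    distinct : ¬ Same e₁ e₂ f₁ f₂
    complete : ∀ {u v} → Adj G u v → TreeEdge par u v ⊎ Same u v e₁ e₂ ⊎ Same u v f₁ f₂
  open SpanningTree tree public

double-sum≡length-filter : ∀ {A B : Set} (f : A → B → Bool) (xs : List A) (ys : List B) →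
  sum (map (λ x → sum (map (λ y → if f x y then 1 else 0) ys)) xs)
    ≡ length (filter (λ p → T? (f (proj₁ p) (proj₂ p))) (cartesianProduct xs ys))
double-sum≡length-filter f [] ys = refl
double-sum≡length-filter {A} {B} f (x ∷ xs) ys = trans (cong (sum (map _ ys) +_) (double-sum≡length-filter f xs ys)) (row ys)
  where
  rest = cartesianProduct xs ys
  F? = λ (p : A × B) → T? (f (proj₁ p) (proj₂ p))
  row : ∀ ys → sum (map (λ y → if f x y then 1 else 0) ys) + length (filter F? rest)
               ≡ length (filter F? (map (x ,_) ys ++ rest))
  row [] = refl
  row (y ∷ ys) with f x y
  ... | true = cong suc (row ys)
  ... | false = row ys

module _ {n} (G : Graph n) (count : edgeCount G ≡ suc n) where

  private
    edges : List (Fin n × Fin n)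
    edges = filter (λ p → T? ((toℕ (proj₁ p) <ᵇ toℕ (proj₂ p)) ∧ adj G (proj₁ p) (proj₂ p)))
                   (cartesianProduct (allFin n) (allFin n))

    edges-length : length edges ≡ suc n
    edges-length = trans (sym (double-sum≡length-filter (λ i j → (toℕ i <ᵇ toℕ j) ∧ adj G i j) (allFin n) (allFin n))) count

    edges-unique : Unique edges
    edges-unique = Unique.filter⁺ _ (Unique.cartesianProduct⁺ (Unique.allFin⁺ n) (Unique.allFin⁺ n))

    T-∧⁻ : ∀ {a b} → T (a ∧ b) → T a × T b
    T-∧⁻ {true} {true} _ = tt , tt

    T-∧⁺ : ∀ {a b} → T a → T b → T (a ∧ b)
    T-∧⁺ {true} {true} _ _ = tt

    ∈-edges⁻ : ∀ {i j} → (i , j) ∈ˡ edges → toℕ i < toℕ j × Adj G i j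
    ∈-edges⁻ {i} {j} p with T-∧⁻ {toℕ i <ᵇ toℕ j} (proj₂ (∈-filter⁻ (λ p → T? ((toℕ (proj₁ p) <ᵇ toℕ (proj₂ p)) ∧ adj G (proj₁ p) (proj₂ p))) {xs = cartesianProduct (allFin n) (allFin n)} p))
    ... | lt , a = <ᵇ⇒< _ _ lt , a

    ∈-edges⁺ : ∀ {i j} → toℕ i < toℕ j → Adj G i j → (i , j) ∈ˡ edges
    ∈-edges⁺ {i} {j} lt a = ∈-filter⁺ _ (∈-cartesianProduct⁺ (∈-allFin i) (∈-allFin j)) (T-∧⁺ {toℕ i <ᵇ toℕ j} (<⇒<ᵇ lt) a)

  module _ {par : Parents n} {ρ : Fin n} (tree : SpanningTree (Adj G) par ρ) where
    open SpanningTree tree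

    private
      Tree? : ∀ (p : Fin n × Fin n) → Dec (TreeEdge par (proj₁ p) (proj₂ p))
      Tree? (i , j) = TreeEdge? par i j

      tree-edges : List (Fin n × Fin n)
      tree-edges = filter Tree? edges

      -- nothing stands for the root, so that vertices correspond to tree edges plus one.
      UpEdge : Maybe (Fin n × Fin n) → Fin n → Set
      UpEdge nothing v = v ≡ ρ
      UpEdge (just (i , j)) v = toℕ i < toℕ j × ((v ≡ i × par i ≡ just j) ⊎ (v ≡ j × par j ≡ just i))

      UpEdge-injective : ∀ {p q v} → UpEdge p v → UpEdge q v → p ≡ q
      UpEdge-injective {nothing} {nothing} _ _ = refl
      UpEdge-injective {nothing} {just _} refl (_ , inj₁ (refl , e)) = ⊥-elim (just≢nothing e root≡)
      UpEdge-injective {nothing} {just _} refl (_ , inj₂ (refl , e)) = ⊥-elim (just≢nothing e root≡)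
      UpEdge-injective {just _} {nothing} (_ , inj₁ (refl , e)) refl = ⊥-elim (just≢nothing e root≡)
      UpEdge-injective {just _} {nothing} (_ , inj₂ (refl , e)) refl = ⊥-elim (just≢nothing e root≡)
      UpEdge-injective {just _} {just _} (_ , inj₁ (refl , e)) (_ , inj₁ (refl , f)) = cong (λ z → just (_ , z)) (same-just e f)
      UpEdge-injective {just _} {just _} (_ , inj₂ (refl , e)) (_ , inj₂ (refl , f)) = cong (λ z → just (z , _)) (same-just e f)
      UpEdge-injective {just _} {just _} (lt , inj₁ (refl , e)) (lt' , inj₂ (refl , f)) with same-just e f
      ... | refl = ⊥-elim (ℕₚ.<-asym lt lt')
      UpEdge-injective {just _} {just _} (lt , inj₂ (refl , e)) (lt' , inj₁ (refl , f)) with same-just e f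
      ... | refl = ⊥-elim (ℕₚ.<-asym lt lt')

      UpEdge-functional : ∀ {v w p} → UpEdge p v → UpEdge p w → v ≡ w
      UpEdge-functional {p = nothing} refl refl = refl
      UpEdge-functional {p = just _} (_ , inj₁ (refl , _)) (_ , inj₁ (refl , _)) = refl
      UpEdge-functional {p = just _} (_ , inj₂ (refl , _)) (_ , inj₂ (refl , _)) = refl
      UpEdge-functional {p = just _} (_ , inj₁ (_ , e)) (_ , inj₂ (_ , f)) = ⊥-elim (no-loop forest e (up f self))
      UpEdge-functional {p = just _} (_ , inj₂ (_ , e)) (_ , inj₁ (_ , f)) = ⊥-elim (no-loop forest e (up f self))

      marked : List (Maybe (Fin n × Fin n))
      marked = nothing ∷ map just tree-edges

      marked-unique : Unique marked
      marked-unique = All.tabulate (λ p → λ { refl → case ∈-map⁻ just p of λ { (_ , _ , ()) } })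
                    ∷ Unique.map⁺ just-injective (Unique.filter⁺ Tree? edges-unique)

      vertex-of : ∀ {m} → m ∈ˡ marked → ∃ λ v → v ∈ˡ allFin n × UpEdge m v
      vertex-of (hereˡ refl) = ρ , ∈-allFin ρ , refl
      vertex-of (thereˡ p) with ∈-map⁻ just p
      ... | (i , j) , q , refl with ∈-filter⁻ Tree? {xs = edges} q
      ...   | q' , inj₁ e = i , ∈-allFin i , proj₁ (∈-edges⁻ q') , inj₁ (refl , e)
      ...   | q' , inj₂ e = j , ∈-allFin j , proj₁ (∈-edges⁻ q') , inj₂ (refl , e)

      edge-of : ∀ {v} → v ∈ˡ allFin n → ∃ λ m → m ∈ˡ marked × UpEdge m v
      edge-of {v} _ with parent-view {par = par} v
      ... | inj₁ e = nothing , hereˡ refl , sym (Anc-root e (rooted v))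
      ... | inj₂ (p , e) with ℕₚ.<-cmp (toℕ v) (toℕ p)
      ...   | tri< lt _ _ = just (v , p) , thereˡ (∈-map⁺ just (∈-filter⁺ Tree? (∈-edges⁺ lt (sound e)) (inj₁ e))) , lt , inj₁ (refl , e)
      ...   | tri≈ _ eq _ = ⊥-elim (parent-≢ forest e (toℕ-injective eq))
      ...   | tri> _ _ gt = just (p , v) , thereˡ (∈-map⁺ just (∈-filter⁺ Tree? (∈-edges⁺ gt (Adj-sym G (sound e))) (inj₂ e))) , gt , inj₂ (refl , e)

      -- `UpEdge` matches each vertex other than the root with the edge to its parent; the
      -- pigeonhole principle is applied in both directions.
      suc-tree-edges : suc (length tree-edges) ≡ n
      suc-tree-edges = trans (cong suc (sym (length-map just tree-edges))) (≤-antisym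
        (≤-trans (relational-pigeonhole UpEdge UpEdge-injective marked-unique vertex-of) (≤-reflexive (length-tabulate id)))
        (≤-trans (≤-reflexive (sym (length-tabulate id))) (relational-pigeonhole (λ v m → UpEdge m v) UpEdge-functional (Unique.allFin⁺ n) edge-of)))

      others : List (Fin n × Fin n)
      others = filter (λ p → ¬? (Tree? p)) edges

      -- `n + 1` edges less the `n - 1` tree edges.
      others-length : length others ≡ 2
      others-length = +-cancelˡ-≡ (length tree-edges) _ _
        (trans (length-filter-split Tree? edges) (trans edges-length (trans (cong suc (sym suc-tree-edges)) (+-comm 2 _))))

      two-members : ∀ {A : Set} (xs : List A) → length xs ≡ 2 → Unique xs →
                    ∃ λ x → ∃ λ y → x ≢ y × x ∈ˡ xs × y ∈ˡ xs × (∀ {z} → z ∈ˡ xs → z ≡ x ⊎ z ≡ y)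
      two-members (x ∷ y ∷ []) refl ((x≢y ∷ []) ∷ _) = x , y , x≢y , hereˡ refl , thereˡ (hereˡ refl) ,
        λ { (hereˡ e) → inj₁ e ; (thereˡ (hereˡ e)) → inj₂ e }

    abstract
      two-extra-edges : ∃ λ e₁ → ∃ λ e₂ → ∃ λ f₁ → ∃ λ f₂ → Skeleton G par ρ e₁ e₂ f₁ f₂
      two-extra-edges with two-members others others-length (Unique.filter⁺ _ edges-unique)
      ... | (e₁ , e₂) , (f₁ , f₂) , e≢f , e∈ , f∈ , all
        with ∈-filter⁻ (λ p → ¬? (Tree? p)) {xs = edges} e∈ | ∈-filter⁻ (λ p → ¬? (Tree? p)) {xs = edges} f∈
      ... | e∈' , ¬te | f∈' , ¬tf = e₁ , e₂ , f₁ , f₂ , record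
        { tree = tree ; e-edge = proj₂ (∈-edges⁻ e∈') ; f-edge = proj₂ (∈-edges⁻ f∈') ; e-new = ¬te ; f-new = ¬tf
        ; distinct = λ { (inj₁ (refl , refl)) → e≢f refl
                       ; (inj₂ (refl , refl)) → ℕₚ.<-asym (proj₁ (∈-edges⁻ e∈')) (proj₁ (∈-edges⁻ f∈')) }
        ; complete = complete′ }
        where
        ordered : ∀ {u v} → toℕ u < toℕ v → Adj G u v → TreeEdge par u v ⊎ Same u v e₁ e₂ ⊎ Same u v f₁ f₂
        ordered {u} {v} lt a with TreeEdge? par u v
        ... | yes t = inj₁ t
        ... | no ¬t with all (∈-filter⁺ (λ p → ¬? (Tree? p)) (∈-edges⁺ lt a) ¬t)
        ...   | inj₁ refl = inj₂ (inj₁ (inj₁ (refl , refl)))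
        ...   | inj₂ refl = inj₂ (inj₂ (inj₁ (refl , refl)))
        swap-same : ∀ {u v x y : Fin n} → Same u v x y → Same v u x y
        swap-same (inj₁ (p , q)) = inj₂ (q , p)
        swap-same (inj₂ (p , q)) = inj₁ (q , p)
        complete′ : ∀ {u v} → Adj G u v → TreeEdge par u v ⊎ Same u v e₁ e₂ ⊎ Same u v f₁ f₂
        complete′ {u} {v} a with ℕₚ.<-cmp (toℕ u) (toℕ v)
        ... | tri< lt _ _ = ordered lt a
        ... | tri≈ _ eq _ = ⊥-elim (Adj-irrefl G a (toℕ-injective eq))
        ... | tri> _ _ gt with ordered gt (Adj-sym G a)
        ...   | inj₁ (inj₁ t) = inj₁ (inj₂ t)
        ...   | inj₁ (inj₂ t) = inj₁ (inj₁ t)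
        ...   | inj₂ (inj₁ s) = inj₂ (inj₁ (swap-same s))
        ...   | inj₂ (inj₂ s) = inj₂ (inj₂ (swap-same s))

-- Back edges

TreeEdge-flip : ∀ {n} {par : Parents n} {u v} → TreeEdge par u v → TreeEdge par v u
TreeEdge-flip (inj₁ e) = inj₂ e
TreeEdge-flip (inj₂ e) = inj₁ e

module _ {n} {G : Graph n} {par : Parents n} {ρ e₁ e₂ f₁ f₂ : Fin n} (sk : Skeleton G par ρ e₁ e₂ f₁ f₂) where
  open Skeleton sk

  flip-f : Skeleton G par ρ e₁ e₂ f₂ f₁
  flip-f = record
    { tree = tree ; e-edge = e-edge ; f-edge = Adj-sym G f-edge ; e-new = e-new ; f-new = f-new ∘ TreeEdge-flip
    ; distinct = distinct ∘ Same-flip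
    ; complete = λ a → [ inj₁ , [ inj₂ ∘ inj₁ , inj₂ ∘ inj₂ ∘ Same-flip ]′ ]′ (complete a) }

  exchange : Skeleton G par ρ f₁ f₂ e₁ e₂
  exchange = record
    { tree = tree ; e-edge = f-edge ; f-edge = e-edge ; e-new = f-new ; f-new = e-new
    ; distinct = distinct ∘ Same-sym
    ; complete = λ a → [ inj₁ , [ inj₂ ∘ inj₂ , inj₂ ∘ inj₁ ]′ ]′ (complete a) }

flip-e : ∀ {n} {G : Graph n} {par : Parents n} {ρ e₁ e₂ f₁ f₂ : Fin n} → Skeleton G par ρ e₁ e₂ f₁ f₂ → Skeleton G par ρ e₂ e₁ f₁ f₂
flip-e sk = exchange (flip-f (exchange sk))

-- One extra edge ends at the root, which thus lies on the cycle closed by this edge.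
RootedOnCycle : ∀ {n} → Graph n → Set
RootedOnCycle G = ∃ λ par → ∃ λ ρ → ∃ λ y → ∃ λ f₁ → ∃ λ f₂ → Skeleton G par ρ y ρ f₁ f₂

-- The root of a second spanning tree, grown inside G minus an extra edge of a first one, can be put on a cycle.
abstract
  skeleton-rooted-on-cycle : ∀ {n} (G : Graph n) → Bicyclic G → Fin n →
    RootedOnCycle G
  skeleton-rooted-on-cycle {n} G (connected , count) v₀ = from-first first
    where
    walk₀ : ∀ {v} → Reach G v v₀ → Growing.Walk (Adj G) (Adj-sym G) v₀ v
    walk₀ reach-here = Growing.stay
    walk₀ (reach-step a r) = Growing.extend (walk₀ r) (Adj-sym G a)
    first : ∃ λ par → SpanningTree (Adj G) par v₀
    first = Growing.spanning-tree (Adj G) (Adj-sym G) v₀ (λ v → walk₀ (connected v v₀))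
    from-first : (∃ λ par → SpanningTree (Adj G) par v₀) →
                 RootedOnCycle G
    from-first (par₀ , tree₀) with two-extra-edges G count tree₀
    ... | ρ , y , _ , _ , sk₀ = second (Second.spanning-tree walk)
      where
      open Skeleton sk₀ using (e-edge; e-new; rooted; sound)
      E : Fin n → Fin n → Set
      E u v = Adj G u v × ¬ Same u v ρ y
      E-sym : ∀ {u v} → E u v → E v u
      E-sym (a , ¬s) = Adj-sym G a , λ { (inj₁ (p , q)) → ¬s (inj₂ (q , p)) ; (inj₂ (p , q)) → ¬s (inj₁ (q , p)) }
      module Second = Growing E E-sym ρ
      tree-E : ∀ {v p} → par₀ v ≡ just p → E v p
      tree-E e = sound e , λ { (inj₁ (refl , refl)) → e-new (inj₁ e) ; (inj₂ (refl , refl)) → e-new (inj₂ e) }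
      climb : ∀ {u} → Second.Walk u → Anc par₀ v₀ u → Second.Walk v₀
      climb w self = w
      climb w (up e a) = climb (Second.extend w (tree-E e)) a
      descend : ∀ {v} → Second.Walk v₀ → Anc par₀ v₀ v → Second.Walk v
      descend w self = w
      descend w (up e a) = Second.extend (descend w a) (E-sym (tree-E e))
      -- From `ρ` along the first tree up to `v₀` and then down to `v`; all these edges differ from
      -- the withheld edge between `ρ` and `y`.
      walk : ∀ v → Second.Walk v
      walk v = descend (climb Second.stay (rooted ρ)) (rooted v)
      second : (∃ λ par → SpanningTree E par ρ) → RootedOnCycle G
      second (par , tree) with two-extra-edges G count tree′
        where
        tree′ : SpanningTree (Adj G) par ρ
        tree′ = record { forest = SpanningTree.forest tree ; root≡ = SpanningTree.root≡ tree
                       ; rooted = SpanningTree.rooted tree ; sound = proj₁ ∘ SpanningTree.sound tree }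
      -- The withheld edge is not in the second tree, so it is one of the two extra edges there.
      ... | p₁ , p₂ , q₁ , q₂ , sk with Skeleton.complete sk e-edge
      ...   | inj₁ (inj₁ e) = ⊥-elim (proj₂ (SpanningTree.sound tree e) (inj₁ (refl , refl)))
      ...   | inj₁ (inj₂ e) = ⊥-elim (proj₂ (SpanningTree.sound tree e) (inj₂ (refl , refl)))
      ...   | inj₂ (inj₁ (inj₁ (refl , refl))) = par , ρ , y , q₁ , q₂ , flip-e sk
      ...   | inj₂ (inj₁ (inj₂ (refl , refl))) = par , ρ , y , q₁ , q₂ , sk
      ...   | inj₂ (inj₂ (inj₁ (refl , refl))) = par , ρ , y , p₁ , p₂ , flip-e (exchange sk)
      ...   | inj₂ (inj₂ (inj₂ (refl , refl))) = par , ρ , y , p₁ , p₂ , exchange sk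

data Depth {n} (par : Parents n) (v : Fin n) : ℕ → Set where
  top  : par v ≡ nothing → Depth par v 0
  down : ∀ {p k} → par v ≡ just p → Depth par p k → Depth par v (suc k)

depth : ∀ {n} {par : Parents n} {v} → Grounded par v → ∃ (Depth par v)
depth (root e) = 0 , top e
depth (child e g) = let (k , d) = depth g in suc k , down e d

Depth-hang : ∀ {n} {par : Parents n} {x m v k} → Depth par v k → ¬ Anc par x v → Depth (hang par x m) v k
Depth-hang {par = par} {x} {m} {v} (top e) ¬a = top (trans (hang-off par x m (λ { refl → ¬a self })) e)
Depth-hang {par = par} {x} {m} {v} (down e d) ¬a = down (trans (hang-off par x m (λ { refl → ¬a self })) e) (Depth-hang d (λ b → ¬a (up e b)))

-- Exchange of the tree edge {f₁, p} for the extra edge {f₁, f₂}.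
rehang : ∀ {n} {G : Graph n} {par : Parents n} {ρ e₁ e₂ f₁ f₂ p : Fin n} → Skeleton G par ρ e₁ e₂ f₁ f₂ →
  ¬ Anc par f₁ f₂ → par f₁ ≡ just p → Skeleton G (hang par f₁ (just f₂)) ρ e₁ e₂ f₁ p
rehang {n} {G} {par} {ρ} {e₁} {e₂} {f₁} {f₂} {p} sk ¬a e = record
  { tree = record
    { forest = hang-forest par f₁ (just f₂) forest (λ { refl → ¬a })
    ; root≡ = trans (off (λ { refl → just≢nothing e root≡ })) root≡
    ; rooted = rooted′
    ; sound = λ {v} → sound′ {v} }
  ; e-edge = e-edge
  ; f-edge = sound e
  ; e-new = λ { (inj₁ t) → e-new′ t (λ s → distinct s) ; (inj₂ t) → flipped t }
  ; f-new = λ { (inj₁ t) → f-new (inj₁ (subst (λ z → par f₁ ≡ just z) (same-just t at) e))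
              ; (inj₂ t) → no-loop forest e (up (trans (sym (off (≢-sym (parent-≢ forest e)))) t) self) }
  ; distinct = λ { (inj₁ (refl , refl)) → e-new (inj₁ e) ; (inj₂ (refl , refl)) → e-new (inj₂ e) }
  ; complete = complete′ }
  where
  open Skeleton sk
  par' = hang par f₁ (just f₂)
  at : par' f₁ ≡ just f₂
  at = hang-at par f₁ (just f₂)
  off : ∀ {v} → v ≢ f₁ → par' v ≡ par v
  off = hang-off par f₁ (just f₂)
  rooted′ : ∀ v → Anc par' ρ v
  rooted′ v with Anc? forest f₁ v
  ... | no ¬b = Anc-hang⁺ par f₁ (just f₂) forest (rooted v) (inj₁ ¬b)
  ... | yes b = Anc-trans (up at (Anc-hang⁺ par f₁ (just f₂) forest (rooted f₂) (inj₁ ¬a)))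
                          (Anc-hang⁺ par f₁ (just f₂) forest b (inj₂ self))
  sound′ : ∀ {v q} → par' v ≡ just q → Adj G v q
  sound′ {v} t with v ≟ f₁
  sound′ refl | yes refl = f-edge
  ... | no _ = sound t
  e-new′ : par' e₁ ≡ just e₂ → ¬ ¬ Same e₁ e₂ f₁ f₂
  e-new′ t ¬s with e₁ ≟ f₁
  ... | yes refl = ¬s (inj₁ (refl , sym (just-injective t)))
  ... | no ne = e-new (inj₁ t)
  flipped : par' e₂ ≡ just e₁ → ⊥
  flipped t with e₂ ≟ f₁
  ... | yes refl = distinct (inj₂ (sym (just-injective t) , refl))
  ... | no ne = e-new (inj₂ t)
  below′ : ∀ {u v} → par u ≡ just v → TreeEdge par' u v ⊎ Same u v e₁ e₂ ⊎ Same u v f₁ p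
  below′ {u} t with u ≟ f₁
  ... | yes refl = inj₂ (inj₂ (inj₁ (refl , same-just t e)))
  ... | no ne = inj₁ (inj₁ t)
  complete′ : ∀ {u v} → Adj G u v → TreeEdge par' u v ⊎ Same u v e₁ e₂ ⊎ Same u v f₁ p
  complete′ {u} {v} a with complete a
  ... | inj₂ (inj₁ s) = inj₂ (inj₁ s)
  ... | inj₂ (inj₂ (inj₁ (refl , refl))) = inj₁ (inj₁ at)
  ... | inj₂ (inj₂ (inj₂ (refl , refl))) = inj₁ (inj₂ at)
  ... | inj₁ (inj₁ t) = below′ t
  ... | inj₁ (inj₂ t) with below′ t
  ...   | inj₁ t' = inj₁ (TreeEdge-flip t')
  ...   | inj₂ (inj₁ (inj₁ (x , y))) = inj₂ (inj₁ (inj₂ (y , x)))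
  ...   | inj₂ (inj₁ (inj₂ (x , y))) = inj₂ (inj₁ (inj₁ (y , x)))
  ...   | inj₂ (inj₂ (inj₁ (x , y))) = inj₂ (inj₂ (inj₂ (y , x)))
  ...   | inj₂ (inj₂ (inj₂ (x , y))) = inj₂ (inj₂ (inj₁ (y , x)))

abstract
  -- If `f₁` and `f₂` are incomparable, the exchange makes the edge from `f₁` to its parent the new
  -- extra edge. This parent, which has smaller depth, takes over the role of `f₁`; the process
  -- stops at the latest when it is the root. The edge `e` stays fixed throughout.
  make-back-edge : ∀ {n} {G : Graph n} {k par ρ e₁ e₂ f₁ f₂} → Depth par f₁ k → Skeleton G par ρ e₁ e₂ f₁ f₂ →
    ∃ λ par' → ∃ λ w → ∃ λ d → Skeleton G par' ρ e₁ e₂ w d × Anc par' d w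
  make-back-edge {par = par} {f₁ = f₁} {f₂} D sk with Anc? (Skeleton.forest sk) f₁ f₂ | Anc? (Skeleton.forest sk) f₂ f₁
  ... | yes a | _ = par , f₂ , f₁ , flip-f sk , a
  ... | no _ | yes a = par , f₁ , f₂ , sk , a
  make-back-edge {ρ = ρ} {f₁ = f₁} (top e) sk | no ¬a | no _ =
    ⊥-elim (¬a (subst (λ z → Anc _ z _) (Anc-root e (Skeleton.rooted sk f₁)) (Skeleton.rooted sk _)))
  make-back-edge (down e D) sk | no ¬a | no _ =
    make-back-edge (Depth-hang D (no-loop (Skeleton.forest sk) e)) (flip-f (rehang sk ¬a e))

-- If d lies on the cycle closed by e = {y, ρ}, rotating this cycle turns d into the root.
abstract
  rotate : ∀ {n} {G : Graph n} {par : Parents n} {ρ y w d : Fin n} → Skeleton G par ρ y ρ w d →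
    Anc par d w → d ≢ ρ → Anc par d y → ∃ λ par' → ∃ λ p → Skeleton G par' d p d w d
  rotate {n} {G} {par} {ρ} {y} {w} {d} sk dw d≢ρ dy with Anc-has-parent (Skeleton.rooted sk d) (≢-sym d≢ρ)
  ... | p , d-p , _ = par₂ , p , record
    { tree = record { forest = forest₂ ; root≡ = root₂ ; rooted = rooted₂ ; sound = λ {v} → sound₂ {v} }
    ; e-edge = Adj-sym G (sound d-p) ; f-edge = f-edge
    ; e-new = λ { (inj₁ t) → p-above t ; (inj₂ t) → just≢nothing t root₂ }
    ; f-new = λ { (inj₁ t) → w-above t ; (inj₂ t) → just≢nothing t root₂ }
    ; distinct = λ { (inj₁ (refl , _)) → f-new (inj₂ d-p) ; (inj₂ (p≡d , _)) → parent-≢ forest d-p (sym p≡d) }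
    ; complete = complete₂ }
    where
    open Skeleton sk
    par₁ par₂ : Parents n
    par₁ = hang par d nothing
    par₂ = hang par₁ ρ (just y)
    at₁ : par₁ d ≡ nothing
    at₁ = hang-at par d nothing
    at₂ : par₂ ρ ≡ just y
    at₂ = hang-at par₁ ρ (just y)
    off : ∀ {v} → v ≢ ρ → v ≢ d → par₂ v ≡ par v
    off v≢ρ v≢d = trans (hang-off par₁ ρ (just y) v≢ρ) (hang-off par d nothing v≢d)
    forest₁ : Forest par₁
    forest₁ = hang-forest par d nothing forest (λ ())
    dy₁ : Anc par₁ d y
    dy₁ = Anc-hang⁺ par d nothing forest dy (inj₂ self)
    separate : ∀ {v} → Anc par₁ d v → ¬ Anc par₁ ρ v
    separate dv ρv with Anc-compare ρv dv
    ... | inj₁ ρd = d≢ρ (sym (Anc-root at₁ ρd))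
    ... | inj₂ dρ = d≢ρ (Anc-root (trans (hang-off par d nothing (≢-sym d≢ρ)) root≡) dρ)
    forest₂ : Forest par₂
    forest₂ = hang-forest par₁ ρ (just y) forest₁ (λ { refl → separate dy₁ })
    root₂ : par₂ d ≡ nothing
    root₂ = trans (hang-off par₁ ρ (just y) d≢ρ) at₁
    keep-d : ∀ {v} → Anc par₁ d v → Anc par₂ d v
    keep-d a = Anc-hang⁺ par₁ ρ (just y) forest₁ a (inj₁ (separate a))
    rooted₂ : ∀ v → Anc par₂ d v
    rooted₂ v with Anc? forest d v
    ... | yes dv = keep-d (Anc-hang⁺ par d nothing forest dv (inj₂ self))
    ... | no ¬dv = Anc-trans (up at₂ (keep-d dy₁))
          (Anc-hang⁺ par₁ ρ (just y) forest₁ (Anc-hang⁺ par d nothing forest (rooted v) (inj₁ ¬dv)) (inj₂ self))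
    sound₂ : ∀ {v q} → par₂ v ≡ just q → Adj G v q
    sound₂ {v} t with v ≟ ρ
    sound₂ refl | yes refl = Adj-sym G e-edge
    ... | no _ with v ≟ d
    sound₂ () | no _ | yes refl
    sound₂ t | no _ | no _ = sound t
    p-above : par₂ p ≡ just d → ⊥
    p-above t with p ≟ ρ
    ... | yes refl = e-new (inj₁ (subst (λ z → par z ≡ just ρ) (sym (just-injective t)) d-p))
    ... | no p≢ρ with p ≟ d
    p-above () | no _ | yes refl
    ...   | no _ = no-loop forest d-p (up t self)
    w-above : par₂ w ≡ just d → ⊥
    w-above t with w ≟ ρ
    ... | yes refl = d≢ρ (Anc-root root≡ dw)
    ... | no _ with w ≟ d
    w-above () | no _ | yes refl
    ...   | no _ = f-new (inj₁ t)
    above : ∀ {u v} → par u ≡ just v → TreeEdge par₂ u v ⊎ Same u v p d ⊎ Same u v w d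
    above {u} t with u ≟ d
    ... | yes refl = inj₂ (inj₁ (inj₂ (refl , same-just t d-p)))
    ... | no u≢d = inj₁ (inj₁ (trans (off (λ { refl → just≢nothing t root≡ }) u≢d) t))
    complete₂ : ∀ {u v} → Adj G u v → TreeEdge par₂ u v ⊎ Same u v p d ⊎ Same u v w d
    complete₂ {u} {v} a with complete a
    ... | inj₂ (inj₂ s) = inj₂ (inj₂ s)
    ... | inj₂ (inj₁ (inj₁ (refl , refl))) = inj₁ (inj₂ at₂)
    ... | inj₂ (inj₁ (inj₂ (refl , refl))) = inj₁ (inj₁ at₂)
    ... | inj₁ (inj₁ t) = above t
    ... | inj₁ (inj₂ t) with above t
    ...   | inj₁ t' = inj₁ (TreeEdge-flip t')
    ...   | inj₂ (inj₁ (inj₁ (x , y))) = inj₂ (inj₁ (inj₂ (y , x)))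
    ...   | inj₂ (inj₁ (inj₂ (x , y))) = inj₂ (inj₁ (inj₁ (y , x)))
    ...   | inj₂ (inj₂ (inj₁ (x , y))) = inj₂ (inj₂ (inj₂ (y , x)))
    ...   | inj₂ (inj₂ (inj₂ (x , y))) = inj₂ (inj₂ (inj₁ (y , x)))

-- The cycles are closed by the edges `y ρ` and `w d`; the second runs from `d` down through `r` to
-- `w`. By `r-y` and `d-y` they are disjoint or meet only in `d ≡ ρ`.
record Cactus {n} (G : Graph n) : Set where
  field
    {par} : Parents n
    {ρ y w d r} : Fin n
    skeleton : Skeleton G par ρ y ρ w d
    r-child  : par r ≡ just d
    r-w      : Anc par r w
    r-y      : ¬ Anc par r y
    d-y      : d ≡ ρ ⊎ ¬ Anc par d y

-- Both cycles start at `c` with the edge to `r`.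
record ThetaSkeleton {n} (G : Graph n) : Set where
  field
    {par} : Parents n
    {c y w r} : Fin n
    skeleton : Skeleton G par c y c w c
    r-child  : par r ≡ just c
    r-w      : Anc par r w
    r-y      : Anc par r y

cactus-or-theta : ∀ {n} (G : Graph n) → Bicyclic G → Fin n → Cactus G ⊎ ThetaSkeleton G
cactus-or-theta {n} G bi v₀ with skeleton-rooted-on-cycle G bi v₀
... | par₀ , ρ , y , f₁ , f₂ , sk₀ with make-back-edge (proj₂ (depth (Skeleton.forest sk₀ f₁))) sk₀
...   | par , w , d , sk , dw = decide (d ≟ ρ) (Anc? (Skeleton.forest sk) d y)
  where
  classify : ∀ {par : Parents n} {ρ y w d} → Skeleton G par ρ y ρ w d → Anc par d w → d ≡ ρ ⊎ ¬ Anc par d y → Cactus G ⊎ ThetaSkeleton G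
  classify {par} {ρ} {y} {w} {d} sk dw h with Anc-child dw (≢-sym (Adj-irrefl G (Skeleton.f-edge sk)))
  ... | r , e , rw with Anc? (Skeleton.forest sk) r y
  ...   | no ¬ry = inj₁ record { skeleton = sk ; r-child = e ; r-w = rw ; r-y = ¬ry ; d-y = h }
  classify sk dw (inj₁ refl) | r , e , rw | yes ry = inj₂ record { skeleton = sk ; r-child = e ; r-w = rw ; r-y = ry }
  classify sk dw (inj₂ ¬dy) | r , e , rw | yes ry = ⊥-elim (¬dy (Anc-trans (up e self) ry))
  decide : Dec (d ≡ ρ) → Dec (Anc par d y) → Cactus G ⊎ ThetaSkeleton G
  decide (yes e) _ = classify sk dw (inj₁ e)
  decide (no _) (no ¬dy) = classify sk dw (inj₂ ¬dy)
  -- Here `d` lies on the first cycle below its root; after the rotation both extra edges end at the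
  -- root `d`.
  decide (no d≢ρ) (yes dy) with rotate sk dw d≢ρ dy
  ... | par' , p , sk' = classify sk' (Skeleton.rooted sk' w) (inj₁ refl)

-- Cycles without a common edge

-- Glued at d, the two unicyclic parts of a cactus are centred at ρ and at d separately.  A set
-- C − centre, where C is one of the two cycles, has no image in its own part: it goes to a disconnected set
-- meeting both parts.
module CactusInjection {n} {G : Graph n} (cactus : Cactus G) where
  open Cactus cactus
  open Skeleton skeleton

  private
    y≢ρ : y ≢ ρ
    y≢ρ = Adj-irrefl G e-edge

    w≢d : w ≢ d
    w≢d = Adj-irrefl G f-edge

    r≢d : r ≢ d
    r≢d = parent-≢ forest r-child

    ¬r-d : ¬ Anc par r d
    ¬r-d = no-loop forest r-child

    ¬r-ρ : ¬ Anc par r ρ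
    ¬r-ρ a with Anc-root root≡ a
    ... | refl = just≢nothing r-child root≡

    w≢r : w ≢ r
    w≢r refl = f-new (inj₁ r-child)

    ρ-child : ∃ λ b → par b ≡ just ρ × Anc par b y
    ρ-child = Anc-child (rooted y) (≢-sym y≢ρ)

    r₁ : Fin n
    r₁ = proj₁ ρ-child

    r₁-child : par r₁ ≡ just ρ
    r₁-child = proj₁ (proj₂ ρ-child)

    r₁-y : Anc par r₁ y
    r₁-y = proj₂ (proj₂ ρ-child)

    y≢r₁ : y ≢ r₁
    y≢r₁ e = e-new (inj₁ (subst (λ z → par z ≡ just ρ) (sym e) r₁-child))

    -- The edge `y ρ` lies outside the subtree of `r`, and the edge `w d` leaves it at `d`, as the
    -- tree edge from `r` does. So `d` is a cut vertex.
    enter : ∀ {a b} → Adj G a b → ¬ Anc par r a → Anc par r b → a ≡ d × (b ≡ r ⊎ b ≡ w)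
    enter {a} {b} ab ¬ra rb with complete ab
    ... | inj₁ (inj₁ e) = ⊥-elim (¬ra (up e rb))
    ... | inj₂ (inj₁ (inj₁ (_ , refl))) = ⊥-elim (¬r-ρ rb)
    ... | inj₂ (inj₁ (inj₂ (_ , refl))) = ⊥-elim (r-y rb)
    ... | inj₂ (inj₂ (inj₁ (refl , _))) = ⊥-elim (¬ra r-w)
    ... | inj₂ (inj₂ (inj₂ (refl , refl))) = refl , inj₂ refl
    ... | inj₁ (inj₂ e) with r ≟ b
    ...   | yes refl = same-just e r-child , inj₁ refl
    ...   | no r≢b = ⊥-elim (¬ra (Anc-parent e rb r≢b))

  M₁ M₂ R₁ R₂ : Fin n → Set
  M₁ v = ¬ Anc par r v
  M₂ v = v ≡ d ⊎ Anc par r v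
  R₁ v = v ≡ r₁ ⊎ v ≡ y
  R₂ v = v ≡ r ⊎ v ≡ w

  par₂ : Parents n
  par₂ = hang par d nothing

  form₁ : Form G par M₁ ρ r₁ R₁
  form₁ = record
    { forest = forest ; R? = λ v → (v ≟ r₁) ⊎-dec (v ≟ y) ; c-root = root≡ ; q-child = r₁-child
    ; tree-edge = tree-edge ; centre-edge = centre-edge
    ; R-below = λ { (inj₁ refl) → self ; (inj₂ refl) → r₁-y }
    ; legs = two-legs root≡ r₁-child }
    where
    tree-edge : ∀ {u v} → M₁ u → M₁ v → u ≢ ρ → v ≢ ρ → Adj G u v → TreeEdge par u v
    tree-edge mu mv u≢ρ v≢ρ uv with complete uv
    ... | inj₁ t = t
    ... | inj₂ (inj₁ (inj₁ (_ , refl))) = ⊥-elim (v≢ρ refl)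
    ... | inj₂ (inj₁ (inj₂ (refl , _))) = ⊥-elim (u≢ρ refl)
    ... | inj₂ (inj₂ (inj₁ (refl , _))) = ⊥-elim (mu r-w)
    ... | inj₂ (inj₂ (inj₂ (_ , refl))) = ⊥-elim (mv r-w)
    centre-edge : ∀ {v} → M₁ v → Adj G ρ v → R₁ v ⊎ (par v ≡ just ρ × v ≢ r₁)
    centre-edge {v} mv ρv with complete ρv
    ... | inj₁ (inj₁ e) = ⊥-elim (just≢nothing e root≡)
    ... | inj₂ (inj₁ (inj₁ (e , _))) = ⊥-elim (y≢ρ (sym e))
    ... | inj₂ (inj₁ (inj₂ (_ , e))) = inj₁ (inj₂ e)
    ... | inj₂ (inj₂ (inj₁ (refl , _))) = ⊥-elim (¬r-ρ r-w)
    ... | inj₂ (inj₂ (inj₂ (_ , refl))) = ⊥-elim (mv r-w)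
    ... | inj₁ (inj₂ e) with v ≟ r₁
    ...   | yes eq = inj₁ (inj₁ eq)
    ...   | no ne = inj₂ (e , ne)

  form₂ : Form G par₂ M₂ d r R₂
  form₂ = record
    { forest = hang-forest par d nothing forest (λ ()) ; R? = λ v → (v ≟ r) ⊎-dec (v ≟ w)
    ; c-root = d-root ; q-child = r-child₂
    ; tree-edge = tree-edge ; centre-edge = centre-edge
    ; R-below = λ { (inj₁ refl) → self ; (inj₂ refl) → Anc-hang⁺ par d nothing forest r-w (inj₂ (up r-child self)) }
    ; legs = two-legs d-root r-child₂ }
    where
    d-root : par₂ d ≡ nothing
    d-root = hang-at par d nothing
    r-child₂ : par₂ r ≡ just d
    r-child₂ = trans (hang-off par d nothing r≢d) r-child
    tree-edge : ∀ {u v} → M₂ u → M₂ v → u ≢ d → v ≢ d → Adj G u v → TreeEdge par₂ u v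
    tree-edge (inj₁ e) _ u≢d _ _ = ⊥-elim (u≢d e)
    tree-edge (inj₂ _) (inj₁ e) _ v≢d _ = ⊥-elim (v≢d e)
    tree-edge (inj₂ ru) (inj₂ rv) u≢d v≢d uv with complete uv
    ... | inj₁ (inj₁ e) = inj₁ (trans (hang-off par d nothing u≢d) e)
    ... | inj₁ (inj₂ e) = inj₂ (trans (hang-off par d nothing v≢d) e)
    ... | inj₂ (inj₁ (inj₁ (refl , _))) = ⊥-elim (r-y ru)
    ... | inj₂ (inj₁ (inj₂ (_ , refl))) = ⊥-elim (r-y rv)
    ... | inj₂ (inj₂ (inj₁ (_ , e))) = ⊥-elim (v≢d e)
    ... | inj₂ (inj₂ (inj₂ (e , _))) = ⊥-elim (u≢d e)
    centre-edge : ∀ {v} → M₂ v → Adj G d v → R₂ v ⊎ (par₂ v ≡ just d × v ≢ r)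
    centre-edge (inj₁ refl) dv = ⊥-elim (Adj-irrefl G dv refl)
    centre-edge (inj₂ rv) dv = inj₁ (proj₂ (enter dv ¬r-d rv))

  private
    module F₁ = FormProperties form₁
    module F₂ = FormProperties form₂
    module E₁ = F₁.TwoLegs {y} id
    module E₂ = F₂.TwoLegs {w} id

    q∈₁ : ∀ {S} → F₁.Exceptional S → r₁ ∈ S
    q∈₁ X = Subtree.top∈ (F₁.Exceptional.subtree X)

    q∈₂ : ∀ {S} → F₂.Exceptional S → r ∈ S
    q∈₂ X = Subtree.top∈ (F₂.Exceptional.subtree X)

  core-above-y : ∀ {S v} → F₁.Exceptional S → v ∈ S → Anc par v y
  core-above-y X v∈ with F₁.Exceptional.core X v∈
  ... | _ , inj₁ refl , _ , a = Anc-trans a r₁-y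
  ... | _ , inj₂ refl , _ , a = a

  -- A vertex of the first cycle that can mark the outer side in the value of the second cycle's
  -- set.
  outer : ∃ λ z → z ≢ d × ¬ Anc par r z
  outer with y ≟ d
  ... | no y≢d = y , y≢d , r-y
  ... | yes refl = ρ , ≢-sym y≢ρ , ¬r-ρ

  private
    z : Fin n
    z = proj₁ outer

    z≢d : z ≢ d
    z≢d = proj₁ (proj₂ outer)

    ¬r-z : ¬ Anc par r z
    ¬r-z = proj₂ (proj₂ outer)

  -- The two vertices a and b cut all edges between d and the cycle through ρ.
  record Separating (S : Subset n) (a b : Fin n) : Set where
    field
      a∈      : a ∈ S
      b∈      : b ∈ S
      a≢b     : a ≢ b
      parent  : ∀ {p} → par d ≡ just p → p ∈ S → p ≡ a ⊎ p ≡ b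
      on-root : d ≡ ρ → (y ≡ a ⊎ y ≡ b) × (r₁ ≡ a ⊎ r₁ ≡ b)

  -- If `d` is the root, its neighbours on the cycle are `y` and `r₁`. If `d` hangs from a member of
  -- `S`, that parent is one of the two vertices; otherwise any two members do.
  separating : ∀ {S} → F₁.Exceptional S → ∃ λ a → ∃ λ b → Separating S a b
  separating {S} X = choose (d ≟ ρ) (parent-view {par = par} d)
    where
    r₁∈ = q∈₁ X
    y∈ = E₁.end-in X
    default : (∀ {p} → par d ≡ just p → p ∈ S → p ≡ y ⊎ p ≡ r₁) → ∃ λ a → ∃ λ b → Separating S a b
    default h = y , r₁ , record { a∈ = y∈ ; b∈ = r₁∈ ; a≢b = y≢r₁ ; parent = h ; on-root = λ _ → inj₁ refl , inj₂ refl }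
    choose : Dec (d ≡ ρ) → (par d ≡ nothing ⊎ ∃ λ p → par d ≡ just p) → ∃ λ a → ∃ λ b → Separating S a b
    choose _ (inj₁ e) = default (λ f → ⊥-elim (just≢nothing f e))
    choose (yes refl) (inj₂ (p , e)) = ⊥-elim (just≢nothing e root≡)
    choose (no d≢ρ) (inj₂ (p , e)) with p ∈? S
    ... | no p∉ = default (λ f p'∈ → ⊥-elim (p∉ (subst (_∈ S) (same-just f e) p'∈)))
    ... | yes p∈ with p ≟ y
    ...   | yes refl = default (λ f _ → inj₁ (same-just f e))
    ...   | no p≢y = p , y , record { a∈ = p∈ ; b∈ = y∈ ; a≢b = p≢y ; parent = λ f _ → inj₁ (same-just f e) ; on-root = λ d≡ρ → ⊥-elim (d≢ρ d≡ρ) }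

  -- `left` works around `ρ` and then exchanges the roles of `ρ` and `d`. A connected set meeting
  -- both sides contains the cut vertex `d` and is kept. The sets left over from the two cycles gain
  -- `d` and one vertex of the opposite side: `r` or `z`.
  data Placed (S Y : Subset n) : Set where
    left  : ∀ {Y₁} → (∀ {v} → v ∈ S → M₁ v) → F₁.Centred S Y₁ → Y ≡ recentre ρ d Y₁ → Placed S Y
    right : (∀ {v} → v ∈ S → M₂ v) → F₂.Centred S Y → Placed S Y
    mixed : ConnectedIn G S → d ∈ S → (∃ λ u → u ∈ S × u ≢ d × ¬ Anc par r u) → (∃ λ v → v ∈ S × Anc par r v) → Y ≡ S → Placed S Y
    left-cycle  : ∀ {a b} → (∀ {v} → v ∈ S → M₁ v) → ρ ∉ S → F₁.Exceptional S → Separating S a b →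
                  Y ≡ swap (swap S a d) b r → Placed S Y
    right-cycle : (∀ {v} → v ∈ S → M₂ v) → d ∉ S → F₂.Exceptional S →
                  Y ≡ swap (swap S w d) r z → Placed S Y

  place : ∀ {S} → ConnectedIn G S → 3 ≤ ∣ S ∣ → ∃ (Placed S)
  place {S} conn big with any? (λ v → (v ∈? S) ×-dec Anc? forest r v)
  ... | no ¬sub = done (F₁.centred-or-exceptional S⊆ conn big)
    where
    S⊆ : ∀ {v} → v ∈ S → M₁ v
    S⊆ v∈ rv = ¬sub (_ , v∈ , rv)
    done : ∃ (F₁.Centred S) ⊎ (ρ ∉ S × F₁.Exceptional S) → ∃ (Placed S)
    done (inj₁ (Y , x)) = _ , left S⊆ x refl
    done (inj₂ (ρ∉ , X)) = _ , left-cycle S⊆ ρ∉ X (proj₂ (proj₂ (separating X))) refl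
  ... | yes sub with any? (λ u → (u ∈? S) ×-dec (¬? (u ≟ d) ×-dec ¬? (Anc? forest r u)))
  ...   | no ¬out = done (F₂.centred-or-exceptional S⊆ conn big)
    where
    S⊆ : ∀ {v} → v ∈ S → M₂ v
    S⊆ {v} v∈ with v ≟ d | Anc? forest r v
    ... | yes e | _ = inj₁ e
    ... | no _ | yes a = inj₂ a
    ... | no v≢d | no ¬a = ⊥-elim (¬out (v , v∈ , v≢d , ¬a))
    done : ∃ (F₂.Centred S) ⊎ (d ∉ S × F₂.Exceptional S) → ∃ (Placed S)
    done (inj₁ (Y , x)) = _ , right S⊆ x
    done (inj₂ (d∉ , X)) = _ , right-cycle S⊆ d∉ X refl
  ...   | yes out@(u , u∈ , _ , ¬ru) with sub
  ...     | v , v∈ , rv with Path-crossing G (Anc? forest r) (conn u∈ v∈) ¬ru rv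
  ...       | a , b , a∈ , b∈ , ab , ¬ra , rb = S , mixed conn (subst (_∈ S) (proj₁ (enter ab ¬ra rb)) a∈) out sub refl

  Inner Outer : Subset n → Set
  Inner Y = ∃ λ v → v ∈ Y × Anc par r v
  Outer Y = ∃ λ u → u ∈ Y × u ≢ d × ¬ Anc par r u

  -- Which sides of `d` the value meets, whether it is connected and whether it contains `r` reveal
  -- how it arose. Injectivity thus reduces to each kind separately.
  data Profile (Y : Subset n) : Fin 5 → Set where
    p-left  : ¬ Inner Y → Profile Y zero
    p-right : Inner Y → ¬ Outer Y → Profile Y (suc zero)
    p-mixed : Inner Y → Outer Y → ConnectedIn G Y → Profile Y (suc (suc zero))
    p-left-cycle  : Inner Y → Outer Y → ¬ ConnectedIn G Y → r ∈ Y → Profile Y (suc (suc (suc zero)))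
    p-right-cycle : Inner Y → Outer Y → ¬ ConnectedIn G Y → r ∉ Y → Profile Y (suc (suc (suc (suc zero))))

  profile-unique : ∀ {Y i j} → Profile Y i → Profile Y j → i ≡ j
  profile-unique (p-left _) (p-left _) = refl
  profile-unique (p-left h) (p-right x _) = ⊥-elim (h x)
  profile-unique (p-left h) (p-mixed x _ _) = ⊥-elim (h x)
  profile-unique (p-left h) (p-left-cycle x _ _ _) = ⊥-elim (h x)
  profile-unique (p-left h) (p-right-cycle x _ _ _) = ⊥-elim (h x)
  profile-unique (p-right x _) (p-left h) = ⊥-elim (h x)
  profile-unique (p-right _ _) (p-right _ _) = refl
  profile-unique (p-right _ h) (p-mixed _ x _) = ⊥-elim (h x)
  profile-unique (p-right _ h) (p-left-cycle _ x _ _) = ⊥-elim (h x)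
  profile-unique (p-right _ h) (p-right-cycle _ x _ _) = ⊥-elim (h x)
  profile-unique (p-mixed x _ _) (p-left h) = ⊥-elim (h x)
  profile-unique (p-mixed _ x _) (p-right _ h) = ⊥-elim (h x)
  profile-unique (p-mixed _ _ _) (p-mixed _ _ _) = refl
  profile-unique (p-mixed _ _ c) (p-left-cycle _ _ ¬c _) = ⊥-elim (¬c c)
  profile-unique (p-mixed _ _ c) (p-right-cycle _ _ ¬c _) = ⊥-elim (¬c c)
  profile-unique (p-left-cycle x _ _ _) (p-left h) = ⊥-elim (h x)
  profile-unique (p-left-cycle _ x _ _) (p-right _ h) = ⊥-elim (h x)
  profile-unique (p-left-cycle _ _ ¬c _) (p-mixed _ _ c) = ⊥-elim (¬c c)
  profile-unique (p-left-cycle _ _ _ _) (p-left-cycle _ _ _ _) = refl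
  profile-unique (p-left-cycle _ _ _ r∈) (p-right-cycle _ _ _ r∉) = ⊥-elim (r∉ r∈)
  profile-unique (p-right-cycle x _ _ _) (p-left h) = ⊥-elim (h x)
  profile-unique (p-right-cycle _ x _ _) (p-right _ h) = ⊥-elim (h x)
  profile-unique (p-right-cycle _ _ ¬c _) (p-mixed _ _ c) = ⊥-elim (¬c c)
  profile-unique (p-right-cycle _ _ _ r∉) (p-left-cycle _ _ _ r∈) = ⊥-elim (r∉ r∈)
  profile-unique (p-right-cycle _ _ _ _) (p-right-cycle _ _ _ _) = refl

  kind : ∀ {S Y} → Placed S Y → Fin 5
  kind (left _ _ _) = zero
  kind (right _ _) = suc zero
  kind (mixed _ _ _ _ _) = suc (suc zero)
  kind (left-cycle _ _ _ _ _) = suc (suc (suc zero))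
  kind (right-cycle _ _ _ _) = suc (suc (suc (suc zero)))

  d∉exceptional : ∀ {S} → ρ ∉ S → F₁.Exceptional S → d ∉ S
  d∉exceptional ρ∉ X d∈ = [ (λ { refl → ρ∉ d∈ }) , (λ ¬dy → ¬dy (core-above-y X d∈)) ]′ d-y

  -- The edge `d r` becomes a component: the neighbours of `d` in `S` are among the removed `a` and
  -- `b`, and `r` has no neighbour outside its subtree except `d`.
  left-cycle-disconnected : ∀ {S a b v} → (∀ {v} → v ∈ S → M₁ v) → ρ ∉ S → F₁.Exceptional S → Separating S a b →
    v ∈ S → v ≢ a → v ≢ b → ¬ ConnectedIn G (swap (swap S a d) b r)
  left-cycle-disconnected {S} {a} {b} {v₀} S⊆ ρ∉ X sep v₀∈ v₀≢a v₀≢b =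
    closed⇒¬connected G (λ v → v ≡ d ⊎ v ≡ r)
      (∈-swap-new (swap S a d) b r) (∈-swap-old (swap S a d) b r v₀≢b (∈-swap-old S a d v₀≢a v₀∈)) (inj₂ refl)
      (λ { (inj₁ refl) → d∉exceptional ρ∉ X v₀∈ ; (inj₂ refl) → S⊆ v₀∈ self }) step
    where
    open Separating sep
    member : ∀ {v} → v ∈ swap (swap S a d) b r → (v ≡ d ⊎ v ≡ r) ⊎ (v ∈ S × v ≢ a × v ≢ b)
    member v∈ with ∈-swap⁻ (swap S a d) b r v∈
    ... | inj₁ e = inj₁ (inj₂ e)
    ... | inj₂ (v≢b , v∈') with ∈-swap⁻ S a d v∈'
    ...   | inj₁ e = inj₁ (inj₁ e)
    ...   | inj₂ (v≢a , p) = inj₂ (p , v≢a , v≢b)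
    isolated : ∀ {v} → v ∈ S → v ≢ a → v ≢ b → ¬ Adj G d v
    isolated {v} v∈ v≢a v≢b dv with complete dv
    ... | inj₁ (inj₁ e) = [ v≢a , v≢b ]′ (parent e v∈)
    ... | inj₁ (inj₂ e) with d-y
    ...   | inj₂ ¬dy = ¬dy (Anc-trans (up e self) (core-above-y X v∈))
    ...   | inj₁ refl with F₁.core-child⇒q (inj₂ refl) (core-above-y X v∈) e
    ...     | refl = [ v≢a , v≢b ]′ (proj₂ (on-root refl))
    isolated v∈ v≢a v≢b dv | inj₂ (inj₁ (inj₁ (_ , refl))) = ρ∉ v∈
    isolated v∈ v≢a v≢b dv | inj₂ (inj₁ (inj₂ (refl , refl))) = [ v≢a , v≢b ]′ (proj₁ (on-root refl))
    isolated v∈ v≢a v≢b dv | inj₂ (inj₂ (inj₁ (e , _))) = w≢d (sym e)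
    isolated v∈ v≢a v≢b dv | inj₂ (inj₂ (inj₂ (_ , refl))) = S⊆ v∈ r-w
    step : ∀ {u v} → u ∈ swap (swap S a d) b r → v ∈ swap (swap S a d) b r → Adj G u v → u ≡ d ⊎ u ≡ r → v ≡ d ⊎ v ≡ r
    step u∈ v∈ uv h with member v∈
    ... | inj₁ e = e
    step u∈ v∈ uv (inj₁ refl) | inj₂ (v∈S , v≢a , v≢b) = ⊥-elim (isolated v∈S v≢a v≢b uv)
    step u∈ v∈ uv (inj₂ refl) | inj₂ (v∈S , v≢a , v≢b) = inj₁ (proj₁ (enter (Adj-sym G uv) (S⊆ v∈S) self))

  inner₂ : ∀ {S v} → (∀ {v} → v ∈ S → M₂ v) → d ∉ S → v ∈ S → Anc par r v
  inner₂ S⊆ d∉ v∈ = [ (λ { refl → ⊥-elim (d∉ v∈) }) , id ]′ (S⊆ v∈)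

  -- Edges leave the subtree of `r` only at `r` and `w`, and both vertices are removed.
  right-cycle-disconnected : ∀ {S v} → (∀ {v} → v ∈ S → M₂ v) → d ∉ S →
    v ∈ S → v ≢ w → v ≢ r → ¬ ConnectedIn G (swap (swap S w d) r z)
  right-cycle-disconnected {S} {v₀} S⊆ d∉ v₀∈ v₀≢w v₀≢r =
    closed⇒¬connected G (λ v → Anc par r v × v ≢ w × v ≢ r)
      (∈-swap-old (swap S w d) r z v₀≢r (∈-swap-old S w d v₀≢w v₀∈)) (∈-swap-new (swap S w d) r z)
      (inner₂ S⊆ d∉ v₀∈ , v₀≢w , v₀≢r) (λ { (rz , _) → ¬r-z rz }) step
    where
    step : ∀ {u v} → u ∈ swap (swap S w d) r z → v ∈ swap (swap S w d) r z → Adj G u v →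
           Anc par r u × u ≢ w × u ≢ r → Anc par r v × v ≢ w × v ≢ r
    step {u} {v} u∈ v∈ uv (ru , u≢w , u≢r) with Anc? forest r v
    ... | no ¬rv = ⊥-elim ([ u≢r , u≢w ]′ (proj₂ (enter (Adj-sym G uv) ¬rv ru)))
    ... | yes rv with ∈-swap⁻ (swap S w d) r z v∈
    ...   | inj₁ refl = ⊥-elim (¬r-z rv)
    ...   | inj₂ (v≢r , v∈') with ∈-swap⁻ S w d v∈'
    ...     | inj₁ refl = ⊥-elim (¬r-d rv)
    ...     | inj₂ (v≢w , _) = rv , v≢w , v≢r

  profile : ∀ {S Y} → 3 ≤ ∣ S ∣ → (p : Placed S Y) → Profile Y (kind p)
  profile big (left {Y₁} S⊆ x refl) = p-left λ { (v , v∈ , rv) → out v∈ rv }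
    where
    out : ∀ {v} → v ∈ recentre ρ d Y₁ → ¬ Anc par r v
    out v∈ with recentre-members ρ d Y₁ v∈
    ... | inj₁ refl = ¬r-d
    ... | inj₂ v∈₁ with F₁.centred-members x v∈₁
    ...   | inj₁ refl = ¬r-ρ
    ...   | inj₂ v∈S = S⊆ v∈S
  profile {S} {Y} big (right S⊆ x) = p-right inner (λ { (u , u∈ , u≢d , ¬ru) → [ u≢d , ¬ru ]′ (in₂ u∈) })
    where
    in₂ : ∀ {v} → v ∈ Y → M₂ v
    in₂ v∈ = [ inj₁ , S⊆ ]′ (F₂.centred-members x v∈)
    inner : Inner Y
    inner with member-outside Y (d ∷ []) (≤-trans (s≤s (s≤s z≤n)) (subst (3 ≤_) (sym (F₂.centred-size x)) big))
    ... | v , v∈ , v∉ = v , v∈ , [ (λ e → ⊥-elim (v∉ (hereˡ e))) , id ]′ (in₂ v∈)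
  profile big (mixed conn _ out sub refl) = p-mixed sub out conn
  -- Two vertices are removed, so size three guarantees a survivor on the old side.
  profile {S} big (left-cycle {a} {b} S⊆ ρ∉ X sep refl) with member-outside S (a ∷ b ∷ []) big
  ... | v , v∈ , v∉ = p-left-cycle (r , ∈-swap-new (swap S a d) b r , self)
        (v , ∈-swap-old (swap S a d) b r (λ e → v∉ (thereˡ (hereˡ e))) (∈-swap-old S a d (λ e → v∉ (hereˡ e)) v∈) , (λ { refl → d∉exceptional ρ∉ X v∈ }) , S⊆ v∈)
        (left-cycle-disconnected S⊆ ρ∉ X sep v∈ (λ e → v∉ (hereˡ e)) (λ e → v∉ (thereˡ (hereˡ e))))
        (∈-swap-new (swap S a d) b r)
  profile {S} big (right-cycle S⊆ d∉ X refl) with member-outside S (w ∷ r ∷ []) big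
  ... | v , v∈ , v∉ = p-right-cycle
        (v , ∈-swap-old (swap S w d) r z (λ e → v∉ (thereˡ (hereˡ e))) (∈-swap-old S w d (λ e → v∉ (hereˡ e)) v∈) , inner₂ S⊆ d∉ v∈)
        (z , ∈-swap-new (swap S w d) r z , z≢d , ¬r-z)
        (right-cycle-disconnected S⊆ d∉ v∈ (λ e → v∉ (hereˡ e)) (λ e → v∉ (thereˡ (hereˡ e))))
        (∉-swap-out (swap S w d) r z (λ { e → ¬r-z (subst (Anc par r) e self) }))

  placed-injective : ∀ {S S' Y} → 3 ≤ ∣ S ∣ → 3 ≤ ∣ S' ∣ → Placed S Y → Placed S' Y → S ≡ S'
  placed-injective big big' p p' = go p p' (profile-unique (profile big p) (profile big' p'))
    where
    go : ∀ {S S' Y} (p : Placed S Y) (p' : Placed S' Y) → kind p ≡ kind p' → S ≡ S'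
    go (left {Y₁} S⊆ x e) (left {Y₁'} S'⊆ x' e') _
      with recentre-injective ρ d Y₁ Y₁' (F₁.centred-centre x) (F₁.centred-centre x') (trans (sym e) e')
    ... | refl = F₁.centred-injective ¬r-ρ S⊆ S'⊆ x x'
    go (right S⊆ x) (right S'⊆ x') _ = F₂.centred-injective (inj₁ refl) S⊆ S'⊆ x x'
    go (mixed _ _ _ _ refl) (mixed _ _ _ _ refl) _ = refl
    go (left-cycle _ _ X _ _) (left-cycle _ _ X' _ _) _ = E₁.exceptional-unique X X'
    go (right-cycle _ _ X _) (right-cycle _ _ X' _) _ = E₂.exceptional-unique X X'

  placed-centre : ∀ {S Y} → Placed S Y → d ∈ Y
  placed-centre (left {Y₁} _ _ refl) = recentre-centre ρ d Y₁
  placed-centre (right _ x) = F₂.centred-centre x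
  placed-centre (mixed _ d∈ _ _ refl) = d∈
  placed-centre {S} (left-cycle {a} {b} S⊆ ρ∉ X sep refl) =
    ∈-swap-old (swap S a d) b r (λ { refl → d∉exceptional ρ∉ X (Separating.b∈ sep) }) (∈-swap-new S a d)
  placed-centre {S} (right-cycle _ _ _ refl) = ∈-swap-old (swap S w d) r z (≢-sym r≢d) (∈-swap-new S w d)

  placed-size : ∀ {S Y} → Placed S Y → ∣ Y ∣ ≡ ∣ S ∣
  placed-size (left {Y₁} _ x refl) = trans (recentre-size ρ d Y₁ (F₁.centred-centre x)) (F₁.centred-size x)
  placed-size (right _ x) = F₂.centred-size x
  placed-size (mixed _ _ _ _ refl) = refl
  placed-size {S} (left-cycle {a} {b} S⊆ ρ∉ X sep refl) =
    trans (∣swap∣ (swap S a d) b r (∈-swap-old S a d (≢-sym a≢b) b∈) r∉) (∣swap∣ S a d a∈ (d∉exceptional ρ∉ X))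
    where
    open Separating sep
    r∉ : r ∉ swap S a d
    r∉ p = S⊆ (proj₂ (∈-swap⁻-old S a d r≢d p)) self
  placed-size {S} (right-cycle S⊆ d∉ X refl) =
    trans (∣swap∣ (swap S w d) r z (∈-swap-old S w d (≢-sym w≢r) (q∈₂ X)) z∉)
          (∣swap∣ S w d (E₂.end-in X) d∉)
    where
    z∉ : z ∉ swap S w d
    z∉ p = ¬r-z (inner₂ S⊆ d∉ (proj₂ (∈-swap⁻-old S w d z≢d p)))

-- Cycles with a common edge

-- The cycles through c run along two of the three legs, the chains from a, b, g up to q.
-- The pointer from q to c need not be an edge of G.
record ThetaShape {n} (G : Graph n) (par : Parents n) (c q a b g : Fin n) : Set where
  field
    forest      : Forest par
    c-root      : par c ≡ nothing
    q-child     : par q ≡ just c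
    rooted      : ∀ v → Anc par c v
    tree-edge   : ∀ {u v} → u ≢ c → v ≢ c → Adj G u v → TreeEdge par u v
    centre-edge : ∀ {v} → Adj G c v → (v ≡ a ⊎ v ≡ b ⊎ v ≡ g) ⊎ (par v ≡ just c × v ≢ q)
    sound       : ∀ {v p} → par v ≡ just p → v ≢ q → Adj G v p
    q-a         : Anc par q a
    q-b         : Anc par q b
    q-g         : Anc par q g
    c-a         : Adj G c a
    c-b         : Adj G c b
    c-g         : Adj G c g
    a≢b         : a ≢ b
    a≢g         : a ≢ g
    b≢g         : b ≢ g
    legs-ab     : ∀ {v} → Anc par v a → Anc par v b → v ≢ c → v ≡ q
    legs-ag     : ∀ {v} → Anc par v a → Anc par v g → v ≢ c → v ≡ q

record Theta {n} (G : Graph n) (par : Parents n) (c q a b g : Fin n) : Set where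
  field
    shape   : ThetaShape G par c q a b g
    legs-bg : ∀ {v} → Anc par v b → Anc par v g → v ≢ c → v ≡ q
  open ThetaShape shape public

module _ {n} {G : Graph n} {par : Parents n} {c q a b g : Fin n} (θ : Theta G par c q a b g) where
  open Theta θ

  swap-ab : Theta G par c q b a g
  swap-ab = record
    { shape = record
      { forest = forest ; c-root = c-root ; q-child = q-child ; rooted = rooted ; tree-edge = tree-edge
      ; centre-edge = λ e → [ (λ { (inj₁ x) → inj₁ (inj₂ (inj₁ x)) ; (inj₂ (inj₁ x)) → inj₁ (inj₁ x) ; (inj₂ (inj₂ x)) → inj₁ (inj₂ (inj₂ x)) }) , inj₂ ]′ (centre-edge e)
      ; sound = sound ; q-a = q-b ; q-b = q-a ; q-g = q-g ; c-a = c-b ; c-b = c-a ; c-g = c-g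
      ; a≢b = ≢-sym a≢b ; a≢g = b≢g ; b≢g = a≢g ; legs-ab = λ x y → legs-ab y x ; legs-ag = legs-bg }
    ; legs-bg = legs-ag }

  swap-bg : Theta G par c q a g b
  swap-bg = record
    { shape = record
      { forest = forest ; c-root = c-root ; q-child = q-child ; rooted = rooted ; tree-edge = tree-edge
      ; centre-edge = λ e → [ (λ { (inj₁ x) → inj₁ (inj₁ x) ; (inj₂ (inj₁ x)) → inj₁ (inj₂ (inj₂ x)) ; (inj₂ (inj₂ x)) → inj₁ (inj₂ (inj₁ x)) }) , inj₂ ]′ (centre-edge e)
      ; sound = sound ; q-a = q-a ; q-b = q-g ; q-g = q-b ; c-a = c-a ; c-b = c-g ; c-g = c-b
      ; a≢b = a≢g ; a≢g = a≢b ; b≢g = ≢-sym b≢g ; legs-ab = legs-ag ; legs-ag = legs-ab }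
    ; legs-bg = λ x y → legs-bg y x }

-- The root q of the component of the centre moves one step down, to its child s.
module Shift {n} {G : Graph n} {par : Parents n} {c q a b g s : Fin n} (shape : ThetaShape G par c q a b g)
             (s-q : par s ≡ just q) (s-b : Anc par s b) (s-g : Anc par s g) where
  open ThetaShape shape

  par₁ par₂ : Parents n
  par₁ = hang par s (just c)
  par₂ = hang par₁ q (just s)

  private
    q≢c : q ≢ c
    q≢c = parent-≢ forest q-child

    s≢q : s ≢ q
    s≢q = parent-≢ forest s-q

    s≢c : s ≢ c
    s≢c refl = just≢nothing s-q c-root

    ¬s-q : ¬ Anc par s q
    ¬s-q = no-loop forest s-q

    ¬s-a : ¬ Anc par s a
    ¬s-a sa = s≢q (legs-ab sa s-b s≢c)

    at-s : par₂ s ≡ just c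
    at-s = trans (hang-off par₁ q (just s) s≢q) (hang-at par s (just c))

    at-q : par₂ q ≡ just s
    at-q = hang-at par₁ q (just s)

    off : ∀ {v} → v ≢ s → v ≢ q → par₂ v ≡ par v
    off v≢s v≢q = trans (hang-off par₁ q (just s) v≢q) (hang-off par s (just c) v≢s)

    c-root₁ : par₁ c ≡ nothing
    c-root₁ = trans (hang-off par s (just c) (≢-sym s≢c)) c-root

    c-root₂ : par₂ c ≡ nothing
    c-root₂ = trans (off (≢-sym s≢c) (≢-sym q≢c)) c-root

    forest₁ : Forest par₁
    forest₁ = hang-forest par s (just c) forest (λ { refl sc → s≢c (Anc-root c-root sc) })

    ¬q-s₁ : ¬ Anc par₁ q s
    ¬q-s₁ qs = q≢c (Anc-root c-root₁ (Anc-parent (hang-at par s (just c)) qs (≢-sym s≢q)))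

    forest₂ : Forest par₂
    forest₂ = hang-forest par₁ q (just s) forest₁ (λ { refl → ¬q-s₁ })

    to₁ : ∀ {u v} → Anc par u v → ¬ Anc par s v ⊎ Anc par s u → Anc par₁ u v
    to₁ = Anc-hang⁺ par s (just c) forest

    to₂ : ∀ {u v} → Anc par₁ u v → ¬ Anc par₁ q v ⊎ Anc par₁ q u → Anc par₂ u v
    to₂ = Anc-hang⁺ par₁ q (just s) forest₁

    ¬q-below-s : ∀ {v} → Anc par s v → ¬ Anc par₁ q v
    ¬q-below-s sv qv with Anc-compare qv (to₁ sv (inj₂ self))
    ... | inj₁ qs = ¬q-s₁ qs
    ... | inj₂ sq = s≢c (Anc-root c-root₁ (Anc-parent (trans (hang-off par s (just c) (≢-sym s≢q)) q-child) sq s≢q))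

    below-s : ∀ {u v} → Anc par s u → Anc par u v → Anc par₂ u v
    below-s su uv = to₂ (to₁ uv (inj₂ su)) (inj₁ (¬q-below-s (Anc-trans su uv)))

    s-a₂ : Anc par₂ s a
    s-a₂ = Anc-trans (up at-q self) (to₂ (to₁ q-a (inj₁ ¬s-a)) (inj₂ self))

    rooted₂ : ∀ v → Anc par₂ c v
    rooted₂ v with Anc? forest s v
    ... | yes sv = Anc-trans (up at-s self) (below-s self sv)
    ... | no ¬sv with Anc? forest₁ q v
    ...   | no ¬qv = to₂ (to₁ (rooted v) (inj₁ ¬sv)) (inj₁ ¬qv)
    ...   | yes qv = Anc-trans (up at-q (up at-s self)) (to₂ qv (inj₂ self))

    from₁ : ∀ {u v} → u ≢ c → Anc par₁ u v → Anc par u v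
    from₁ u≢c uv with Anc-hang⁻ par s (just c) uv
    ... | inj₁ a = a
    ... | inj₂ (_ , _ , refl , uc) = ⊥-elim (u≢c (Anc-root c-root₁ uc))

    legs₂ : ∀ {x} → Anc par s x → (∀ {v} → Anc par v a → Anc par v x → v ≢ c → v ≡ q) →
            ∀ {v} → Anc par₂ v a → Anc par₂ v x → v ≢ c → v ≡ s
    legs₂ {x} sx old {v} va vx v≢c with Anc-compare vx (below-s self sx)
    ... | inj₁ vs = above-root-child c-root₂ at-s vs v≢c
    ... | inj₂ sv with Anc-hang⁻ par₁ q (just s) va
    ...   | inj₂ (_ , _ , refl , vs) = above-root-child c-root₂ at-s vs v≢c
    ...   | inj₁ va₁ with Anc-hang⁻ par₁ q (just s) vx
    ...     | inj₂ (qx , _) = ⊥-elim (¬q-below-s sx qx)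
    ...     | inj₁ vx₁ with old (from₁ v≢c va₁) (from₁ v≢c vx₁) v≢c
    ...       | refl = ⊥-elim (¬q-below-s sx vx₁)

    tree-edge₂ : ∀ {u v} → u ≢ c → v ≢ c → Adj G u v → TreeEdge par₂ u v
    tree-edge₂ u≢c v≢c uv = [ (λ e → half v≢c e) , (λ e → TreeEdge-flip (half u≢c e)) ]′ (tree-edge u≢c v≢c uv)
      where
      half : ∀ {u v} → v ≢ c → par u ≡ just v → TreeEdge par₂ u v
      half {u} v≢c e with u ≟ s
      ... | yes refl with same-just e s-q
      ...   | refl = inj₂ at-q
      half {u} v≢c e | no u≢s with u ≟ q
      ... | yes refl = ⊥-elim (v≢c (same-just e q-child))
      ... | no u≢q = inj₁ (trans (hang-off par s (just c) u≢s) e)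

    centre-edge₂ : ∀ {v} → Adj G c v → (v ≡ a ⊎ v ≡ b ⊎ v ≡ g) ⊎ (par₂ v ≡ just c × v ≢ s)
    centre-edge₂ cv with centre-edge cv
    ... | inj₁ r = inj₁ r
    ... | inj₂ (e , v≢q) = inj₂ (trans (off v≢s v≢q) e , v≢s)
      where
      v≢s : _ ≢ s
      v≢s refl = q≢c (same-just s-q e)

    sound₂ : ∀ {v p} → par₂ v ≡ just p → v ≢ s → Adj G v p
    sound₂ {v} e v≢s with v ≟ q
    sound₂ refl v≢s | yes refl = Adj-sym G (sound s-q s≢q)
    ... | no v≢q = sound (trans (sym (hang-off par s (just c) v≢s)) e) v≢q

  shifted : ThetaShape G par₂ c s a b g
  shifted = record
    { forest = forest₂ ; c-root = c-root₂ ; q-child = at-s ; rooted = rooted₂ ; tree-edge = tree-edge₂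
    ; centre-edge = centre-edge₂ ; sound = sound₂
    ; q-a = s-a₂ ; q-b = below-s self s-b ; q-g = below-s self s-g ; c-a = c-a ; c-b = c-b ; c-g = c-g
    ; a≢b = a≢b ; a≢g = a≢g ; b≢g = b≢g ; legs-ab = legs₂ s-b legs-ab ; legs-ag = legs₂ s-g legs-ag }

  -- `s` now hangs from `c` directly instead of from the child `q` of `c`, so everything below `s`
  -- rises by one level.
  shifted-depth : ∀ {v k} → Anc par s v → Depth par v (suc k) → Depth par₂ v k
  shifted-depth self (down e (top f)) = ⊥-elim (just≢nothing q-child (subst (λ z → par z ≡ nothing) (same-just e s-q) f))
  shifted-depth self (down e (down f (top _))) = down at-s (top c-root₂)
  shifted-depth self (down e (down f (down h _))) with same-just e s-q
  ... | refl with same-just f q-child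
  ...   | refl = ⊥-elim (just≢nothing h c-root)
  shifted-depth (up e sp) (down f d) with same-just e f
  shifted-depth (up e sp) (down f (top h)) | refl with Anc-root h sp
  ... | refl = ⊥-elim (just≢nothing s-q h)
  shifted-depth {v} (up e sp) (down f d@(down _ _)) | refl =
    down (trans (off (λ { refl → no-loop forest e sp }) (λ { refl → ¬s-q (up e sp) })) e) (shifted-depth sp d)

-- While the legs of `b` and `g` share a child `s` of `q`, the root moves down to `s`, and `b` loses
-- one level each time. At the end `q` is the last vertex common to these legs.
separate-legs : ∀ {n} {G : Graph n} {k par c q a b g} → Depth par b k → ThetaShape G par c q a b g →
                ∃ λ par' → ∃ λ q' → Theta G par' c q' a b g
separate-legs {par = par} {c} {q} {a} {b} {g} D shape
  with any? (λ s → just? (par s) q ×-dec (Anc? (ThetaShape.forest shape) s b ×-dec Anc? (ThetaShape.forest shape) s g))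
... | no ¬s = par , q , record { shape = shape ; legs-bg = legs-bg }
  where
  open ThetaShape shape
  legs-bg : ∀ {v} → Anc par v b → Anc par v g → v ≢ c → v ≡ q
  legs-bg {v} vb vg v≢c with Anc-compare vb q-b
  ... | inj₁ vq = above-root-child c-root q-child vq v≢c
  ... | inj₂ qv with v ≟ q
  ...   | yes e = e
  ...   | no v≢q with Anc-child qv (≢-sym v≢q)
  ...     | s , e , sv = ⊥-elim (¬s (s , e , Anc-trans sv vb , Anc-trans sv vg))
separate-legs (top f) shape | yes (s , s-q , s-b , s-g) with Anc-root f s-b
... | refl = ⊥-elim (just≢nothing s-q f)
separate-legs (down e D) shape | yes (s , s-q , s-b , s-g) =
  separate-legs (Shift.shifted-depth shape s-q s-b s-g s-b (down e D)) (Shift.shifted shape s-q s-b s-g)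

theta-from-skeleton : ∀ {n} {G : Graph n} → ThetaSkeleton G →
  ∃ λ par → ∃ λ c → ∃ λ q → ∃ λ a → ∃ λ b → ∃ λ g → Theta G par c q a b g
theta-from-skeleton {n} {G} t = _ , c , proj₁ (proj₂ result) , r , y , w , proj₂ (proj₂ result)
  where
  open ThetaSkeleton t
  open Skeleton skeleton
  y≢c : y ≢ c
  y≢c = Adj-irrefl G e-edge
  w≢c : w ≢ c
  w≢c = Adj-irrefl G f-edge
  centre : ∀ {v} → Adj G c v → (v ≡ r ⊎ v ≡ y ⊎ v ≡ w) ⊎ (par v ≡ just c × v ≢ r)
  centre {v} cv with complete cv
  ... | inj₁ (inj₁ e) = ⊥-elim (just≢nothing e root≡)
  ... | inj₂ (inj₁ (inj₁ (e , _))) = ⊥-elim (y≢c (sym e))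
  ... | inj₂ (inj₁ (inj₂ (_ , e))) = inj₁ (inj₂ (inj₁ e))
  ... | inj₂ (inj₂ (inj₁ (e , _))) = ⊥-elim (w≢c (sym e))
  ... | inj₂ (inj₂ (inj₂ (_ , e))) = inj₁ (inj₂ (inj₂ e))
  ... | inj₁ (inj₂ e) with v ≟ r
  ...   | yes v≡r = inj₁ (inj₁ v≡r)
  ...   | no v≢r = inj₂ (e , v≢r)
  tree-edge : ∀ {u v} → u ≢ c → v ≢ c → Adj G u v → TreeEdge par u v
  tree-edge u≢c v≢c uv with complete uv
  ... | inj₁ t = t
  ... | inj₂ (inj₁ (inj₁ (_ , e))) = ⊥-elim (v≢c e)
  ... | inj₂ (inj₁ (inj₂ (e , _))) = ⊥-elim (u≢c e)
  ... | inj₂ (inj₂ (inj₁ (_ , e))) = ⊥-elim (v≢c e)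
  ... | inj₂ (inj₂ (inj₂ (e , _))) = ⊥-elim (u≢c e)
  -- At the start `a` and `q` are both `r`: this leg has no inner vertex, and its separation from
  -- the others is automatic. Each shift lengthens it.
  shape : ThetaShape G par c r r y w
  shape = record
    { forest = forest ; c-root = root≡ ; q-child = r-child ; rooted = rooted ; tree-edge = tree-edge ; centre-edge = centre
    ; sound = λ e _ → sound e ; q-a = self ; q-b = r-y ; q-g = r-w
    ; c-a = Adj-sym G (sound r-child) ; c-b = Adj-sym G e-edge ; c-g = Adj-sym G f-edge
    ; a≢b = λ { refl → e-new (inj₁ r-child) } ; a≢g = λ { refl → f-new (inj₁ r-child) }
    ; b≢g = λ { refl → distinct (inj₁ (refl , refl)) }
    ; legs-ab = λ va _ v≢c → above-root-child root≡ r-child va v≢c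
    ; legs-ag = λ va _ v≢c → above-root-child root≡ r-child va v≢c }
  result : ∃ λ par' → ∃ λ q' → Theta G par' c q' r y w
  result = separate-legs (proj₂ (depth (forest y))) shape

-- Legs, cycles and triangles around the two branch vertices

module _ {n : ℕ} where

  swap² : Subset n → Fin n → Fin n → Fin n → Fin n → Subset n
  swap² S x y x' y' = swap (swap S x y) x' y'

  ∈-swap²⁻ : ∀ S x y x' y' {u} → u ∈ swap² S x y x' y' → (u ≡ y ⊎ u ≡ y') ⊎ (u ≢ x × u ≢ x' × u ∈ S)
  ∈-swap²⁻ S x y x' y' u∈ with ∈-swap⁻ (swap S x y) x' y' u∈
  ... | inj₁ e = inj₁ (inj₂ e)
  ... | inj₂ (u≢x' , p) with ∈-swap⁻ S x y p
  ...   | inj₁ e = inj₁ (inj₁ e)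
  ...   | inj₂ (u≢x , u∈S) = inj₂ (u≢x , u≢x' , u∈S)

  ∈-swap²-old : ∀ S x y x' y' {u} → u ≢ x → u ≢ x' → u ∈ S → u ∈ swap² S x y x' y'
  ∈-swap²-old S x y x' y' u≢x u≢x' u∈ = ∈-swap-old (swap S x y) x' y' u≢x' (∈-swap-old S x y u≢x u∈)

  ∈-swap²-first : ∀ S x y x' y' → y ≢ x' → y ∈ swap² S x y x' y'
  ∈-swap²-first S x y x' y' y≢x' = ∈-swap-old (swap S x y) x' y' y≢x' (∈-swap-new S x y)

  ∈-swap²-second : ∀ S x y x' y' → y' ∈ swap² S x y x' y'
  ∈-swap²-second S x y x' y' = ∈-swap-new (swap S x y) x' y'

  ∉-swap² : ∀ S x y x' y' {u} → u ≢ y → u ≢ y' → (u ≡ x ⊎ u ≡ x' ⊎ u ∉ S) → u ∉ swap² S x y x' y'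
  ∉-swap² S x y x' y' u≢y u≢y' h p with ∈-swap²⁻ S x y x' y' p
  ... | inj₁ e = [ u≢y , u≢y' ]′ e
  ... | inj₂ (u≢x , u≢x' , u∈) = [ u≢x , [ u≢x' , (λ u∉ → u∉ u∈) ]′ ]′ h

  ∣swap²∣ : ∀ S x y x' y' → x ∈ S → y ∉ S → x' ∈ S → x' ≢ x → y' ∉ S → y' ≢ y → ∣ swap² S x y x' y' ∣ ≡ ∣ S ∣
  ∣swap²∣ S x y x' y' x∈ y∉ x'∈ x'≢x y'∉ y'≢y =
    trans (∣swap∣ (swap S x y) x' y' (∈-swap-old S x y x'≢x x'∈) (λ p → y'∉ (proj₂ (∈-swap⁻-old S x y y'≢y p))))
          (∣swap∣ S x y x∈ y∉)

module ThetaProperties {n} {G : Graph n} {par : Parents n} {c q a b g : Fin n} (θ : Theta G par c q a b g) where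
  open Theta θ public

  R : Fin n → Set
  R v = v ≡ a ⊎ v ≡ b ⊎ v ≡ g

  pattern is-a = inj₁ refl
  pattern is-b = inj₂ (inj₁ refl)
  pattern is-g = inj₂ (inj₂ refl)

  form : Form G par (λ _ → ⊤) c q R
  form = record
    { forest = forest ; R? = λ v → (v ≟ a) ⊎-dec ((v ≟ b) ⊎-dec (v ≟ g)) ; c-root = c-root ; q-child = q-child
    ; tree-edge = λ _ _ → tree-edge ; centre-edge = λ _ → centre-edge
    ; R-below = λ { is-a → q-a ; is-b → q-b ; is-g → q-g }
    ; legs = λ { is-a is-a ne → ⊥-elim (ne refl) ; is-b is-b ne → ⊥-elim (ne refl) ; is-g is-g ne → ⊥-elim (ne refl)
               ; is-a is-b _ → legs-ab ; is-a is-g _ → legs-ag ; is-b is-g _ → legs-bg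
               ; is-b is-a _ x y → legs-ab y x ; is-g is-a _ x y → legs-ag y x ; is-g is-b _ x y → legs-bg y x } }

  open Form form public using (legs; R-below)
  open FormProperties form public

  -- The path from `c` to `q` through `r` has no inner vertex if `r ≡ q`, and one if `r` is a child
  -- of `q`. All other legs count as long.
  Short : Fin n → Set
  Short r = r ≡ q ⊎ par r ≡ just q

  Short? : ∀ r → Dec (Short r)
  Short? r = (r ≟ q) ⊎-dec just? (par r) q

  q≢c : q ≢ c
  q≢c = parent-≢ forest q-child

  R≢c : ∀ {r} → R r → r ≢ c
  R≢c Rr refl = q≢c (Anc-root c-root (R-below Rr))

  core-below-q : ∀ {r v} → R r → Anc par v r → v ≢ c → Anc par q v
  core-below-q Rr vr v≢c with Anc-compare vr (R-below Rr)
  ... | inj₂ qv = qv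
  ... | inj₁ vq with above-root-child c-root q-child vq v≢c
  ...   | refl = self

  short-core : ∀ {r v} → Short r → Anc par v r → v ≢ c → v ≡ r ⊎ v ≡ q
  short-core (inj₁ refl) vr v≢c = inj₁ (above-root-child c-root q-child vr v≢c)
  short-core {r} {v} (inj₂ e) vr v≢c with v ≟ r
  ... | yes eq = inj₁ eq
  ... | no v≢r = inj₂ (above-root-child c-root q-child (Anc-parent e vr v≢r) v≢c)

  leg-parent : ∀ {r} → R r → r ≢ q → ∃ λ p → par r ≡ just p × Anc par q p × p ≢ c
  leg-parent Rr r≢q with Anc-has-parent (R-below Rr) (≢-sym r≢q)
  ... | p , e , qp = p , e , qp , λ { refl → q≢c (Anc-root c-root qp) }

  module _ {S : Subset n} (X : Exceptional S) where
    open Exceptional X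

    exceptional-q : q ∈ S
    exceptional-q = Subtree.top∈ subtree

    leg-in : ∀ {r v} → R r → r ∈ S → Anc par v r → v ≢ c → v ∈ S
    leg-in Rr r∈ vr v≢c = Subtree.above-in subtree forest vr r∈ (core-below-q Rr vr v≢c)

  no-tree-triangle : ∀ {u v w} → TreeEdge par u v → TreeEdge par v w → TreeEdge par u w → ⊥
  no-tree-triangle (inj₁ uv) (inj₁ vw) (inj₁ uw) = parent-≢ forest vw (same-just uv uw)
  no-tree-triangle (inj₁ uv) (inj₁ vw) (inj₂ wu) = no-loop forest uv (up vw (up wu self))
  no-tree-triangle (inj₁ uv) (inj₂ wv) (inj₁ uw) = parent-≢ forest wv (same-just uw uv)
  no-tree-triangle (inj₁ uv) (inj₂ wv) (inj₂ wu) = parent-≢ forest uv (same-just wu wv)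
  no-tree-triangle (inj₂ vu) (inj₁ vw) (inj₁ uw) = parent-≢ forest uw (same-just vu vw)
  no-tree-triangle (inj₂ vu) (inj₁ vw) (inj₂ wu) = parent-≢ forest wu (same-just vw vu)
  no-tree-triangle (inj₂ vu) (inj₂ wv) (inj₁ uw) = no-loop forest vu (up uw (up wv self))
  no-tree-triangle (inj₂ vu) (inj₂ wv) (inj₂ wu) = parent-≢ forest vu (same-just wv wu)

  -- Of two adjacent neighbours of `c` one is the parent of the other; the lower one is an end, and
  -- the upper one, lying above two ends, must be `q`.
  triangle-at-centre : ∀ {u v} → Adj G c u → Adj G c v → Adj G u v → R q × ∃ λ x → (x ≡ u ⊎ x ≡ v) × R x × par x ≡ just q
  triangle-at-centre cu cv uv = [ half cu cv , (λ e → let (Rq , x , m , r) = half cv cu e in Rq , x , [ inj₂ , inj₁ ]′ m , r) ]′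
    (tree-edge (≢-sym (Adj-irrefl G cu)) (≢-sym (Adj-irrefl G cv)) uv)
    where
    half : ∀ {u v} → Adj G c u → Adj G c v → par u ≡ just v → R q × ∃ λ x → (x ≡ u ⊎ x ≡ v) × R x × par x ≡ just q
    half {u} {v} cu cv e with centre-edge cu
    ... | inj₂ (e' , _) = ⊥-elim (Adj-irrefl G cv (same-just e' e))
    ... | inj₁ Ru with centre-edge cv
    ...   | inj₂ (e' , v≢q) = ⊥-elim (v≢q (core-child⇒q Ru (up e self) e'))
    ...   | inj₁ Rv with legs Ru Rv (parent-≢ forest e) (up e self) self (R≢c Rv)
    ...     | refl = Rv , u , inj₁ refl , Ru , e

  triangle : ∀ {u v w} → Adj G u v → Adj G v w → Adj G u w → R q × ∃ λ x → (x ≡ u ⊎ x ≡ v ⊎ x ≡ w) × R x × par x ≡ just q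
  triangle {u} {v} {w} uv vw uw with u ≟ c | v ≟ c | w ≟ c
  ... | yes refl | _ | _ = let (Rq , x , m , r) = triangle-at-centre uv uw vw in Rq , x , inj₂ m , r
  ... | _ | yes refl | _ = let (Rq , x , m , r) = triangle-at-centre (Adj-sym G uv) vw uw in
                           Rq , x , [ inj₁ , inj₂ ∘ inj₂ ]′ m , r
  ... | _ | _ | yes refl = let (Rq , x , m , r) = triangle-at-centre (Adj-sym G uw) (Adj-sym G vw) uv in
                           Rq , x , [ inj₁ , inj₂ ∘ inj₁ ]′ m , r
  ... | no u≢c | no v≢c | no w≢c = ⊥-elim (no-tree-triangle (tree-edge u≢c v≢c uv) (tree-edge v≢c w≢c vw) (tree-edge u≢c w≢c uw))

  centre-leg : ∀ {r} → R r → Adj G c r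
  centre-leg is-a = c-a
  centre-leg is-b = c-b
  centre-leg is-g = c-g

  Cycle : Fin n → Fin n → Fin n → Set
  Cycle i j v = v ≡ c ⊎ (v ≢ c × (Anc par v i ⊎ Anc par v j))

  -- At `q` one neighbour is the next vertex on the leg of `i`, which exists since `i ≢ q`; the
  -- other is the next one on the leg of `j`, or `c` if `j ≡ q`.
  cycle-degree : ∀ {i j} → R i → R j → i ≢ j → i ≢ q → ∀ {v} → Cycle i j v →
    ∃ λ x → ∃ λ y → Cycle i j x × Cycle i j y × x ≢ y × Adj G v x × Adj G v y
  cycle-degree {i} {j} Ri Rj i≢j i≢q (inj₁ refl) =
    i , j , inj₂ (R≢c Ri , inj₁ self) , inj₂ (R≢c Rj , inj₂ self) , i≢j , centre-leg Ri , centre-leg Rj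
  cycle-degree {i} {j} Ri Rj i≢j i≢q {v} (inj₂ (v≢c , m)) with v ≟ q
  ... | no v≢q = [ inner (λ w≢c a → inj₂ (w≢c , inj₁ a)) Ri , inner (λ w≢c a → inj₂ (w≢c , inj₂ a)) Rj ]′ m
    where
    inner : ∀ {r} → (∀ {w} → w ≢ c → Anc par w r → Cycle i j w) → R r → Anc par v r →
            ∃ λ x → ∃ λ y → Cycle i j x × Cycle i j y × x ≢ y × Adj G v x × Adj G v y
    inner {r} on Rr vr with Anc-has-parent (core-below-q Rr vr v≢c) (≢-sym v≢q)
    ... | p , e , qp with v ≟ r
    ...   | yes refl = p , c , on (λ { refl → q≢c (Anc-root c-root qp) }) (up e self) , inj₁ refl ,
                       (λ { refl → q≢c (Anc-root c-root qp) }) , sound e v≢q , Adj-sym G (centre-leg Rr)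
    ...   | no v≢r with Anc-child vr v≢r
    ...     | s , f , sr = p , s , on (λ { refl → q≢c (Anc-root c-root qp) }) (Anc-trans (up e self) vr) ,
                           on s≢c sr , (λ { refl → no-loop forest e (up f self) }) , sound e v≢q ,
                           Adj-sym G (sound f (λ { refl → v≢c (same-just f q-child) }))
      where
      s≢c : s ≢ c
      s≢c refl = just≢nothing f c-root
  cycle-degree {i} {j} Ri Rj i≢j i≢q {v} (inj₂ (v≢c , m)) | yes refl with Anc-child (R-below Ri) (≢-sym i≢q)
  ... | s , e , si = other (j ≟ q)
    where
    s≢c : s ≢ c
    s≢c refl = just≢nothing e c-root
    qs : Adj G q s
    qs = Adj-sym G (sound e (λ { refl → q≢c (same-just e q-child) }))
    other : Dec (j ≡ q) → ∃ λ x → ∃ λ y → Cycle i j x × Cycle i j y × x ≢ y × Adj G q x × Adj G q y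
    other (yes refl) = s , c , inj₂ (s≢c , inj₁ si) , inj₁ refl , s≢c , qs , Adj-sym G (centre-leg Rj)
    other (no j≢q) with Anc-child (R-below Rj) (≢-sym j≢q)
    ... | s' , e' , sj = s , s' , inj₂ (s≢c , inj₁ si) , inj₂ (s'≢c , inj₂ sj) , s≢s' , qs ,
                         Adj-sym G (sound e' (λ { refl → q≢c (same-just e' q-child) }))
      where
      s'≢c : s' ≢ c
      s'≢c refl = just≢nothing e' c-root
      s≢s' : s ≢ s'
      s≢s' refl = parent-≢ forest e (legs Ri Rj i≢j si sj s≢c)

  -- The robber stays on the cycle through `c`, `i` and `j`. By `triangle`, the last premise leaves
  -- no triangle in `Y` that could help the cop.
  cycle⇒¬copwin : ∀ {i j} {Y : Subset n} → R i → R j → i ≢ j → i ≢ q → c ∈ Y →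
    (∀ {v} → v ≢ c → Anc par v i ⊎ Anc par v j → v ∈ Y) →
    (R q → ∀ {x} → x ∈ Y → R x → par x ≡ just q → ⊥) → ¬ InducedCopWin G Y
  cycle⇒¬copwin {i} {j} {Y} Ri Rj i≢j i≢q c∈ on no-tri =
    triangle-free⇒¬copwin G (Cycle i j) (λ { (inj₁ refl) → c∈ ; (inj₂ (v≢c , m)) → on v≢c m }) (c , inj₁ refl)
      (cycle-degree Ri Rj i≢j i≢q) no-triangle
    where
    no-triangle : ∀ {u v w} → u ∈ Y → v ∈ Y → w ∈ Y → Adj G u v → Adj G v w → Adj G u w → ⊥
    no-triangle u∈ v∈ w∈ uv vw uw with triangle uv vw uw
    ... | Rq , x , m , Rx , e = no-tri Rq ([ (λ { refl → u∈ }) , [ (λ { refl → v∈ }) , (λ { refl → w∈ }) ]′ ]′ m) Rx e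

  -- `bad` keeps `Y` apart from the kept sets, which are cop-win, and `free` from the regular
  -- images.
  record Compensates (S Y : Subset n) : Set where
    field
      size   : ∣ Y ∣ ≡ ∣ S ∣
      centre : c ∈ Y
      bad    : ¬ InducedCopWin G Y
      free   : ∀ {S' t} → c ∉ S' → Subtree par S' t → ¬ Image S' t Y

  NotTop NotCore NotLeg : Subset n → Set
  NotTop Y = ∀ {S' t} → c ∉ S' → Subtree par S' t → Y ≡ swap S' t c → ⊥
  NotCore Y = ∀ {S' t b' a'} → c ∉ S' → Subtree par S' t →
    (∀ {v} → v ∈ S' → par v ≡ just t → ∃ λ r → R r × r ∈ S' × Anc par v r) →
    b' ∈ S' → par b' ≡ just a' → a' ∈ S' → a' ≢ t → OffCore b' → Y ≡ swap S' a' c → ⊥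
  NotLeg Y = ∀ {S' r a'} → c ∉ S' → R r → r ∈ S' → (∀ {v} → v ∈ S' → Anc par v r) →
    par r ≡ just a' → a' ∈ S' → Y ≡ swap S' a' c → ⊥

  not-image : ∀ {Y} → NotTop Y → NotCore Y → NotLeg Y → ∀ {S' t} → c ∉ S' → Subtree par S' t → ¬ Image S' t Y
  not-image nt nc nl c∉ T (cut-top _ _ _) = nt c∉ T refl
  not-image nt nc nl c∉ T (cut-core h b∈ e a∈ a≢t off) = nc c∉ T h b∈ e a∈ a≢t off refl
  not-image nt nc nl c∉ T (cut-leg Rr r∈ _ chain e a∈ _ _) = nl c∉ Rr r∈ chain e a∈ refl

  module Preimage {Y S' : Subset n} {a' : Fin n} (c∉ : c ∉ S') (a'∈ : a' ∈ S') (Y≡ : Y ≡ swap S' a' c) where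

    back : ∀ {u} → u ∈ Y → u ≢ c → u ≢ a' × u ∈ S'
    back {u} u∈ u≢c = ∈-swap⁻-old S' a' c u≢c (subst (u ∈_) Y≡ u∈)

    forth : ∀ {u} → u ∈ S' → u ≢ a' → u ∈ Y
    forth {u} u∈ u≢a' = subst (u ∈_) (sym Y≡) (∈-swap-old S' a' c u≢a' u∈)

    a'≢c : a' ≢ c
    a'≢c refl = c∉ a'∈

    cut : a' ∉ Y
    cut p = proj₁ (back p a'≢c) refl

    q-top : ∀ {t} → Subtree par S' t → q ∈ S' → q ≡ t
    q-top {t} T q∈ with q ≟ t
    ... | yes e = e
    ... | no q≢t = ⊥-elim (c∉ (Subtree.parent-in T q∈ q≢t q-child))

  -- A subtree that contains `q` and avoids `c` has top `q`, which `cut-top` would have removed.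
  q∈⇒NotTop : ∀ {Y} → q ∈ Y → NotTop Y
  q∈⇒NotTop q∈ c∉ T e = proj₁ (back q∈ q≢c) (q-top T (proj₂ (back q∈ q≢c)))
    where open Preimage c∉ (Subtree.top∈ T) e

  -- `cut-core` leaves `b` in the image, and no end lies below `b`.
  core⇒NotCore : ∀ {Y} → (∀ {v} → v ∈ Y → v ≢ c → ∃ λ r → R r × Anc par v r) → NotCore Y
  core⇒NotCore core c∉ T _ b∈ e a∈ _ off y = let (r , Rr , br) = core (forth b∈ (parent-≢ forest e)) (λ { refl → c∉ b∈ }) in off r Rr br
    where open Preimage c∉ a∈ y

  -- After `cut-leg` all members except `c` lie above `r`, and the parent of `r` is missing.
  spread⇒NotLeg : ∀ {Y} → (∀ {r} → R r → r ∈ Y → (∃ λ u → u ∈ Y × u ≢ c × ¬ Anc par u r) ⊎ (∃ λ p → par r ≡ just p × p ∈ Y)) → NotLeg Y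
  spread⇒NotLeg {Y} spread {S'} {r} {a'} c∉ Rr r∈ chain e a∈ y with spread Rr (forth r∈ (parent-≢ forest e))
    where open Preimage c∉ a∈ y
  ... | inj₁ (u , u∈ , u≢c , ¬ur) = ¬ur (chain (proj₂ (back u∈ u≢c)))
    where open Preimage c∉ a∈ y
  ... | inj₂ (p , f , p∈) = cut (subst (_∈ Y) (same-just f e) p∈)
    where open Preimage c∉ a∈ y

-- Replacements for the exceptional sets

module Compensations {n} {G : Graph n} {par : Parents n} {c q a b g : Fin n} (θ : Theta G par c q a b g)
                     (a≢q : a ≢ q) (b≢q : b ≢ q) where
  open ThetaProperties θ

  Ra : R a
  Ra = is-a
  Rb : R b
  Rb = is-b
  Rg : R g
  Rg = is-g

  c-unlike : ∀ {S : Subset n} {v} → c ∉ S → v ∈ S → v ≢ c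
  c-unlike c∉ v∈ refl = c∉ v∈

  disjoint-leg : ∀ {r r' v} → R r → R r' → r ≢ r' → Anc par v r → v ≢ c → v ≢ q → ¬ Anc par v r'
  disjoint-leg Rr Rr' ne vr v≢c v≢q vr' = v≢q (legs Rr Rr' ne vr vr' v≢c)

  end-off : ∀ {r r'} → R r → R r' → r ≢ r' → r ≢ q → ¬ Anc par r r'
  end-off Rr Rr' ne r≢q = disjoint-leg Rr Rr' ne self (R≢c Rr) r≢q

  swap²-core : ∀ {S x x' l} → Exceptional S → R l → NotCore (swap² S x c x' l)
  swap²-core {S} {x} {x'} {l} X Rl = core⇒NotCore core
    where
    core : ∀ {v} → v ∈ swap² S x c x' l → v ≢ c → ∃ λ r → R r × Anc par v r
    core v∈ v≢c with ∈-swap²⁻ S x c x' l v∈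
    ... | inj₁ (inj₁ e) = ⊥-elim (v≢c e)
    ... | inj₁ (inj₂ refl) = l , Rl , self
    ... | inj₂ (_ , _ , v∈S) = let (r , Rr , _ , vr) = Exceptional.core X v∈S in r , Rr , vr

  -- The cycle along the legs of `a` and `g` survives. With `b` gone, a triangle would force `g ≡ q`
  -- and make `a` a child of `q`, against the last premise.
  remove-end : ∀ {S} → Exceptional S → c ∉ S → a ∈ S → b ∈ S → g ∈ S → g ≢ q ⊎ ¬ Short a → Compensates S (swap S b c)
  remove-end {S} X c∉ a∈ b∈ g∈ h = record
    { size = ∣swap∣ S b c b∈ c∉
    ; centre = ∈-swap-new S b c
    ; bad = cycle⇒¬copwin Ra Rg a≢g a≢q (∈-swap-new S b c) on no-tri
    ; free = not-image (q∈⇒NotTop (old (≢-sym b≢q) (exceptional-q X))) (core⇒NotCore core′) (spread⇒NotLeg spread) }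
    where
    old : ∀ {v} → v ≢ b → v ∈ S → v ∈ swap S b c
    old = ∈-swap-old S b c
    on : ∀ {v} → v ≢ c → Anc par v a ⊎ Anc par v g → v ∈ swap S b c
    on v≢c (inj₁ va) = old (λ { refl → end-off Rb Ra (≢-sym a≢b) b≢q va }) (leg-in X Ra a∈ va v≢c)
    on v≢c (inj₂ vg) = old (λ { refl → end-off Rb Rg b≢g b≢q vg }) (leg-in X Rg g∈ vg v≢c)
    no-tri : R q → ∀ {x} → x ∈ swap S b c → R x → par x ≡ just q → ⊥
    no-tri (inj₁ e) = ⊥-elim (a≢q (sym e))
    no-tri (inj₂ (inj₁ e)) = ⊥-elim (b≢q (sym e))
    no-tri (inj₂ (inj₂ e)) x∈ (inj₁ refl) f = [ (λ g≢q → g≢q (sym e)) , (λ ¬sa → ¬sa (inj₂ f)) ]′ h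
    no-tri (inj₂ (inj₂ e)) x∈ (inj₂ (inj₁ refl)) f = ∉-swap-out S b c (R≢c Rb) x∈
    no-tri (inj₂ (inj₂ refl)) x∈ (inj₂ (inj₂ refl)) f = parent-≢ forest f refl
    core′ : ∀ {v} → v ∈ swap S b c → v ≢ c → ∃ λ r → R r × Anc par v r
    core′ v∈ v≢c = let (r , Rr , _ , vr) = Exceptional.core X (proj₂ (∈-swap⁻-old S b c v≢c v∈)) in r , Rr , vr
    spread : ∀ {r} → R r → r ∈ swap S b c → (∃ λ u → u ∈ swap S b c × u ≢ c × ¬ Anc par u r) ⊎ (∃ λ p → par r ≡ just p × p ∈ swap S b c)
    spread is-a _ = let (p , e , qp , p≢c) = leg-parent Ra a≢q in
      inj₂ (p , e , old (λ p≡b → end-off Rb Ra (≢-sym a≢b) b≢q (subst (λ z → Anc par z a) p≡b (up e self))) (leg-in X Ra a∈ (up e self) p≢c))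
    spread is-b b∈' = ⊥-elim (∉-swap-out S b c (R≢c Rb) b∈')
    spread is-g _ = inj₁ (a , old a≢b a∈ , R≢c Ra , end-off Ra Rg a≢g a≢q)

  -- In the value, `c` is adjacent to `l` alone, and the parent of `l` is missing because that leg
  -- is long; so `c` and `l` are cut off. Since `j` may be `q`, the witness against `cut-top` is the
  -- first vertex on the long leg of `i`, not `q` itself.
  exchange-ends : ∀ {S i j l} → Exceptional S → c ∉ S → 3 ≤ ∣ S ∣ → R i → R j → R l → i ≢ j → i ≢ l → j ≢ l →
    (∀ {r} → R r → r ≡ i ⊎ r ≡ j ⊎ r ≡ l) → ¬ Short i → ¬ Short l → i ∈ S → j ∈ S → l ∉ S →
    Compensates S (swap² S i c j l)
  exchange-ends {S} {i} {j} {l} X c∉ big Ri Rj Rl i≢j i≢l j≢l cover ¬si ¬sl i∈ j∈ l∉ = record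
    { size = ∣swap²∣ S i c j l i∈ c∉ j∈ (≢-sym i≢j) l∉ (R≢c Rl)
    ; centre = c∈Y
    ; bad = λ w → disconnected (copwin⇒connected G w)
    ; free = not-image not-top (swap²-core X Rl) (spread⇒NotLeg spread) }
    where
    Y : Subset n
    Y = swap² S i c j l
    c∈Y : c ∈ Y
    c∈Y = ∈-swap²-first S i c j l (≢-sym (R≢c Rj))
    split : ∀ {u} → u ∈ Y → (u ≡ c ⊎ u ≡ l) ⊎ (u ≢ i × u ≢ j × u ∈ S)
    split = ∈-swap²⁻ S i c j l
    old : ∀ {u} → u ≢ i → u ≢ j → u ∈ S → u ∈ Y
    old = ∈-swap²-old S i c j l
    first : ∃ λ x → par x ≡ just q × Anc par x i
    first = Anc-child (R-below Ri) (λ e → ¬si (inj₁ (sym e)))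
    x = proj₁ first
    x-q = proj₁ (proj₂ first)
    xi = proj₂ (proj₂ first)
    x≢q : x ≢ q
    x≢q = parent-≢ forest x-q
    x≢c : x ≢ c
    x≢c e = just≢nothing x-q (subst (λ z → par z ≡ nothing) (sym e) c-root)
    x∈Y : x ∈ Y
    x∈Y = old (λ e → ¬si (inj₂ (subst (λ z → par z ≡ just q) e x-q)))
              (λ e → x≢q (trans e (legs Rj Ri (≢-sym i≢j) self (subst (λ z → Anc par z i) e xi) (R≢c Rj))))
              (leg-in X Ri i∈ xi x≢c)
    below-l : ∀ {u} → par l ≡ just u → u ∈ S → ⊥
    below-l {u} e u∈ with Exceptional.core X u∈
    ... | r , Rr , r∈ , ur with legs Rl Rr (λ { refl → l∉ r∈ }) (up e self) ur (c-unlike c∉ u∈)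
    ...   | refl = ¬sl (inj₂ e)
    disconnected : ¬ ConnectedIn G Y
    disconnected with member-outside S (i ∷ j ∷ []) big
    ... | v , v∈ , v∉ = closed⇒¬connected G (λ v → v ∈ S × v ≢ i × v ≢ j) (old v≢i v≢j v∈) c∈Y (v∈ , v≢i , v≢j) (λ { (p , _) → c∉ p }) step
      where
      v≢i : v ≢ i
      v≢i e = v∉ (hereˡ e)
      v≢j : v ≢ j
      v≢j e = v∉ (thereˡ (hereˡ e))
      step : ∀ {u v} → u ∈ Y → v ∈ Y → Adj G u v → u ∈ S × u ≢ i × u ≢ j → v ∈ S × v ≢ i × v ≢ j
      step u∈ v∈ uv (u∈S , u≢i , u≢j) with split v∈
      ... | inj₂ (v≢i , v≢j , v∈S) = v∈S , v≢i , v≢j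
      ... | inj₁ (inj₁ refl) with centre-edge (Adj-sym G uv)
      ...   | inj₁ Ru = ⊥-elim ([ u≢i , [ u≢j , (λ { refl → l∉ u∈S }) ]′ ]′ (cover Ru))
      ...   | inj₂ (e , u≢q) = let (r , Rr , _ , ur) = Exceptional.core X u∈S in ⊥-elim (u≢q (core-child⇒q Rr ur e))
      step u∈ v∈ uv (u∈S , u≢i , u≢j) | inj₁ (inj₂ refl) with tree-edge (c-unlike c∉ u∈S) (R≢c Rl) uv
      ... | inj₂ e = ⊥-elim (below-l e u∈S)
      ... | inj₁ e with Exceptional.core X u∈S
      ...   | r , Rr , r∈ , ur with legs Rl Rr (λ { refl → l∉ r∈ }) self (Anc-trans (up e self) ur) (R≢c Rl)
      ...     | l≡q = ⊥-elim (¬sl (inj₁ l≡q))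
    spread : ∀ {r} → R r → r ∈ Y → (∃ λ u → u ∈ Y × u ≢ c × ¬ Anc par u r) ⊎ (∃ λ p → par r ≡ just p × p ∈ Y)
    spread Rr r∈ with cover Rr | split r∈
    ... | _ | inj₁ (inj₁ e) = ⊥-elim (R≢c Rr e)
    ... | inj₁ e | inj₂ (ne , _) = ⊥-elim (ne e)
    ... | inj₂ (inj₁ e) | inj₂ (_ , ne , _) = ⊥-elim (ne e)
    ... | inj₂ (inj₂ refl) | inj₂ (_ , _ , l∈) = ⊥-elim (l∉ l∈)
    ... | _ | inj₁ (inj₂ refl) = inj₁ (x , x∈Y , x≢c , disjoint-leg Ri Rl i≢l xi x≢c x≢q)
    not-top : NotTop Y
    not-top {S'} {t} c∉' T y with back (∈-swap²-second S i c j l) (R≢c Rl)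
      where open Preimage c∉' (Subtree.top∈ T) y
    ... | l≢t , l∈' with Subtree.closed T l∈' l≢t
    ...   | p , e , p∈' with p ≟ t
    ...     | yes refl = ¬sl (inj₂ (subst (λ z → par l ≡ just z) (sym (q-top T (Subtree.parent-in T (proj₂ (back x∈Y x≢c)) (proj₁ (back x∈Y x≢c)) x-q))) e))
      where open Preimage c∉' (Subtree.top∈ T) y
    ...     | no p≢t with split (Preimage.forth c∉' (Subtree.top∈ T) y p∈' p≢t)
    ...       | inj₁ (inj₁ refl) = c∉' p∈'
    ...       | inj₁ (inj₂ refl) = parent-≢ forest e refl
    ...       | inj₂ (_ , _ , p∈S) = below-l e p∈S

  -- As `g` is a child of `q`, adding `g` closes a cycle with the leg of `b`; the two lowest
  -- vertices of the long leg of `a` make room. No end is `q`, so there is no triangle.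
  reroute : ∀ {S p} → Exceptional S → c ∉ S → a ∈ S → b ∈ S → g ∉ S → g ≢ q → Short g → ¬ Short a → par a ≡ just p →
            Compensates S (swap² S a c p g)
  reroute {S} {p} X c∉ a∈ b∈ g∉ g≢q sg ¬sa a-p = record
    { size = ∣swap²∣ S a c p g a∈ c∉ (leg-in X Ra a∈ pa p≢c) (≢-sym (parent-≢ forest a-p)) g∉ (R≢c Rg)
    ; centre = c∈Y
    ; bad = cycle⇒¬copwin Rb Rg b≢g b≢q c∈Y on no-tri
    ; free = not-image (q∈⇒NotTop q∈Y) (swap²-core X Rg) (spread⇒NotLeg spread) }
    where
    Y : Subset n
    Y = swap² S a c p g
    pa : Anc par p a
    pa = up a-p self
    p≢q : p ≢ q
    p≢q e = ¬sa (inj₂ (subst (λ z → par a ≡ just z) e a-p))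
    p≢c : p ≢ c
    p≢c refl = q≢c (Anc-root c-root (Anc-parent a-p q-a (≢-sym a≢q)))
    c∈Y : c ∈ Y
    c∈Y = ∈-swap²-first S a c p g (≢-sym p≢c)
    old : ∀ {u} → u ≢ a → u ≢ p → u ∈ S → u ∈ Y
    old = ∈-swap²-old S a c p g
    q∈Y : q ∈ Y
    q∈Y = old (≢-sym a≢q) (≢-sym p≢q) (exceptional-q X)
    on : ∀ {v} → v ≢ c → Anc par v b ⊎ Anc par v g → v ∈ Y
    on v≢c (inj₁ vb) = old (λ { refl → end-off Ra Rb a≢b a≢q vb }) (λ { refl → disjoint-leg Ra Rb a≢b pa v≢c p≢q vb }) (leg-in X Rb b∈ vb v≢c)
    on v≢c (inj₂ vg) with short-core sg vg v≢c
    ... | inj₁ refl = ∈-swap²-second S a c p g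
    ... | inj₂ refl = q∈Y
    no-tri : R q → ∀ {x} → x ∈ Y → R x → par x ≡ just q → ⊥
    no-tri (inj₁ e) = ⊥-elim (a≢q (sym e))
    no-tri (inj₂ (inj₁ e)) = ⊥-elim (b≢q (sym e))
    no-tri (inj₂ (inj₂ e)) = ⊥-elim (g≢q (sym e))
    spread : ∀ {r} → R r → r ∈ Y → (∃ λ u → u ∈ Y × u ≢ c × ¬ Anc par u r) ⊎ (∃ λ p → par r ≡ just p × p ∈ Y)
    spread is-a a∈' = ⊥-elim (∉-swap² S a c p g (R≢c Ra) a≢g (inj₁ refl) a∈')
    spread is-b _ = inj₁ (g , ∈-swap²-second S a c p g , R≢c Rg , end-off Rg Rb (≢-sym b≢g) g≢q)
    spread is-g _ = inj₁ (b , old (≢-sym a≢b) (λ { refl → end-off Rb Ra (≢-sym a≢b) b≢q pa }) b∈ , R≢c Rb , end-off Rb Rg b≢g b≢q)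

  -- On a leg with at least three inner vertices, removing `a` and `s` leaves `p` between them
  -- without a neighbour.
  isolate : ∀ {S p s} → Exceptional S → c ∉ S → a ∈ S → b ∉ S → g ∈ S → Short b → ¬ Short a →
            par a ≡ just p → par p ≡ just s → s ≢ q → Compensates S (swap² S a c s b)
  isolate {S} {p} {s} X c∉ a∈ b∉ g∈ sb ¬sa a-p p-s s≢q = record
    { size = ∣swap²∣ S a c s b a∈ c∉ (leg-in X Ra a∈ sa s≢c) (λ { refl → no-loop forest p-s (up a-p self) }) b∉ (R≢c Rb)
    ; centre = c∈Y
    ; bad = λ w → disconnected (copwin⇒connected G w)
    ; free = not-image (q∈⇒NotTop (old (≢-sym a≢q) (≢-sym s≢q) (exceptional-q X))) (swap²-core X Rb) (spread⇒NotLeg spread) }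
    where
    Y : Subset n
    Y = swap² S a c s b
    pa : Anc par p a
    pa = up a-p self
    sa : Anc par s a
    sa = up a-p (up p-s self)
    p≢q : p ≢ q
    p≢q e = ¬sa (inj₂ (subst (λ z → par a ≡ just z) e a-p))
    q-p : Anc par q p
    q-p = Anc-parent a-p q-a (≢-sym a≢q)
    p≢c : p ≢ c
    p≢c refl = q≢c (Anc-root c-root q-p)
    s≢c : s ≢ c
    s≢c refl = q≢c (Anc-root c-root (Anc-parent p-s q-p (≢-sym p≢q)))
    c∈Y : c ∈ Y
    c∈Y = ∈-swap²-first S a c s b (≢-sym s≢c)
    old : ∀ {u} → u ≢ a → u ≢ s → u ∈ S → u ∈ Y
    old = ∈-swap²-old S a c s b
    p∈Y : p ∈ Y
    p∈Y = old (≢-sym (parent-≢ forest a-p)) (parent-≢ forest p-s) (leg-in X Ra a∈ pa p≢c)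
    off : ∀ {r} → R r → a ≢ r → ¬ Anc par p r
    off Rr a≢r = disjoint-leg Ra Rr a≢r pa p≢c p≢q
    disconnected : ¬ ConnectedIn G Y
    disconnected = closed⇒¬connected G (λ v → v ≡ p) p∈Y c∈Y refl (≢-sym p≢c) step
      where
      step : ∀ {u v} → u ∈ Y → v ∈ Y → Adj G u v → u ≡ p → v ≡ p
      step {v = v} u∈ v∈ pv refl with ∈-swap²⁻ S a c s b v∈
      ... | inj₁ (inj₁ refl) with centre-edge (Adj-sym G pv)
      ...   | inj₁ Rp = ⊥-elim (off Rp (parent-≢ forest a-p) self)
      ...   | inj₂ (e , _) = ⊥-elim (p≢q (core-child⇒q Ra pa e))
      step u∈ v∈ pv refl | inj₁ (inj₂ refl) with tree-edge p≢c (R≢c Rb) pv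
      ... | inj₁ e = ⊥-elim (end-off Rb Ra (≢-sym a≢b) b≢q (up a-p (up e self)))
      ... | inj₂ e = ⊥-elim ([ b≢q , (λ f → p≢q (same-just e f)) ]′ sb)
      step {v = v} u∈ v∈ pv refl | inj₂ (v≢a , v≢s , v∈S) with tree-edge p≢c (c-unlike c∉ v∈S) pv
      ... | inj₁ e = ⊥-elim (v≢s (same-just e p-s))
      ... | inj₂ e with Exceptional.core X v∈S
      ...   | r , Rr , _ , vr with a ≟ r
      ...     | yes refl = ⊥-elim (no-loop forest e (Anc-parent a-p vr v≢a))
      ...     | no a≢r = ⊥-elim (off Rr a≢r (Anc-trans (up e self) vr))
    spread : ∀ {r} → R r → r ∈ Y → (∃ λ u → u ∈ Y × u ≢ c × ¬ Anc par u r) ⊎ (∃ λ p → par r ≡ just p × p ∈ Y)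
    spread is-a a∈' = ⊥-elim (∉-swap² S a c s b (R≢c Ra) a≢b (inj₁ refl) a∈')
    spread is-b _ = inj₁ (p , p∈Y , p≢c , off Rb a≢b)
    spread is-g _ = inj₁ (p , p∈Y , p≢c , off Rg a≢g)

  -- The remaining replacements use a vertex h off the three legs.
  module OffLegs {h m : Fin n} (h≢c : h ≢ c) (off : OffCore h) (h-m : par h ≡ just m) where

    ¬Rh : ¬ R h
    ¬Rh Rh = off h Rh self

    h≢q : h ≢ q
    h≢q refl = off a Ra q-a

    h∉ : ∀ {S} → Exceptional S → h ∉ S
    h∉ X h∈ = let (r , Rr , _ , a) = Exceptional.core X h∈ in off r Rr a

    not-parent : ∀ {r v} → R r → Anc par v r → par v ≡ just h → ⊥
    not-parent Rr vr e = off _ Rr (Anc-trans (up e self) vr)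

    NotLeg-h : ∀ {Y} → h ∈ Y → NotLeg Y
    NotLeg-h h∈ c∉ Rr _ chain _ a∈ y = off _ Rr (chain (proj₂ (Preimage.back c∉ a∈ y h∈ h≢c)))

    -- `h` is the only member without an end below it, so `cut-core` can only have removed its
    -- parent.
    only-h-off : ∀ {Y S' a' b'} → (∀ {v} → v ∈ Y → v ≢ h → v ≢ c → ∃ λ r → R r × Anc par v r) →
      c ∉ S' → a' ∈ S' → Y ≡ swap S' a' c → b' ∈ S' → par b' ≡ just a' → OffCore b' → a' ≡ m
    only-h-off {b' = b'} core c∉ a∈ y b∈ e offb with b' ≟ h
    ... | yes refl = same-just e h-m
    ... | no b'≢h = let (r , Rr , vr) = core (Preimage.forth c∉ a∈ y b∈ (parent-≢ forest e)) b'≢h (λ { refl → c∉ b∈ }) in ⊥-elim (offb r Rr vr)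

    -- Legs with 2, 1 and 1 inner vertices.
    module _ {S : Subset n} {p} (X : Exceptional S) (c∉ : c ∉ S) (a∈ : a ∈ S) (b∉ : b ∉ S) (g∈ : g ∈ S)
             (g≢q : g ≢ q) (a-p : par a ≡ just p) (p-q : par p ≡ just q) (g-q : par g ≡ just q) where

      private
        pa : Anc par p a
        pa = up a-p self
        p≢q : p ≢ q
        p≢q = parent-≢ forest p-q
        p≢c : p ≢ c
        p≢c refl = just≢nothing p-q c-root
        p≢a : p ≢ a
        p≢a = ≢-sym (parent-≢ forest a-p)
        p≢h : p ≢ h
        p≢h refl = off a Ra pa
        p≢g : p ≢ g
        p≢g refl = end-off Rg Ra (≢-sym a≢g) g≢q pa
        p∈ : p ∈ S
        p∈ = leg-in X Ra a∈ pa p≢c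

        members : ∀ {v} → v ∈ S → v ≡ a ⊎ v ≡ p ⊎ v ≡ q ⊎ v ≡ g
        members {v} v∈ with Exceptional.core X v∈
        ... | _ , is-b , b∈ , _ = ⊥-elim (b∉ b∈)
        ... | _ , is-g , _ , vg with short-core (inj₂ g-q) vg (c-unlike c∉ v∈)
        ...   | inj₁ e = inj₂ (inj₂ (inj₂ e))
        ...   | inj₂ e = inj₂ (inj₂ (inj₁ e))
        members {v} v∈ | _ , is-a , _ , va with v ≟ a
        ... | yes e = inj₁ e
        ... | no v≢a with v ≟ p
        ...   | yes e = inj₂ (inj₁ e)
        ...   | no v≢p = inj₂ (inj₂ (inj₁ (above-root-child c-root q-child (Anc-parent p-q (Anc-parent a-p va v≢a) v≢p) (c-unlike c∉ v∈))))

      -- `S` is `{a, p, q, g}` and the value `{a, h, q, c}`, where `q` is cut off from `c`. A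
      -- preimage under `cut-core` would contain the parent `p` of `a` and lose only `m`, so `p`
      -- would still be there.
      detach-q : m ≢ p → Compensates S (swap² S p h g c)
      detach-q m≢p = record
        { size = ∣swap²∣ S p h g c p∈ (h∉ X) g∈ (≢-sym p≢g) c∉ (≢-sym h≢c)
        ; centre = c∈Y
        ; bad = λ w → closed⇒¬connected G (λ v → v ≡ q ⊎ (v ≡ h × m ≡ q)) q∈Y c∈Y (inj₁ refl)
                        (λ { (inj₁ e) → q≢c (sym e) ; (inj₂ (e , _)) → h≢c (sym e) }) step (copwin⇒connected G w)
        ; free = not-image (q∈⇒NotTop q∈Y) not-core (NotLeg-h h∈Y) }
        where
        Y : Subset n
        Y = swap² S p h g c
        c∈Y : c ∈ Y
        c∈Y = ∈-swap²-second S p h g c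
        h∈Y : h ∈ Y
        h∈Y = ∈-swap²-first S p h g c (λ { refl → ¬Rh Rg })
        old : ∀ {u} → u ≢ p → u ≢ g → u ∈ S → u ∈ Y
        old = ∈-swap²-old S p h g c
        q∈Y : q ∈ Y
        q∈Y = old (≢-sym p≢q) (≢-sym g≢q) (exceptional-q X)
        a∈Y : a ∈ Y
        a∈Y = old (≢-sym p≢a) a≢g a∈
        split : ∀ {v} → v ∈ Y → v ≡ h ⊎ v ≡ c ⊎ v ≡ a ⊎ v ≡ q
        split v∈ with ∈-swap²⁻ S p h g c v∈
        ... | inj₁ (inj₁ e) = inj₁ e
        ... | inj₁ (inj₂ e) = inj₂ (inj₁ e)
        ... | inj₂ (v≢p , v≢g , v∈S) with members v∈S
        ...   | inj₁ e = inj₂ (inj₂ (inj₁ e))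
        ...   | inj₂ (inj₁ e) = ⊥-elim (v≢p e)
        ...   | inj₂ (inj₂ (inj₁ e)) = inj₂ (inj₂ (inj₂ e))
        ...   | inj₂ (inj₂ (inj₂ e)) = ⊥-elim (v≢g e)
        step : ∀ {u v} → u ∈ Y → v ∈ Y → Adj G u v → u ≡ q ⊎ (u ≡ h × m ≡ q) → v ≡ q ⊎ (v ≡ h × m ≡ q)
        step {v = v} _ v∈ uv u with split v∈
        ... | inj₂ (inj₂ (inj₂ e)) = inj₁ e
        step _ _ uv (inj₂ (refl , e)) | inj₁ refl = inj₂ (refl , e)
        step _ _ uv (inj₁ refl) | inj₁ refl with tree-edge q≢c h≢c uv
        ... | inj₁ e = ⊥-elim (h≢c (same-just e q-child))
        ... | inj₂ e = inj₂ (refl , same-just h-m e)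
        step _ _ uv (inj₁ refl) | inj₂ (inj₁ refl) with centre-edge (Adj-sym G uv)
        ... | inj₁ (inj₁ e) = ⊥-elim (a≢q (sym e))
        ... | inj₁ (inj₂ (inj₁ e)) = ⊥-elim (b≢q (sym e))
        ... | inj₁ (inj₂ (inj₂ e)) = ⊥-elim (g≢q (sym e))
        ... | inj₂ (_ , ne) = ⊥-elim (ne refl)
        step _ _ uv (inj₂ (refl , e)) | inj₂ (inj₁ refl) with centre-edge (Adj-sym G uv)
        ... | inj₁ Rh = ⊥-elim (¬Rh Rh)
        ... | inj₂ (f , _) = ⊥-elim (q≢c (trans (sym e) (same-just h-m f)))
        step _ _ uv (inj₁ refl) | inj₂ (inj₂ (inj₁ refl)) with tree-edge q≢c (R≢c Ra) uv
        ... | inj₁ e = ⊥-elim (R≢c Ra (same-just e q-child))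
        ... | inj₂ e = ⊥-elim (p≢q (same-just a-p e))
        step _ _ uv (inj₂ (refl , e)) | inj₂ (inj₂ (inj₁ refl)) with tree-edge h≢c (R≢c Ra) uv
        ... | inj₁ f = ⊥-elim (a≢q (trans (same-just f h-m) e))
        ... | inj₂ f = ⊥-elim (p≢h (same-just a-p f))
        core′ : ∀ {v} → v ∈ Y → v ≢ h → v ≢ c → ∃ λ r → R r × Anc par v r
        core′ v∈ v≢h v≢c with split v∈
        ... | inj₁ e = ⊥-elim (v≢h e)
        ... | inj₂ (inj₁ e) = ⊥-elim (v≢c e)
        ... | inj₂ (inj₂ (inj₁ refl)) = a , Ra , self
        ... | inj₂ (inj₂ (inj₂ refl)) = a , Ra , q-a
        not-core : NotCore Y
        not-core {S'} {t} c∉' T _ b∈' e a∈' a≢t offb y with only-h-off core′ c∉' a∈' y b∈' e offb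
        ... | refl with back a∈Y (R≢c Ra) | q-top T (proj₂ (back q∈Y q≢c))
          where open Preimage c∉' a∈' y
        ...   | _ , a∈S' | refl with split (Preimage.forth c∉' a∈' y (Subtree.parent-in T a∈S' a≢q a-p) (≢-sym m≢p))
        ...     | inj₁ e′ = p≢h e′
        ...     | inj₂ (inj₁ e′) = p≢c e′
        ...     | inj₂ (inj₂ (inj₁ e′)) = p≢a e′
        ...     | inj₂ (inj₂ (inj₂ e′)) = p≢q e′

      -- Now the value of `detach-q` is taken: `cut-core` sends `{q, p, a, h}` to it. In
      -- `{c, q, g, h}` the vertex `h` is isolated instead, and the candidate `{q, p, g, h}` has no
      -- end below `p`, against the first premise of `cut-core`.
      detach-h : m ≡ p → Compensates S (swap² S a c p h)
      detach-h refl = record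
        { size = ∣swap²∣ S a c p h a∈ c∉ p∈ p≢a (h∉ X) h≢c
        ; centre = c∈Y
        ; bad = λ w → closed⇒¬connected G (λ v → v ≡ h) h∈Y c∈Y refl (≢-sym h≢c) step (copwin⇒connected G w)
        ; free = not-image (q∈⇒NotTop q∈Y) not-core (NotLeg-h h∈Y) }
        where
        Y : Subset n
        Y = swap² S a c p h
        c∈Y : c ∈ Y
        c∈Y = ∈-swap²-first S a c p h (≢-sym p≢c)
        h∈Y : h ∈ Y
        h∈Y = ∈-swap²-second S a c p h
        q∈Y : q ∈ Y
        q∈Y = ∈-swap²-old S a c p h (≢-sym a≢q) (≢-sym p≢q) (exceptional-q X)
        split : ∀ {v} → v ∈ Y → v ≡ h ⊎ v ≡ c ⊎ v ≡ g ⊎ v ≡ q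
        split v∈ with ∈-swap²⁻ S a c p h v∈
        ... | inj₁ (inj₁ e) = inj₂ (inj₁ e)
        ... | inj₁ (inj₂ e) = inj₁ e
        ... | inj₂ (v≢a , v≢p , v∈S) with members v∈S
        ...   | inj₁ e = ⊥-elim (v≢a e)
        ...   | inj₂ (inj₁ e) = ⊥-elim (v≢p e)
        ...   | inj₂ (inj₂ (inj₁ e)) = inj₂ (inj₂ (inj₂ e))
        ...   | inj₂ (inj₂ (inj₂ e)) = inj₂ (inj₂ (inj₁ e))
        step : ∀ {u v} → u ∈ Y → v ∈ Y → Adj G u v → u ≡ h → v ≡ h
        step _ v∈ hv refl with split v∈
        ... | inj₁ e = e
        ... | inj₂ (inj₁ refl) with centre-edge (Adj-sym G hv)
        ...   | inj₁ Rh = ⊥-elim (¬Rh Rh)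
        ...   | inj₂ (f , _) = ⊥-elim (p≢c (same-just h-m f))
        step _ v∈ hv refl | inj₂ (inj₂ (inj₁ refl)) with tree-edge h≢c (R≢c Rg) hv
        ... | inj₁ f = ⊥-elim (p≢g (same-just h-m f))
        ... | inj₂ f = ⊥-elim (not-parent Rg self f)
        step _ v∈ hv refl | inj₂ (inj₂ (inj₂ refl)) with tree-edge h≢c q≢c hv
        ... | inj₁ f = ⊥-elim (p≢q (same-just h-m f))
        ... | inj₂ f = ⊥-elim (not-parent Ra q-a f)
        core′ : ∀ {v} → v ∈ Y → v ≢ h → v ≢ c → ∃ λ r → R r × Anc par v r
        core′ v∈ v≢h v≢c with split v∈
        ... | inj₁ e = ⊥-elim (v≢h e)
        ... | inj₂ (inj₁ e) = ⊥-elim (v≢c e)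
        ... | inj₂ (inj₂ (inj₁ refl)) = g , Rg , self
        ... | inj₂ (inj₂ (inj₂ refl)) = a , Ra , q-a
        not-core : NotCore Y
        not-core {S'} {t} c∉' T children b∈' e a∈' a≢t offb y with only-h-off core′ c∉' a∈' y b∈' e offb
        ... | refl with q-top T (proj₂ (back q∈Y q≢c))
          where open Preimage c∉' a∈' y
        ...   | refl with children a∈' p-q
        ...     | r , Rr , r∈' , pr with a ≟ r
        ...       | no a≢r = disjoint-leg Ra Rr a≢r pa p≢c p≢q pr
        ...       | yes refl with split (Preimage.forth c∉' a∈' y r∈' (≢-sym p≢a))
        ...         | inj₁ refl = ¬Rh Ra
        ...         | inj₂ (inj₁ e′) = R≢c Ra e′
        ...         | inj₂ (inj₂ (inj₁ e′)) = a≢g e′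
        ...         | inj₂ (inj₂ (inj₂ e′)) = a≢q e′

    -- All three legs with one inner vertex.
    module _ {S : Subset n} {i j} (X : Exceptional S) (c∉ : c ∉ S) (Ri : R i) (Rj : R j) (i≢j : i ≢ j)
             (i∈ : i ∈ S) (j∈ : j ∈ S) (only : ∀ {r} → R r → r ∈ S → r ≡ i ⊎ r ≡ j)
             (leg : ∀ {r} → R r → par r ≡ just q) where

      private
        ≢q : ∀ {r} → R r → r ≢ q
        ≢q Rr = parent-≢ forest (leg Rr)

        members : ∀ {v} → v ∈ S → v ≡ i ⊎ v ≡ j ⊎ v ≡ q
        members v∈ with Exceptional.core X v∈
        ... | r , Rr , r∈ , vr with short-core (inj₂ (leg Rr)) vr (c-unlike c∉ v∈)
        ...   | inj₂ e = inj₂ (inj₂ e)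
        ...   | inj₁ refl with only Rr r∈
        ...     | inj₁ e = inj₁ e
        ...     | inj₂ e = inj₂ (inj₁ e)

      -- The value is `{c, q, h}`, and `c` and `q` are not adjacent. If `m` were an end, `cut-core`
      -- would send `{q, m, h}` to the same set.
      spare-ends : ¬ R m → Compensates S (swap² S i c j h)
      spare-ends ¬Rm = record
        { size = ∣swap²∣ S i c j h i∈ c∉ j∈ (≢-sym i≢j) (h∉ X) h≢c
        ; centre = c∈Y
        ; bad = λ w → closed⇒¬connected G (λ v → v ≡ q ⊎ (v ≡ h × m ≡ q)) q∈Y c∈Y (inj₁ refl)
                        (λ { (inj₁ e) → q≢c (sym e) ; (inj₂ (e , _)) → h≢c (sym e) }) step (copwin⇒connected G w)
        ; free = not-image (q∈⇒NotTop q∈Y) not-core (NotLeg-h h∈Y) }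
        where
        Y : Subset n
        Y = swap² S i c j h
        c∈Y : c ∈ Y
        c∈Y = ∈-swap²-first S i c j h (≢-sym (R≢c Rj))
        h∈Y : h ∈ Y
        h∈Y = ∈-swap²-second S i c j h
        q∈Y : q ∈ Y
        q∈Y = ∈-swap²-old S i c j h (≢-sym (≢q Ri)) (≢-sym (≢q Rj)) (exceptional-q X)
        split : ∀ {v} → v ∈ Y → v ≡ h ⊎ v ≡ c ⊎ v ≡ q
        split v∈ with ∈-swap²⁻ S i c j h v∈
        ... | inj₁ (inj₁ e) = inj₂ (inj₁ e)
        ... | inj₁ (inj₂ e) = inj₁ e
        ... | inj₂ (v≢i , v≢j , v∈S) with members v∈S
        ...   | inj₁ e = ⊥-elim (v≢i e)
        ...   | inj₂ (inj₁ e) = ⊥-elim (v≢j e)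
        ...   | inj₂ (inj₂ e) = inj₂ (inj₂ e)
        step : ∀ {u v} → u ∈ Y → v ∈ Y → Adj G u v → u ≡ q ⊎ (u ≡ h × m ≡ q) → v ≡ q ⊎ (v ≡ h × m ≡ q)
        step _ v∈ uv u with split v∈
        ... | inj₂ (inj₂ e) = inj₁ e
        step _ _ uv (inj₂ (refl , e)) | inj₁ refl = inj₂ (refl , e)
        step _ _ uv (inj₁ refl) | inj₁ refl with tree-edge q≢c h≢c uv
        ... | inj₁ e = ⊥-elim (h≢c (same-just e q-child))
        ... | inj₂ e = inj₂ (refl , same-just h-m e)
        step _ _ uv (inj₁ refl) | inj₂ (inj₁ refl) with centre-edge (Adj-sym G uv)
        ... | inj₁ Rq = ⊥-elim (≢q Rq refl)
        ... | inj₂ (_ , ne) = ⊥-elim (ne refl)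
        step _ _ uv (inj₂ (refl , e)) | inj₂ (inj₁ refl) with centre-edge (Adj-sym G uv)
        ... | inj₁ Rh = ⊥-elim (¬Rh Rh)
        ... | inj₂ (f , _) = ⊥-elim (q≢c (trans (sym e) (same-just h-m f)))
        core′ : ∀ {v} → v ∈ Y → v ≢ h → v ≢ c → ∃ λ r → R r × Anc par v r
        core′ v∈ v≢h v≢c with split v∈
        ... | inj₁ e = ⊥-elim (v≢h e)
        ... | inj₂ (inj₁ e) = ⊥-elim (v≢c e)
        ... | inj₂ (inj₂ refl) = a , Ra , q-a
        not-core : NotCore Y
        not-core {S'} {t} c∉' T children b∈' e a∈' a≢t offb y with only-h-off core′ c∉' a∈' y b∈' e offb
        ... | refl with q-top T (proj₂ (back q∈Y q≢c)) | Subtree.closed T a∈' a≢t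
          where open Preimage c∉' a∈' y
        ...   | refl | s , m-s , s∈' with split (Preimage.forth c∉' a∈' y s∈' (≢-sym (parent-≢ forest m-s)))
        ...     | inj₁ refl = no-loop forest h-m (up m-s self)
        ...     | inj₂ (inj₁ refl) = c∉' s∈'
        ...     | inj₂ (inj₂ refl) with children a∈' m-s
        ...       | r , Rr , r∈' , mr with r ≟ m
        ...         | yes refl = ¬Rm Rr
        ...         | no r≢m with split (Preimage.forth c∉' a∈' y r∈' r≢m)
        ...           | inj₁ refl = ¬Rh Rr
        ...           | inj₂ (inj₁ e′) = R≢c Rr e′
        ...           | inj₂ (inj₂ e′) = ≢q Rr e′

      -- The value for an end `m` is `{c, i, h}`: its vertex `h` is isolated because `m` is absent.
      -- A preimage under `cut-top` would contain both `q` and `m` although each is missing from the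
      -- value and only one vertex was removed.
      spare-middle : R m → i ≢ m → Compensates S (swap² S j c q h)
      spare-middle Rm i≢m = record
        { size = ∣swap²∣ S j c q h j∈ c∉ (exceptional-q X) (≢-sym (≢q Rj)) (h∉ X) h≢c
        ; centre = c∈Y
        ; bad = λ w → closed⇒¬connected G (λ v → v ≡ h) h∈Y c∈Y refl (≢-sym h≢c) step (copwin⇒connected G w)
        ; free = not-image not-top not-core (NotLeg-h h∈Y) }
        where
        Y : Subset n
        Y = swap² S j c q h
        c∈Y : c ∈ Y
        c∈Y = ∈-swap²-first S j c q h (≢-sym q≢c)
        h∈Y : h ∈ Y
        h∈Y = ∈-swap²-second S j c q h
        i∈Y : i ∈ Y
        i∈Y = ∈-swap²-old S j c q h i≢j (≢q Ri) i∈
        m≢h : m ≢ h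
        m≢h = ≢-sym (parent-≢ forest h-m)
        split : ∀ {v} → v ∈ Y → v ≡ h ⊎ v ≡ c ⊎ v ≡ i
        split v∈ with ∈-swap²⁻ S j c q h v∈
        ... | inj₁ (inj₁ e) = inj₂ (inj₁ e)
        ... | inj₁ (inj₂ e) = inj₁ e
        ... | inj₂ (v≢j , v≢q , v∈S) with members v∈S
        ...   | inj₁ e = inj₂ (inj₂ e)
        ...   | inj₂ (inj₁ e) = ⊥-elim (v≢j e)
        ...   | inj₂ (inj₂ e) = ⊥-elim (v≢q e)
        q∉Y : q ∉ Y
        q∉Y q∈ with split q∈
        ... | inj₁ e = h≢q (sym e)
        ... | inj₂ (inj₁ e) = q≢c e
        ... | inj₂ (inj₂ e) = ≢q Ri (sym e)
        m∉Y : m ∉ Y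
        m∉Y m∈ with split m∈
        ... | inj₁ e = m≢h e
        ... | inj₂ (inj₁ e) = R≢c Rm e
        ... | inj₂ (inj₂ e) = i≢m (sym e)
        step : ∀ {u v} → u ∈ Y → v ∈ Y → Adj G u v → u ≡ h → v ≡ h
        step _ v∈ hv refl with split v∈
        ... | inj₁ e = e
        ... | inj₂ (inj₁ refl) with centre-edge (Adj-sym G hv)
        ...   | inj₁ Rh = ⊥-elim (¬Rh Rh)
        ...   | inj₂ (f , _) = ⊥-elim (R≢c Rm (same-just h-m f))
        step _ v∈ hv refl | inj₂ (inj₂ refl) with tree-edge h≢c (R≢c Ri) hv
        ... | inj₁ f = ⊥-elim (i≢m (same-just f h-m))
        ... | inj₂ f = ⊥-elim (not-parent Ri self f)
        core′ : ∀ {v} → v ∈ Y → v ≢ h → v ≢ c → ∃ λ r → R r × Anc par v r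
        core′ v∈ v≢h v≢c with split v∈
        ... | inj₁ e = ⊥-elim (v≢h e)
        ... | inj₂ (inj₁ e) = ⊥-elim (v≢c e)
        ... | inj₂ (inj₂ refl) = i , Ri , self
        not-top : NotTop Y
        not-top {S'} {t} c∉' T y = ≢q Rm (trans m≡t (sym q≡t))
          where
          open Preimage c∉' (Subtree.top∈ T) y
          q∈' : q ∈ S'
          q∈' = Subtree.parent-in T (proj₂ (back i∈Y (R≢c Ri))) (proj₁ (back i∈Y (R≢c Ri))) (leg Ri)
          q≡t : q ≡ t
          q≡t = q-top T q∈'
          m≡t : m ≡ t
          m≡t with m ≟ t
          ... | yes e = e
          ... | no m≢t = ⊥-elim (m∉Y (forth (Subtree.parent-in T (proj₂ (back h∈Y h≢c)) (proj₁ (back h∈Y h≢c)) h-m) m≢t))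
        not-core : NotCore Y
        not-core {S'} {t} c∉' T children b∈' e a∈' a≢t offb y with only-h-off core′ c∉' a∈' y b∈' e offb
        ... | refl = q∉Y (forth (Subtree.parent-in T a∈' a≢t (leg Rm)) (≢-sym (≢q Rm)))
          where open Preimage c∉' a∈' y

-- nothing stands for the cop-win set {1,2,3} of B_n that avoids the centre.
record CopWinInjection {n} (G : Graph n) : Set₁ where
  field
    centre     : Fin n
    Goes       : Subset n → Maybe (Subset n) → Set
    total      : ∀ {S} → InducedCopWin G S → 3 ≤ ∣ S ∣ → ∃ (Goes S)
    injective  : ∀ {S S' m} → 3 ≤ ∣ S ∣ → 3 ≤ ∣ S' ∣ → Goes S m → Goes S' m → S ≡ S'
    to-centred : ∀ {S Y} → Goes S (just Y) → centre ∈ Y × ∣ Y ∣ ≡ ∣ S ∣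
    to-spare   : ∀ {S} → Goes S nothing → ∣ S ∣ ≡ 3

cactus-injection : ∀ {n} {G : Graph n} → Cactus G → CopWinInjection G
cactus-injection {n} {G} cactus = record
  { centre = Cactus.d cactus
  ; Goes = Goes
  ; total = λ w big → let (Y , p) = place (copwin⇒connected G w) big in just Y , p
  ; injective = λ {_} {_} {m} → inj {m = m}
  ; to-centred = λ p → placed-centre p , placed-size p
  ; to-spare = λ () }
  where
  open CactusInjection cactus
  Goes : Subset n → Maybe (Subset n) → Set
  Goes S (just Y) = Placed S Y
  Goes S nothing = ⊥
  inj : ∀ {S S' m} → 3 ≤ ∣ S ∣ → 3 ≤ ∣ S' ∣ → Goes S m → Goes S' m → S ≡ S'
  inj {m = just Y} = placed-injective
  inj {m = nothing} _ _ ()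

fresh : ∀ {n} (xs : List (Fin n)) → length xs < n → ∃ λ v → v ∉ˡ xs
fresh {n} xs lt with member-outside Subset.⊤ xs (subst (length xs <_) (sym (∣⊤∣≡n n)) lt)
... | v , _ , v∉ = v , v∉

size-three : ∀ {n} {S : Subset n} {x y z} → 3 ≤ ∣ S ∣ → (∀ {v} → v ∈ S → v ≡ x ⊎ v ≡ y ⊎ v ≡ z) → ∣ S ∣ ≡ 3
size-three {S = S} {x} {y} {z} big h with ℕₚ.m≤n⇒m<n∨m≡n big
... | inj₂ e = sym e
... | inj₁ lt with member-outside S (x ∷ y ∷ z ∷ []) lt
...   | v , v∈ , v∉ = ⊥-elim (v∉ ([ hereˡ , [ thereˡ ∘ hereˡ , thereˡ ∘ thereˡ ∘ hereˡ ]′ ]′ (h v∈)))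

not-two : ∀ {n} {S : Subset n} {x y} → 3 ≤ ∣ S ∣ → (∀ {v} → v ∈ S → v ≡ x ⊎ v ≡ y) → ⊥
not-two {S = S} {x} {y} big h with member-outside S (x ∷ y ∷ []) big
... | v , v∈ , v∉ = v∉ ([ hereˡ , thereˡ ∘ hereˡ ]′ (h v∈))

-- Distribution of the replacements by the lengths of the legs

data Missing : Set where
  none miss-a miss-b miss-g : Missing

module Assignments {n} {G : Graph n} {par : Parents n} {c q a b g : Fin n} (θ : Theta G par c q a b g)
                   (a≢q : a ≢ q) (b≢q : b ≢ q) where
  open ThetaProperties θ
  open Compensations θ a≢q b≢q

  OfType : Subset n → Missing → Set
  OfType S none   = a ∈ S × b ∈ S × g ∈ S
  OfType S miss-a = a ∉ S × b ∈ S × g ∈ S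
  OfType S miss-b = a ∈ S × b ∉ S × g ∈ S
  OfType S miss-g = a ∈ S × b ∈ S × g ∉ S

  type-of : ∀ {S} → Exceptional S → ∃ (OfType S)
  type-of {S} X with a ∈? S | b ∈? S | g ∈? S
  ... | yes a∈ | yes b∈ | yes g∈ = none , a∈ , b∈ , g∈
  ... | no a∉ | yes b∈ | yes g∈ = miss-a , a∉ , b∈ , g∈
  ... | yes a∈ | no b∉ | yes g∈ = miss-b , a∈ , b∉ , g∈
  ... | yes a∈ | yes b∈ | no g∉ = miss-g , a∈ , b∈ , g∉
  ... | no a∉ | no b∉ | _ = ⊥-elim (several X λ { is-a p → ⊥-elim (a∉ p) ; is-b p → ⊥-elim (b∉ p) ; is-g _ → refl })
  ... | no a∉ | yes _ | no g∉ = ⊥-elim (several X λ { is-a p → ⊥-elim (a∉ p) ; is-b _ → refl ; is-g p → ⊥-elim (g∉ p) })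
  ... | yes _ | no b∉ | no g∉ = ⊥-elim (several X λ { is-a _ → refl ; is-b p → ⊥-elim (b∉ p) ; is-g p → ⊥-elim (g∉ p) })

  type-⊆ : ∀ {S S'} m → OfType S m → OfType S' m → ∀ {r} → R r → r ∈ S → r ∈ S'
  type-⊆ none _ (x , y , z) = λ { is-a _ → x ; is-b _ → y ; is-g _ → z }
  type-⊆ miss-a (n , _) (_ , y , z) = λ { is-a p → ⊥-elim (n p) ; is-b _ → y ; is-g _ → z }
  type-⊆ miss-b (_ , n , _) (x , _ , z) = λ { is-a _ → x ; is-b p → ⊥-elim (n p) ; is-g _ → z }
  type-⊆ miss-g (_ , _ , n) (x , y , _) = λ { is-a _ → x ; is-b _ → y ; is-g p → ⊥-elim (n p) }

  same-type : ∀ {S S'} m → Exceptional S → Exceptional S' → OfType S m → OfType S' m → S ≡ S'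
  same-type m X X' t t' = ⊆⊇⇒≡ (exceptional-⊆ X X' (type-⊆ m t t')) (exceptional-⊆ X' X (type-⊆ m t' t))

  -- The type of an exceptional set determines it, so for injectivity a value only has to reveal the
  -- type: this is the fingerprint. `Room m` permits the use of the spare value and holds for at
  -- most one type.
  record Assignment : Set₁ where
    field
      Fingerprint : Missing → Subset n → Set
      Room        : Missing → Set
      fingerprint-unique : ∀ {m m' Y} → Fingerprint m Y → Fingerprint m' Y → m ≡ m'
      room-unique : ∀ {m m'} → Room m → Room m' → m ≡ m'
      assign : ∀ m {S} → OfType S m → Exceptional S → c ∉ S → 3 ≤ ∣ S ∣ →
               (Room m × ∣ S ∣ ≡ 3) ⊎ ∃ λ Y → Compensates S Y × Fingerprint m Y

  theta-injection : Assignment → CopWinInjection G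
  theta-injection A = record
    { centre = c ; Goes = Goes ; total = total ; injective = λ {_} {_} {m} → injective {m = m}
    ; to-centred = to-centred ; to-spare = to-spare }
    where
    open Assignment A
    data Goes (S : Subset n) : Maybe (Subset n) → Set where
      centred : ∀ {Y} → InducedCopWin G S → Centred S Y → Goes S (just Y)
      special : ∀ {Y} m → OfType S m → Exceptional S → Compensates S Y → Fingerprint m Y → Goes S (just Y)
      spare   : ∀ m → OfType S m → Exceptional S → Room m → ∣ S ∣ ≡ 3 → Goes S nothing
    total : ∀ {S} → InducedCopWin G S → 3 ≤ ∣ S ∣ → ∃ (Goes S)
    total w big with centred-or-exceptional (λ _ → tt) (copwin⇒connected G w) big
    ... | inj₁ (Y , x) = just Y , centred w x
    ... | inj₂ (c∉ , X) with type-of X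
    ...   | m , t with assign m t X c∉ big
    ...     | inj₁ (r , e) = nothing , spare m t X r e
    ...     | inj₂ (Y , k , f) = just Y , special m t X k f
    clash : ∀ {S S' Y} → InducedCopWin G S → Centred S Y → Compensates S' Y → ⊥
    clash w (kept _ _ refl) k = Compensates.bad k w
    clash w (moved c∉ T i) k = Compensates.free k c∉ T i
    injective : ∀ {S S' m} → 3 ≤ ∣ S ∣ → 3 ≤ ∣ S' ∣ → Goes S m → Goes S' m → S ≡ S'
    injective _ _ (centred _ x) (centred _ x') = centred-injective tt (λ _ → tt) (λ _ → tt) x x'
    injective _ _ (centred w x) (special _ _ _ k _) = ⊥-elim (clash w x k)
    injective _ _ (special _ _ _ k _) (centred w x) = ⊥-elim (clash w x k)
    injective _ _ (special m t X _ f) (special m' t' X' _ f') with fingerprint-unique f f'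
    ... | refl = same-type m X X' t t'
    injective _ _ (spare m t X r _) (spare m' t' X' r' _) with room-unique r r'
    ... | refl = same-type m X X' t t'
    to-centred : ∀ {S Y} → Goes S (just Y) → c ∈ Y × ∣ Y ∣ ≡ ∣ S ∣
    to-centred (centred _ x) = centred-centre x , centred-size x
    to-centred (special _ _ _ k _) = Compensates.centre k , Compensates.size k
    to-spare : ∀ {S} → Goes S nothing → ∣ S ∣ ≡ 3
    to-spare (spare _ _ _ _ e) = e

  private
    second-on-leg : ∃ λ p → par a ≡ just p × Anc par q p × p ≢ c
    second-on-leg = leg-parent Ra a≢q

  module TwoLongLegs (¬sa : ¬ Short a) (¬sb : ¬ Short b) where

    -- Two long legs give four replacements, one for each pattern of membership of `a` and `g`, and
    -- the spare value stays free.
    Fingerprint : Missing → Subset n → Set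
    Fingerprint none Y   = a ∈ Y × g ∈ Y
    Fingerprint miss-a Y = a ∈ Y × g ∉ Y
    Fingerprint miss-b Y = a ∉ Y × g ∉ Y
    Fingerprint miss-g Y = a ∉ Y × g ∈ Y

    unique : ∀ m m' {Y} → Fingerprint m Y → Fingerprint m' Y → m ≡ m'
    unique none none _ _ = refl
    unique miss-a miss-a _ _ = refl
    unique miss-b miss-b _ _ = refl
    unique miss-g miss-g _ _ = refl
    unique none miss-a (_ , y) (_ , x) = ⊥-elim (x y)
    unique none miss-b (y , _) (x , _) = ⊥-elim (x y)
    unique none miss-g (y , _) (x , _) = ⊥-elim (x y)
    unique miss-a none (_ , x) (_ , y) = ⊥-elim (x y)
    unique miss-a miss-b (y , _) (x , _) = ⊥-elim (x y)
    unique miss-a miss-g (y , _) (x , _) = ⊥-elim (x y)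
    unique miss-b none (x , _) (y , _) = ⊥-elim (x y)
    unique miss-b miss-a (x , _) (y , _) = ⊥-elim (x y)
    unique miss-b miss-g (_ , x) (_ , y) = ⊥-elim (x y)
    unique miss-g none (x , _) (y , _) = ⊥-elim (x y)
    unique miss-g miss-a (x , _) (y , _) = ⊥-elim (x y)
    unique miss-g miss-b (_ , y) (_ , x) = ⊥-elim (x y)

    assign : ∀ m {S} → OfType S m → Exceptional S → c ∉ S → 3 ≤ ∣ S ∣ → ∃ λ Y → Compensates S Y × Fingerprint m Y
    assign none {S} (a∈ , b∈ , g∈) X c∉ big =
      swap S b c , remove-end X c∉ a∈ b∈ g∈ (inj₂ ¬sa) , ∈-swap-old S b c a≢b a∈ , ∈-swap-old S b c (≢-sym b≢g) g∈
    assign miss-a {S} (a∉ , b∈ , g∈) X c∉ big =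
      swap² S b c g a ,
      exchange-ends X c∉ big Rb Rg Ra b≢g (≢-sym a≢b) (≢-sym a≢g) (λ { is-a → is-g ; is-b → is-a ; is-g → is-b }) ¬sb ¬sa b∈ g∈ a∉ ,
      ∈-swap²-second S b c g a , ∉-swap² S b c g a (R≢c Rg) (≢-sym a≢g) (inj₂ (inj₁ refl))
    assign miss-b {S} (a∈ , b∉ , g∈) X c∉ big =
      swap² S a c g b ,
      exchange-ends X c∉ big Ra Rg Rb a≢g a≢b (≢-sym b≢g) (λ { is-a → is-a ; is-b → is-g ; is-g → is-b }) ¬sa ¬sb a∈ g∈ b∉ ,
      ∉-swap² S a c g b (R≢c Ra) a≢b (inj₁ refl) , ∉-swap² S a c g b (R≢c Rg) (≢-sym b≢g) (inj₂ (inj₁ refl))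
    assign miss-g {S} (a∈ , b∈ , g∉) X c∉ big with Short? g
    ... | no ¬sg = swap² S a c b g ,
          exchange-ends X c∉ big Ra Rb Rg a≢b a≢g b≢g id ¬sa ¬sg a∈ b∈ g∉ ,
          ∉-swap² S a c b g (R≢c Ra) a≢g (inj₁ refl) , ∈-swap²-second S a c b g
    ... | yes sg with second-on-leg
    ...   | p , a-p , _ , p≢c = swap² S a c p g ,
            reroute X c∉ a∈ b∈ g∉ (λ { refl → g∉ (exceptional-q X) }) sg ¬sa a-p ,
            ∉-swap² S a c p g (R≢c Ra) a≢g (inj₁ refl) , ∈-swap²-second S a c p g

    assignment : Assignment
    assignment = record
      { Fingerprint = Fingerprint ; Room = λ _ → ⊥ ; fingerprint-unique = λ {m} {m'} → unique m m' ; room-unique = λ ()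
      ; assign = λ m t X c∉ big → inj₂ (assign m t X c∉ big) }

  private
    -- With `g ≡ q` the set would shrink to at most `i` and `q`.
    big-leg⇒g≢q : ∀ {S} → Exceptional S → c ∉ S → 3 ≤ ∣ S ∣ → ∀ {i} → Short i → (∀ {r} → R r → r ∈ S → r ≡ i ⊎ r ≡ g) → g ≢ q
    big-leg⇒g≢q X c∉ big {i} si only g≡q = not-two big members
      where
      members : ∀ {v} → v ∈ _ → v ≡ i ⊎ v ≡ q
      members v∈ with Exceptional.core X v∈
      ... | r , Rr , r∈ , vr with only Rr r∈
      ...   | inj₁ refl = short-core si vr (c-unlike c∉ v∈)
      ...   | inj₂ refl with short-core (inj₁ g≡q) vr (c-unlike c∉ v∈)
      ...     | inj₁ e = inj₂ (trans e g≡q)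
      ...     | inj₂ e = inj₂ e

    short-members : ∀ {S} → Exceptional S → c ∉ S → ∀ {i j} → Short i → Short j → (∀ {r} → R r → r ∈ S → r ≡ i ⊎ r ≡ j) →
                    ∀ {v} → v ∈ S → v ≡ i ⊎ v ≡ j ⊎ v ≡ q
    short-members X c∉ si sj only v∈ with Exceptional.core X v∈
    ... | r , Rr , r∈ , vr with only Rr r∈
    ...   | inj₁ refl = [ inj₁ , inj₂ ∘ inj₂ ]′ (short-core si vr (c-unlike c∉ v∈))
    ...   | inj₂ refl = [ inj₂ ∘ inj₁ , inj₂ ∘ inj₂ ]′ (short-core sj vr (c-unlike c∉ v∈))

    only-bg : ∀ {S} → a ∉ S → ∀ {r} → R r → r ∈ S → r ≡ b ⊎ r ≡ g
    only-bg a∉ = λ { is-a p → ⊥-elim (a∉ p) ; is-b _ → inj₁ refl ; is-g _ → inj₂ refl }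

    only-ag : ∀ {S} → b ∉ S → ∀ {r} → R r → r ∈ S → r ≡ a ⊎ r ≡ g
    only-ag b∉ = λ { is-b p → ⊥-elim (b∉ p) ; is-a _ → inj₁ refl ; is-g _ → inj₂ refl }

    only-ab : ∀ {S} → g ∉ S → ∀ {r} → R r → r ∈ S → r ≡ a ⊎ r ≡ b
    only-ab g∉ = λ { is-g p → ⊥-elim (g∉ p) ; is-a _ → inj₁ refl ; is-b _ → inj₂ refl }

    leg-of : ∀ {r} → r ≢ q → Short r → par r ≡ just q
    leg-of r≢q = [ (λ e → ⊥-elim (r≢q e)) , id ]′

  module OneLongLeg (7≤n : 7 ≤ n) (¬sa : ¬ Short a) (sb : Short b) (sg : Short g) where

    private
      p : Fin n
      p = proj₁ second-on-leg
      a-p : par a ≡ just p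
      a-p = proj₁ (proj₂ second-on-leg)
      q-p : Anc par q p
      q-p = proj₁ (proj₂ (proj₂ second-on-leg))
      p≢c : p ≢ c
      p≢c = proj₂ (proj₂ (proj₂ second-on-leg))
      p≢q : p ≢ q
      p≢q e = ¬sa (inj₂ (subst (λ z → par a ≡ just z) e a-p))
      p≢a : p ≢ a
      p≢a = ≢-sym (parent-≢ forest a-p)
      pa : Anc par p a
      pa = up a-p self
      p≢leg : ∀ {r} → R r → a ≢ r → p ≢ r
      p≢leg {r} Rr a≢r e = disjoint-leg Ra Rr a≢r pa p≢c p≢q (subst (Anc par p) e self)

    -- The alternatives for `miss-b` belong to `detach-q`, `detach-h` and `isolate`, in this order.
    -- Sets of type `miss-a` always take the spare value.
    Fingerprint : Missing → Subset n → Set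
    Fingerprint none Y   = a ∈ Y × g ∈ Y
    Fingerprint miss-a Y = ⊥
    Fingerprint miss-b Y = (a ∈ Y × g ∉ Y) ⊎ (a ∉ Y × (b ∉ Y ⊎ p ∈ Y))
    Fingerprint miss-g Y = a ∉ Y × b ∈ Y × p ∉ Y

    -- The candidates are `{b, g, q}` and, if `p` is a child of `q`, `{a, p, q}`. The first requires
    -- `g ≢ q` and the second `g ≡ q`, so they never compete.
    Room : Missing → Set
    Room none   = ⊥
    Room miss-a = g ≢ q
    Room miss-b = g ≡ q
    Room miss-g = ⊥

    unique : ∀ m m' {Y} → Fingerprint m Y → Fingerprint m' Y → m ≡ m'
    unique none none _ _ = refl
    unique miss-b miss-b _ _ = refl
    unique miss-g miss-g _ _ = refl
    unique none miss-b (_ , y) (inj₁ (_ , x)) = ⊥-elim (x y)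
    unique none miss-b (y , _) (inj₂ (x , _)) = ⊥-elim (x y)
    unique none miss-g (y , _) (x , _) = ⊥-elim (x y)
    unique miss-b none (inj₁ (_ , x)) (_ , y) = ⊥-elim (x y)
    unique miss-b none (inj₂ (x , _)) (y , _) = ⊥-elim (x y)
    unique miss-b miss-g (inj₁ (y , _)) (x , _) = ⊥-elim (x y)
    unique miss-b miss-g (inj₂ (_ , inj₁ x)) (_ , y , _) = ⊥-elim (x y)
    unique miss-b miss-g (inj₂ (_ , inj₂ y)) (_ , _ , x) = ⊥-elim (x y)
    unique miss-g none (x , _) (y , _) = ⊥-elim (x y)
    unique miss-g miss-b (x , _) (inj₁ (y , _)) = ⊥-elim (x y)
    unique miss-g miss-b (_ , y , _) (inj₂ (_ , inj₁ x)) = ⊥-elim (x y)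
    unique miss-g miss-b (_ , _ , x) (inj₂ (_ , inj₂ y)) = ⊥-elim (x y)

    unique-room : ∀ m m' → Room m → Room m' → m ≡ m'
    unique-room miss-a miss-a _ _ = refl
    unique-room miss-b miss-b _ _ = refl
    unique-room miss-a miss-b x y = ⊥-elim (x y)
    unique-room miss-b miss-a y x = ⊥-elim (x y)

    long : ∀ {S s} → a ∈ S → b ∉ S → g ∈ S → Exceptional S → c ∉ S → 3 ≤ ∣ S ∣ → par p ≡ just s → Dec (s ≡ q) → Dec (g ≡ q) →
           (Room miss-b × ∣ S ∣ ≡ 3) ⊎ ∃ λ Y → Compensates S Y × Fingerprint miss-b Y
    long {S} {s} a∈ b∉ g∈ X c∉ big p-s (no s≢q) _ =
      inj₂ (swap² S a c s b , isolate X c∉ a∈ b∉ g∈ sb ¬sa a-p p-s s≢q ,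
            inj₂ (∉-swap² S a c s b (R≢c Ra) a≢b (inj₁ refl) ,
                  inj₂ (∈-swap²-old S a c s b p≢a (parent-≢ forest p-s) (leg-in X Ra a∈ pa p≢c))))
    long {S} a∈ b∉ g∈ X c∉ big p-q (yes refl) (yes g≡q) = inj₁ (g≡q , size-three big members)
      where
      members : ∀ {v} → v ∈ S → v ≡ a ⊎ v ≡ p ⊎ v ≡ q
      members {v} v∈ with Exceptional.core X v∈
      ... | _ , is-b , b∈ , _ = ⊥-elim (b∉ b∈)
      ... | _ , is-g , _ , vg = inj₂ (inj₂ ([ (λ e → trans e g≡q) , id ]′ (short-core (inj₁ g≡q) vg (c-unlike c∉ v∈))))
      ... | _ , is-a , _ , va with v ≟ a
      ...   | yes e = inj₁ e
      ...   | no v≢a = inj₂ (short-core (inj₂ p-q) (Anc-parent a-p va v≢a) (c-unlike c∉ v∈))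
    -- Centre, `q` and the legs with 2, 1 and 1 inner vertices fill six places; the seventh vertex
    -- is `h`.
    long {S} a∈ b∉ g∈ X c∉ big p-q (yes refl) (no g≢q) with fresh (c ∷ q ∷ p ∷ a ∷ b ∷ g ∷ []) 7≤n
    ... | h , h∉ with Anc-has-parent (rooted h) (λ e → h∉ (hereˡ (sym e)))
    ...   | m , h-m , _ = inj₂ (result (m ≟ p))
      where
      h≢c : h ≢ c
      h≢c e = h∉ (hereˡ e)
      off : OffCore h
      off r is-a ha with h ≟ a
      ... | yes e = h∉ (thereˡ (thereˡ (thereˡ (hereˡ e))))
      ... | no h≢a with short-core (inj₂ p-q) (Anc-parent a-p ha h≢a) h≢c
      ...   | inj₁ e = h∉ (thereˡ (thereˡ (hereˡ e)))
      ...   | inj₂ e = h∉ (thereˡ (hereˡ e))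
      off r is-b hb = [ (λ e → h∉ (thereˡ (thereˡ (thereˡ (thereˡ (hereˡ e)))))) , (λ e → h∉ (thereˡ (hereˡ e))) ]′ (short-core sb hb h≢c)
      off r is-g hg = [ (λ e → h∉ (thereˡ (thereˡ (thereˡ (thereˡ (thereˡ (hereˡ e))))))) , (λ e → h∉ (thereˡ (hereˡ e))) ]′ (short-core sg hg h≢c)
      open OffLegs h≢c off h-m
      h≢ : ∀ {r} → R r → h ≢ r
      h≢ Rr refl = ¬Rh Rr
      result : Dec (m ≡ p) → ∃ λ Y → Compensates S Y × Fingerprint miss-b Y
      result (no m≢p) = swap² S p h g c , detach-q X c∉ a∈ b∉ g∈ g≢q a-p p-q (leg-of g≢q sg) m≢p ,
        inj₁ (∈-swap²-old S p h g c (≢-sym p≢a) a≢g a∈ , ∉-swap² S p h g c (≢-sym (h≢ Rg)) (R≢c Rg) (inj₂ (inj₁ refl)))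
      result (yes m≡p) = swap² S a c p h , detach-h X c∉ a∈ b∉ g∈ g≢q a-p p-q (leg-of g≢q sg) m≡p ,
        inj₂ (∉-swap² S a c p h (R≢c Ra) (≢-sym (h≢ Ra)) (inj₁ refl) ,
              inj₁ (∉-swap² S a c p h (R≢c Rb) (≢-sym (h≢ Rb)) (inj₂ (inj₂ b∉))))

    assign : ∀ m {S} → OfType S m → Exceptional S → c ∉ S → 3 ≤ ∣ S ∣ →
             (Room m × ∣ S ∣ ≡ 3) ⊎ ∃ λ Y → Compensates S Y × Fingerprint m Y
    assign none {S} (a∈ , b∈ , g∈) X c∉ big =
      inj₂ (swap S b c , remove-end X c∉ a∈ b∈ g∈ (inj₂ ¬sa) , ∈-swap-old S b c a≢b a∈ , ∈-swap-old S b c (≢-sym b≢g) g∈)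
    assign miss-a (a∉ , b∈ , g∈) X c∉ big =
      inj₁ (big-leg⇒g≢q X c∉ big sb (only-bg a∉) , size-three big (short-members X c∉ sb sg (only-bg a∉)))
    assign miss-b (a∈ , b∉ , g∈) X c∉ big =
      let (s , p-s , _) = Anc-has-parent q-p (≢-sym p≢q) in long a∈ b∉ g∈ X c∉ big p-s (s ≟ q) (g ≟ q)
    assign miss-g {S} (a∈ , b∈ , g∉) X c∉ big =
      inj₂ (swap² S a c p g , reroute X c∉ a∈ b∈ g∉ (λ { refl → g∉ (exceptional-q X) }) sg ¬sa a-p ,
            ∉-swap² S a c p g (R≢c Ra) a≢g (inj₁ refl) ,
            ∈-swap²-old S a c p g (≢-sym a≢b) (≢-sym (p≢leg Rb a≢b)) b∈ ,
            ∉-swap² S a c p g p≢c (p≢leg Rg a≢g) (inj₂ (inj₁ refl)))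

    assignment : Assignment
    assignment = record
      { Fingerprint = Fingerprint ; Room = Room ; fingerprint-unique = λ {m} {m'} → unique m m'
      ; room-unique = λ {m} {m'} → unique-room m m' ; assign = assign }

  module NoLongLeg (7≤n : 7 ≤ n) (sa : Short a) (sb : Short b) (sg : Short g) where

    private
      core-list : List (Fin n)
      core-list = c ∷ q ∷ a ∷ b ∷ g ∷ []

      off-list : ∀ {h} → h ∉ˡ core-list → h ≢ c × OffCore h
      off-list {h} h∉ = h≢c , λ { r is-a ha → h∉ (place (short-core sa ha h≢c) (thereˡ (thereˡ (hereˡ refl))))
                                ; r is-b hb → h∉ (place (short-core sb hb h≢c) (thereˡ (thereˡ (thereˡ (hereˡ refl)))))
                                ; r is-g hg → h∉ (place (short-core sg hg h≢c) (thereˡ (thereˡ (thereˡ (thereˡ (hereˡ refl)))))) }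
        where
        h≢c : h ≢ c
        h≢c e = h∉ (hereˡ e)
        place : ∀ {r} → h ≡ r ⊎ h ≡ q → r ∈ˡ core-list → h ∈ˡ core-list
        place (inj₁ refl) r∈ = r∈
        place (inj₂ refl) _ = thereˡ (hereˡ refl)

      spare₁ : ∃ λ h → h ∉ˡ core-list
      spare₁ = fresh core-list (≤-trans (s≤s (s≤s (s≤s (s≤s (s≤s (s≤s z≤n)))))) 7≤n)

      h₁ : Fin n
      h₁ = proj₁ spare₁

      -- The types `miss-b` and `miss-g` each receive a vertex of their own off the legs, by which
      -- they are told apart. Five vertices are taken, so 7 is again the bound.
      spare₂ : ∃ λ h → h ∉ˡ h₁ ∷ core-list
      spare₂ = fresh (h₁ ∷ core-list) 7≤n

      h₂ : Fin n
      h₂ = proj₁ spare₂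

      h₁-off : h₁ ≢ c × OffCore h₁
      h₁-off = off-list (proj₂ spare₁)

      h₂-off : h₂ ≢ c × OffCore h₂
      h₂-off = off-list (λ p → proj₂ spare₂ (thereˡ p))

      h₁≢h₂ : h₁ ≢ h₂
      h₁≢h₂ e = proj₂ spare₂ (hereˡ (sym e))

      off∉ : ∀ {S h} → Exceptional S → OffCore h → h ∉ S
      off∉ X off h∈ = let (r , Rr , _ , hr) = Exceptional.core X h∈ in off r Rr hr

    Fingerprint : Missing → Subset n → Set
    Fingerprint none Y   = h₁ ∉ Y × h₂ ∉ Y
    Fingerprint miss-a Y = ⊥
    Fingerprint miss-b Y = h₁ ∈ Y
    Fingerprint miss-g Y = h₁ ∉ Y × h₂ ∈ Y

    -- If `g ≡ q`, the only exceptional set of size at least three is `{a, b, q}`. Otherwise one of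
    -- the three similar triples, `{b, g, q}`, takes the spare value.
    Room : Missing → Set
    Room none   = g ≡ q
    Room miss-a = g ≢ q
    Room miss-b = ⊥
    Room miss-g = ⊥

    unique : ∀ m m' {Y} → Fingerprint m Y → Fingerprint m' Y → m ≡ m'
    unique none none _ _ = refl
    unique miss-b miss-b _ _ = refl
    unique miss-g miss-g _ _ = refl
    unique none miss-b (x , _) y = ⊥-elim (x y)
    unique none miss-g (_ , x) (_ , y) = ⊥-elim (x y)
    unique miss-b none y (x , _) = ⊥-elim (x y)
    unique miss-b miss-g y (x , _) = ⊥-elim (x y)
    unique miss-g none (_ , y) (_ , x) = ⊥-elim (x y)
    unique miss-g miss-b (x , _) y = ⊥-elim (x y)

    unique-room : ∀ m m' → Room m → Room m' → m ≡ m'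
    unique-room none none _ _ = refl
    unique-room miss-a miss-a _ _ = refl
    unique-room none miss-a y x = ⊥-elim (x y)
    unique-room miss-a none x y = ⊥-elim (x y)

    legs-one : g ≢ q → ∀ {r} → R r → par r ≡ just q
    legs-one g≢q is-a = leg-of a≢q sa
    legs-one g≢q is-b = leg-of b≢q sb
    legs-one g≢q is-g = leg-of g≢q sg

    use : ∀ {S i j h} → Exceptional S → c ∉ S → R i → R j → i ≢ j → i ∈ S → j ∈ S → (∀ {r} → R r → r ∈ S → r ≡ i ⊎ r ≡ j) →
          g ≢ q → h ≢ c × OffCore h →
          ∃ λ Y → Compensates S Y × h ∈ Y × (∀ {v} → v ∈ Y → v ≡ c ⊎ v ≡ h ⊎ v ∈ S)
    use {S} {i} {j} {h} X c∉ Ri Rj i≢j i∈ j∈ only g≢q (h≢c , off) with Anc-has-parent (rooted h) (≢-sym h≢c)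
    ... | m , h-m , _ = result (Form.R? form m) (i ≟ m)
      where
      open OffLegs h≢c off h-m
      bound : ∀ x x' {v} → v ∈ swap² S x c x' h → v ≡ c ⊎ v ≡ h ⊎ v ∈ S
      bound x x' v∈ with ∈-swap²⁻ S x c x' h v∈
      ... | inj₁ e = [ inj₁ , inj₂ ∘ inj₁ ]′ e
      ... | inj₂ (_ , _ , v∈S) = inj₂ (inj₂ v∈S)
      result : Dec (R m) → Dec (i ≡ m) → ∃ λ Y → Compensates S Y × h ∈ Y × (∀ {v} → v ∈ Y → v ≡ c ⊎ v ≡ h ⊎ v ∈ S)
      result (no ¬Rm) _ = swap² S i c j h , spare-ends X c∉ Ri Rj i≢j i∈ j∈ only (legs-one g≢q) ¬Rm ,
        ∈-swap²-second S i c j h , bound i j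
      result (yes Rm) (no i≢m) = swap² S j c q h , spare-middle X c∉ Ri Rj i≢j i∈ j∈ only (legs-one g≢q) Rm i≢m ,
        ∈-swap²-second S j c q h , bound j q
      -- The roles of `i` and `j` are interchanged so that the end that stays is not the parent of
      -- `h`.
      result (yes Rm) (yes refl) = swap² S i c q h ,
        spare-middle X c∉ Rj Ri (≢-sym i≢j) j∈ i∈ (λ Rr r∈ → [ inj₂ , inj₁ ]′ (only Rr r∈)) (legs-one g≢q) Rm (≢-sym i≢j) ,
        ∈-swap²-second S i c q h , bound i q

    assign : ∀ m {S} → OfType S m → Exceptional S → c ∉ S → 3 ≤ ∣ S ∣ →
             (Room m × ∣ S ∣ ≡ 3) ⊎ ∃ λ Y → Compensates S Y × Fingerprint m Y
    assign none {S} (a∈ , b∈ , g∈) X c∉ big with g ≟ q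
    ... | no g≢q = inj₂ (swap S b c , remove-end X c∉ a∈ b∈ g∈ (inj₁ g≢q) , out h₁-off , out h₂-off)
      where
      out : ∀ {h} → h ≢ c × OffCore h → h ∉ swap S b c
      out (h≢c , off) h∈ = off∉ X off (proj₂ (∈-swap⁻-old S b c h≢c h∈))
    ... | yes g≡q = inj₁ (g≡q , size-three big members)
      where
      members : ∀ {v} → v ∈ S → v ≡ a ⊎ v ≡ b ⊎ v ≡ q
      members v∈ with Exceptional.core X v∈
      ... | _ , is-a , _ , va = [ inj₁ , inj₂ ∘ inj₂ ]′ (short-core sa va (c-unlike c∉ v∈))
      ... | _ , is-b , _ , vb = [ inj₂ ∘ inj₁ , inj₂ ∘ inj₂ ]′ (short-core sb vb (c-unlike c∉ v∈))
      ... | _ , is-g , _ , vg = inj₂ (inj₂ ([ (λ e → trans e g≡q) , id ]′ (short-core sg vg (c-unlike c∉ v∈))))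
    assign miss-a (a∉ , b∈ , g∈) X c∉ big =
      inj₁ (big-leg⇒g≢q X c∉ big sb (only-bg a∉) , size-three big (short-members X c∉ sb sg (only-bg a∉)))
    assign miss-b (a∈ , b∉ , g∈) X c∉ big =
      let (Y , k , h∈ , _) = use X c∉ Ra Rg a≢g a∈ g∈ (only-ag b∉) (big-leg⇒g≢q X c∉ big sa (only-ag b∉)) h₁-off in inj₂ (Y , k , h∈)
    assign miss-g {S} (a∈ , b∈ , g∉) X c∉ big =
      let (Y , k , h∈ , bound) = use X c∉ Ra Rb a≢b a∈ b∈ (only-ab g∉) (λ { refl → g∉ (exceptional-q X) }) h₂-off
      in inj₂ (Y , k , (λ p → [ proj₁ h₁-off , [ h₁≢h₂ , off∉ X (proj₂ h₁-off) ]′ ]′ (bound p)) , h∈)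

    assignment : Assignment
    assignment = record
      { Fingerprint = Fingerprint ; Room = Room ; fingerprint-unique = λ {m} {m'} → unique m m'
      ; room-unique = λ {m} {m'} → unique-room m m' ; assign = assign }

sorted-theta-injection : ∀ {n} {G : Graph n} {par c q a b g} (θ : Theta G par c q a b g) → 7 ≤ n → a ≢ q → b ≢ q →
  (ThetaProperties.Short θ a → ThetaProperties.Short θ b) → (ThetaProperties.Short θ b → ThetaProperties.Short θ g) →
  CopWinInjection G
sorted-theta-injection {a = a} {b} θ 7≤n a≢q b≢q ab bg = by-cases (Short? a) (Short? b)
  where
  open ThetaProperties θ
  open Assignments θ a≢q b≢q
  by-cases : Dec (Short a) → Dec (Short b) → CopWinInjection _
  by-cases (no ¬sa) (no ¬sb) = theta-injection (TwoLongLegs.assignment ¬sa ¬sb)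
  by-cases (no ¬sa) (yes sb) = theta-injection (OneLongLeg.assignment 7≤n ¬sa sb (bg sb))
  by-cases (yes sa) _ = theta-injection (NoLongLeg.assignment 7≤n sa (ab sa) (bg (ab sa)))

theta-injection : ∀ {n} {G : Graph n} {par c q a b g} → Theta G par c q a b g → 7 ≤ n → CopWinInjection G
theta-injection {n} {G} {par} {c} {q} {a} {b} {g} θ 7≤n = sort θ (ℕₚ.≤-total (level a) (level b))
  where
  -- Higher levels mean shorter legs, with 2 for no inner vertex, so sorting puts long legs first.
  -- Only one end can be `q`, and it ends up as `g`.
  level : Fin n → ℕ
  level r with r ≟ q | just? (par r) q
  ... | yes _ | _ = 2
  ... | no _ | yes _ = 1
  ... | no _ | no _ = 0
  level-q : ∀ {r} → r ≡ q → 2 ≤ level r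
  level-q {r} e with r ≟ q | just? (par r) q
  ... | yes _ | _ = s≤s (s≤s z≤n)
  ... | no ne | _ = ⊥-elim (ne e)
  q-level : ∀ {r} → 2 ≤ level r → r ≡ q
  q-level {r} l with r ≟ q | just? (par r) q
  ... | yes e | _ = e
  q-level (s≤s ()) | no _ | yes _
  q-level () | no _ | no _
  level-short : ∀ {r} → r ≡ q ⊎ par r ≡ just q → 1 ≤ level r
  level-short {r} s with r ≟ q | just? (par r) q
  ... | yes _ | _ = s≤s z≤n
  ... | no _ | yes _ = s≤s z≤n
  ... | no x | no y = ⊥-elim ([ x , y ]′ s)
  short-level : ∀ {r} → 1 ≤ level r → r ≡ q ⊎ par r ≡ just q
  short-level {r} l with r ≟ q | just? (par r) q
  ... | yes e | _ = inj₁ e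
  ... | no _ | yes e = inj₂ e
  short-level () | no _ | no _
  sorted : ∀ {a b g} → Theta G par c q a b g → level a ≤ level b → level b ≤ level g → CopWinInjection G
  sorted {a} {b} {g} θ ab bg = sorted-theta-injection θ 7≤n
    (λ e → Theta.a≢g θ (trans e (sym (q-level (≤-trans (level-q e) (≤-trans ab bg))))))
    (λ e → Theta.b≢g θ (trans e (sym (q-level (≤-trans (level-q e) bg)))))
    (λ s → short-level (≤-trans (level-short s) ab)) (λ s → short-level (≤-trans (level-short s) bg))
  insert : ∀ {a b g} → Theta G par c q a b g → level a ≤ level b → CopWinInjection G
  insert {a} {b} {g} θ ab with ℕₚ.≤-total (level b) (level g) | ℕₚ.≤-total (level a) (level g)
  ... | inj₁ bg | _ = sorted θ ab bg
  ... | inj₂ gb | inj₁ ag = sorted (swap-bg θ) ag gb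
  ... | inj₂ gb | inj₂ ga = sorted (swap-ab (swap-bg θ)) ga ab
  sort : ∀ {a b g} → Theta G par c q a b g → level a ≤ level b ⊎ level b ≤ level a → CopWinInjection G
  sort θ (inj₁ ab) = insert θ ab
  sort θ (inj₂ ba) = insert (swap-ab θ) ba

bicyclic-injection : ∀ {n} (G : Graph n) → Bicyclic G → 7 ≤ n → CopWinInjection G
bicyclic-injection {suc n} G bi 7≤n = [ cactus-injection , (λ t → theta-injection (proj₂ (proj₂ (proj₂ (proj₂ (proj₂ (proj₂ (theta-from-skeleton t))))))) 7≤n) ]′ (cactus-or-theta G bi zero)

-- Comparison with B_n

module _ {m : ℕ} where

  private
    n : ℕ
    n = suc (suc (suc (suc m)))

    one : Fin n
    one = suc zero

  B-centred-copwin : {Y : Subset n} → zero ∈ Y → InducedCopWin (B n) Y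
  B-centred-copwin z∈ = dominated⇒copwin (B n) z∈ dominate
    where
    dominate : ∀ {v} → v ∈ _ → v ≢ zero → Adj (B n) zero v
    dominate {zero} _ ne = ⊥-elim (ne refl)
    dominate {suc v} _ _ = tt

  -- With one flag set these are the edges `ab` and `aw` of `B n`, with both the path `{1, 2, 3}`.
  spare-set : Bool → Bool → Subset n
  spare-set x y = false ∷ true ∷ x ∷ y ∷ Subset.⊥

  B-spare-copwin : ∀ x y → InducedCopWin (B n) (spare-set x y)
  B-spare-copwin x y = dominated⇒copwin (B n) {c = one} (there here) dominate
    where
    dominate : ∀ {v} → v ∈ spare-set x y → v ≢ one → Adj (B n) one v
    dominate {zero} ()
    dominate {suc zero} _ ne = ⊥-elim (ne refl)
    dominate {suc (suc zero)} _ _ = tt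
    dominate {suc (suc (suc zero))} _ _ = tt
    dominate {suc (suc (suc (suc v)))} (there (there (there (there p)))) _ = ⊥-elim (∉⊥ p)

  ≡-members : ∀ {S S' : Subset n} {x y} → ∣ S ∣ ≡ 2 → x ∈ S → y ∈ S → x ≢ y → x ∈ S' → y ∈ S' → ∀ {v} → v ∈ S → v ∈ S'
  ≡-members {S} {S'} e x∈ y∈ x≢y x∈' y∈' v∈ = [ (λ { refl → x∈' }) , (λ { refl → y∈' }) ]′ (two-elements S e x∈ y∈ x≢y v∈)

  module _ {G : Graph n} where

    W₁≤ : ∀ {b a} → W G 1 b → W (B n) 1 a → b ≤ a
    W₁≤ = Count-≤ _≡_ (λ { refl refl → refl }) (λ { {S} (e , _) → S , (e , singleton S e) , refl })
      where
      singleton : ∀ (S : Subset n) → ∣ S ∣ ≡ 1 → InducedCopWin (B n) S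
      singleton S e with positive⇒Nonempty S (≤-reflexive (sym e))
      ... | x , x∈ = dominated⇒copwin (B n) x∈ λ {v} v∈ v≢x →
            ⊥-elim (contra (trans (cong suc (∣del∣ (del S x) v (∈-del S x v≢x v∈))) (trans (∣del∣ S x x∈) e)))
        where
        contra : ∀ {k} → suc (suc k) ≡ 1 → ⊥
        contra ()

    -- A connected pair is an edge. Tree edges go to the pairs containing the universal vertex of
    -- `B n`, one for each vertex other than the root, and the two extra edges go to `ab` and `aw`.
    W₂≤ : Bicyclic G → ∀ {b a} → W G 2 b → W (B n) 2 a → b ≤ a
    W₂≤ bi with skeleton-rooted-on-cycle G bi zero
    ... | par , ρ , e₁ , f₁ , f₂ , sk = Count-≤ Edge edge-injective λ { (size , w) → edge size (copwin⇒connected G w) }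
      where
      open Skeleton sk
      data Edge (S Z : Subset n) : Set where
        tree-edge : ∀ {v p} → par v ≡ just p → v ∈ S → p ∈ S → ∣ S ∣ ≡ 2 → Z ≡ recentre ρ zero (recentre p ρ S) → Edge S Z
        e-edge′   : e₁ ∈ S → ρ ∈ S → ∣ S ∣ ≡ 2 → Z ≡ spare-set true false → Edge S Z
        f-edge′   : f₁ ∈ S → f₂ ∈ S → ∣ S ∣ ≡ 2 → Z ≡ spare-set false true → Edge S Z
      ≢ρ : ∀ {v p} → par v ≡ just p → v ≢ ρ
      ≢ρ t refl = just≢nothing t root≡
      not-spare : ∀ {x y} (S : Subset n) → recentre ρ zero S ≡ spare-set x y → ⊥
      not-spare S e = case subst (zero ∈_) e (recentre-centre ρ zero S) of λ ()
      edge-injective : ∀ {S S' Z} → Edge S Z → Edge S' Z → S ≡ S'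
      edge-injective {S} {S'} (tree-edge {v} {p} t v∈ p∈ s z) (tree-edge {v'} {p'} t' v∈' p∈' s' z')
        with recentre-injective ρ zero (recentre p ρ S) (recentre p' ρ S') (recentre-centre p ρ S) (recentre-centre p' ρ S') (trans (sym z) z')
      ... | same = recentred v≡v'
        where
        v∈Y : v ∈ recentre p ρ S
        v∈Y = recentre-kept p ρ S (parent-≢ forest t) v∈
        v'∈Y : v' ∈ recentre p ρ S
        v'∈Y = subst (v' ∈_) (sym same) (recentre-kept p' ρ S' (parent-≢ forest t') v∈')
        -- Moving the upper endpoint to `ρ` leaves the lower one as the only other member, and it
        -- determines its parent.
        v≡v' : v' ≡ v
        v≡v' = [ id , (λ e → ⊥-elim (≢ρ t' e)) ]′
          (two-elements (recentre p ρ S) (trans (recentre-size p ρ S p∈) s) v∈Y (recentre-centre p ρ S) (≢ρ t) v'∈Y)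
        recentred : v' ≡ v → S ≡ S'
        recentred refl with same-just t t'
        ... | refl = recentre-injective p ρ S S' p∈ p∈' same
      edge-injective {S} {S'} (e-edge′ x y s _) (e-edge′ x' y' s' _) =
        ⊆⊇⇒≡ (≡-members {S} {S'} s x y (Adj-irrefl G e-edge) x' y') (≡-members {S'} {S} s' x' y' (Adj-irrefl G e-edge) x y)
      edge-injective {S} {S'} (f-edge′ x y s _) (f-edge′ x' y' s' _) =
        ⊆⊇⇒≡ (≡-members {S} {S'} s x y (Adj-irrefl G f-edge) x' y') (≡-members {S'} {S} s' x' y' (Adj-irrefl G f-edge) x y)
      edge-injective {S} (tree-edge {p = p} _ _ _ _ z) (e-edge′ _ _ _ z') = ⊥-elim (not-spare (recentre p ρ S) (trans (sym z) z'))
      edge-injective {S} (tree-edge {p = p} _ _ _ _ z) (f-edge′ _ _ _ z') = ⊥-elim (not-spare (recentre p ρ S) (trans (sym z) z'))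
      edge-injective {S' = S'} (e-edge′ _ _ _ z') (tree-edge {p = p} _ _ _ _ z) = ⊥-elim (not-spare (recentre p ρ S') (trans (sym z) z'))
      edge-injective {S' = S'} (f-edge′ _ _ _ z') (tree-edge {p = p} _ _ _ _ z) = ⊥-elim (not-spare (recentre p ρ S') (trans (sym z) z'))
      edge-injective (e-edge′ _ _ _ refl) (f-edge′ _ _ _ ())
      edge-injective (f-edge′ _ _ _ refl) (e-edge′ _ _ _ ())
      spare-size : ∣ Subset.⊥ {m} ∣ ≡ 0
      spare-size = ∣⊥∣≡0 m
      along : ∀ {S} → ∣ S ∣ ≡ 2 → ∀ {u v} → u ∈ S → v ∈ S → Adj G u v → ∃ λ Z → (∣ Z ∣ ≡ 2 × InducedCopWin (B n) Z) × Edge S Z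
      along {S} s u∈ v∈ uv with complete uv
      ... | inj₁ t = [ (λ t → on-tree t u∈ v∈) , (λ t → on-tree t v∈ u∈) ]′ t
        where
        on-tree : ∀ {v p} → par v ≡ just p → v ∈ S → p ∈ S → ∃ λ Z → (∣ Z ∣ ≡ 2 × InducedCopWin (B n) Z) × Edge S Z
        on-tree {v} {p} t v∈ p∈ = recentre ρ zero (recentre p ρ S) ,
          (trans (recentre-size ρ zero (recentre p ρ S) (recentre-centre p ρ S)) (trans (recentre-size p ρ S p∈) s) ,
           B-centred-copwin (recentre-centre ρ zero (recentre p ρ S))) , tree-edge t v∈ p∈ s refl
      ... | inj₂ (inj₁ t) = spare-set true false , (cong (λ k → suc (suc k)) spare-size , B-spare-copwin true false) ,
            [ (λ { (refl , refl) → e-edge′ u∈ v∈ s refl }) , (λ { (refl , refl) → e-edge′ v∈ u∈ s refl }) ]′ t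
      ... | inj₂ (inj₂ t) = spare-set false true , (cong (λ k → suc (suc k)) spare-size , B-spare-copwin false true) ,
            [ (λ { (refl , refl) → f-edge′ u∈ v∈ s refl }) , (λ { (refl , refl) → f-edge′ v∈ u∈ s refl }) ]′ t
      edge : ∀ {S} → ∣ S ∣ ≡ 2 → ConnectedIn G S → ∃ λ Z → (∣ Z ∣ ≡ 2 × InducedCopWin (B n) Z) × Edge S Z
      edge {S} s conn with positive⇒Nonempty S (subst (1 ≤_) (sym s) (s≤s z≤n))
      ... | x , x∈ with member-outside S (x ∷ []) (≤-reflexive (sym s))
      ...   | y , y∈ , y∉ with Path-crossing G (_≟ x) (conn y∈ x∈) (λ e → y∉ (hereˡ e)) refl
      ...     | a , b , a∈ , b∈ , ab , _ = along s a∈ b∈ ab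

    -- Relabelling the centre as `zero` gives sets around the universal vertex, all cop-win in
    -- `B n`; the spare set avoids `zero` and cannot coincide with them.
    W₃≤ : CopWinInjection G → ∀ {k} → 3 ≤ k → ∀ {b a} → W G k b → W (B n) k a → b ≤ a
    W₃≤ injection {k} 3≤k = Count-≤ Target target-injective
        λ { (size , w) → let big = subst (3 ≤_) (sym size) 3≤k in target size (total w big) }
      where
      open CopWinInjection injection
      data Target (S Z : Subset n) : Set where
        centred : ∀ {Y} → ∣ S ∣ ≡ k → Goes S (just Y) → Z ≡ recentre centre zero Y → Target S Z
        spare   : ∣ S ∣ ≡ k → Goes S nothing → Z ≡ spare-set true true → Target S Z
      enough : ∀ {S : Subset n} → ∣ S ∣ ≡ k → 3 ≤ ∣ S ∣
      enough e = subst (3 ≤_) (sym e) 3≤k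
      not-spare : ∀ (S : Subset n) → recentre centre zero S ≡ spare-set true true → ⊥
      not-spare S e = case subst (zero ∈_) e (recentre-centre centre zero S) of λ ()
      target-injective : ∀ {S S' Z} → Target S Z → Target S' Z → S ≡ S'
      target-injective {S} {S'} (centred {Y} s p z) (centred {Y'} s' p' z')
        with recentre-injective centre zero Y Y' (proj₁ (to-centred p)) (proj₁ (to-centred p')) (trans (sym z) z')
      ... | refl = injective (enough {S} s) (enough {S'} s') p p'
      target-injective (centred {Y} _ _ z) (spare _ _ z') = ⊥-elim (not-spare Y (trans (sym z) z'))
      target-injective (spare _ _ z') (centred {Y} _ _ z) = ⊥-elim (not-spare Y (trans (sym z) z'))
      target-injective {S} {S'} (spare s p _) (spare s' p' _) = injective (enough {S} s) (enough {S'} s') p p'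
      target : ∀ {S} → ∣ S ∣ ≡ k → ∃ (Goes S) → ∃ λ Z → (∣ Z ∣ ≡ k × InducedCopWin (B n) Z) × Target S Z
      target s (just Y , p) = recentre centre zero Y ,
        (trans (recentre-size centre zero Y (proj₁ (to-centred p))) (trans (proj₂ (to-centred p)) s) ,
         B-centred-copwin (recentre-centre centre zero Y)) , centred s p refl
      target s (nothing , p) = spare-set true true ,
        (trans (cong (λ k → suc (suc (suc k))) (∣⊥∣≡0 m)) (trans (sym (to-spare p)) s) , B-spare-copwin true true) , spare s p refl

theorem4p8 : (n : ℕ) → 7 ≤ n → (G : Graph n) → Bicyclic G → G ⪯CW B n
theorem4p8 n 7≤n G bi zero b a refl refl = z≤n
theorem4p8 (suc (suc (suc (suc m)))) 7≤n G bi (suc zero) b a = W₁≤ {G = G}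
theorem4p8 (suc (suc (suc (suc m)))) 7≤n G bi (suc (suc zero)) b a = W₂≤ {G = G} bi
theorem4p8 (suc (suc (suc (suc m)))) 7≤n G bi (suc (suc (suc k))) b a =
  W₃≤ (bicyclic-injection G bi 7≤n) (s≤s (s≤s (s≤s z≤n)))
theorem4p8 zero () G bi (suc k)
theorem4p8 (suc zero) (s≤s ()) G bi (suc k)
theorem4p8 (suc (suc zero)) (s≤s (s≤s ())) G bi (suc k)
theorem4p8 (suc (suc (suc zero))) (s≤s (s≤s (s≤s ()))) G bi (suc k)
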